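{- Let $\mathcal I,\mathcal J$ be ideals on $\omega$. If $\mathcal I$ contains a tall summable ideal and Player I has a winning strategy in the game $G(\mathcal J,A,f)$ for all $A\notin\mathcal J$ and all $\mathcal J$-to-one functions $f:A\to\omega$ (in particular, if $\mathcal I$ contains a tall summable ideal and $\mathcal J$ is a Borel ideal such that for each $A\notin\mathcal J$ the ideal $\mathcal J\restriction A$ is not $\le_K$-above any tall summable ideal), then $$\operatorname{cov}(\mathcal M)\le\mathfrak{fip}(\mathcal I,\mathcal J,\omega^\omega).$$
   Context: An ideal on a set $X$ is a family of subsets of $X$ closed under finite unions and subsets, containing all finite subsets of $X$ and not containing $X$; $\mathcal J^+=\mathcal P(X)\setminus\mathcal J$. Borel refers to the topology of $\mathcal P(\omega)\cong\{0,1\}^\omega$. $\operatorname{cov}(\mathcal M)$ is the least number of meager sets covering the real line; $\mathfrak c=2^{\aleph_0}$. A summable ideal is $\mathcal I_g=\{A\subseteq\omega:\sum_{n\in A}g(n)<\infty\}$ with $g:\omega\to[0,\infty)$, $\sum_{n\in\omega}g(n)=\infty$; it is tall (every infinite subset of $\omega$ contains an infinite member) iff $g(n)\to0$. $\mathcal J\restriction A=\{B\cap A:B\in\mathcal J\}$ is an ideal on $A$ for $A\notin\mathcal J$; it is $\le_K$-above $\mathcal I_g$ if there is $f:A\to\omega$ with $f^{ -1}[B]\in\mathcal J\restriction A$ for all $B\in\mathcal I_g$. A function $f:A\to\omega$ is $\mathcal J$-to-one if $f^{ -1}[\{n\}]\in\mathcal J$ for every $n$. The game $G(\mathcal J,A,f)$: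 first Player I plays $k_0\in\omega$; then, for $n=0,1,2,\dots$, Player II plays a finite set $G_n\subseteq\omega$ and Player I responds with $(F_n,k_{n+1})$, where $F_n\subseteq\omega$ is finite, $F_n\cap G_n=\emptyset$, $|F_n|\le k_n$, and $k_{n+1}\in\omega$. Player I wins iff $f^{ -1}[\bigcup_nF_n]\notin\mathcal J\restriction A$; otherwise Player II wins. A nonempty family $\mathcal A\subseteq\mathcal P(\omega)$ has $\mathcal J^+$-FIP if $\bigcap F\in\mathcal J^+$ for each finite $F\subseteq\mathcal A$. $\mathfrak{fip}(\mathcal I,\mathcal J,\mathcal F)$ (for $\mathcal F\subseteq\omega^\omega$) is the minimum of the set consisting of $\mathfrak c^+$ and all cardinals $|\mathcal A|$ such that $\mathcal A\subseteq\mathcal P(\omega)$ has $\mathcal J^+$-FIP and it is not true that for every $f\in\mathcal F$ there is $B\in\mathcal I$ such that $\mathcal A\cup\{f^{ -1}[B]\}$ has $\mathcal J^+$-FIP. -}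

module Defs where

open import Algebra.Bundles using (CommutativeMonoid)
open import Data.Bool.Base using (Bool)
open import Data.List.Base using (List; []; _∷_; foldr; map; length; deduplicate; applyUpTo)
open import Data.List.Membership.Propositional using () renaming (_∈_ to _∈ₗ_)
open import Data.List.Relation.Unary.All using (All)
open import Data.List.Relation.Unary.Unique.Propositional using (Unique)
open import Data.Nat.Base as ℕ using (ℕ; zero; suc)
import Data.Nat.Properties as ℕₚ
open import Data.Product.Base using (Σ; Σ-syntax; ∃; ∃-syntax; _×_; _,_; proj₁; proj₂)
open import Data.Rational.Base as ℚ using (ℚ; 0ℚ; ½; ∣_∣)
import Data.Rational.Properties as ℚₚ
open import Algebra.Properties.CommutativeSemigroup
  (CommutativeMonoid.commutativeSemigroup ℚₚ.+-0-commutativeMonoid) using (interchange)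
open import Data.Sum.Base using (_⊎_)
open import Function.Bundles using (Injection; Bijection; _⇔_)
open import Level using (Level; 0ℓ; _⊔_) renaming (suc to lsuc)
open import Relation.Binary.Bundles using (Setoid)
import Relation.Binary.Construct.On as On
open import Relation.Binary.PropositionalEquality using (_≡_; sym; trans; cong; subst; _→-setoid_)
open import Relation.Nullary.Negation using (¬_)
open import Relation.Unary
  using (Pred; _∈_; _∉_; _⊆_; _≐_; _∩_; _∪_; ∁; U; Empty; Satisfiable; ⋃; _⊢_)
open import Relation.Unary.Relation.Binary.Equality using (≐-setoid)

private
  variable
    a b ℓ ℓ′ ℓ₁ ℓ₂ : Level

1ℓ : Level
1ℓ = lsuc 0ℓ

------------------------------------------------------------------------
-- The real line

-- Reals are Cauchy sequences of rationals.  They are not quotiented: the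
-- order below only depends on the real number represented, so a set of
-- sequences and its closure under "same limit" are nowhere dense, or
-- meager, together, and covering is insensitive to the difference.

record ℝ : Set where
  constructor mkℝ
  field
    seq    : ℕ → ℚ
    cauchy : ∀ ε → 0ℚ ℚ.< ε →
             ∃[ N ] (∀ m n → N ℕ.≤ m → N ℕ.≤ n → ∣ seq m ℚ.- seq n ∣ ℚ.< ε)

open ℝ public

infix 4 _<ℝ_ _≤ℝ_
infixl 6 _+ℝ_

fromℚ : ℚ → ℝ
fromℚ q = mkℝ (λ _ → q) λ ε 0<ε →
  0 , λ _ _ _ _ → subst (λ d → ∣ d ∣ ℚ.< ε) (sym (ℚₚ.+-inverseʳ q)) 0<ε

0ℝ : ℝ
0ℝ = fromℚ 0ℚ

_<ℝ_ : ℝ → ℝ → Set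
x <ℝ y = ∃[ ε ] 0ℚ ℚ.< ε × ∃[ N ] (∀ n → N ℕ.≤ n → seq x n ℚ.+ ε ℚ.≤ seq y n)

_≤ℝ_ : ℝ → ℝ → Set
x ≤ℝ y = ¬ (y <ℝ x)

_+ℝ_ : ℝ → ℝ → ℝ
x +ℝ y = mkℝ (λ n → seq x n ℚ.+ seq y n) λ ε 0<ε →
  let δ         = ½ ℚ.* ε
      0<δ       = subst (ℚ._< δ) (ℚₚ.*-zeroʳ ½) (ℚₚ.*-monoʳ-<-pos ½ 0<ε)
      (M , x-M) = cauchy x δ 0<δ
      (N , y-N) = cauchy y δ 0<δ
  in M ℕ.⊔ N , λ m n h k →
     let x< = x-M m n (ℕₚ.m⊔n≤o⇒m≤o M N h) (ℕₚ.m⊔n≤o⇒m≤o M N k)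
         y< = y-N m n (ℕₚ.m⊔n≤o⇒n≤o M N h) (ℕₚ.m⊔n≤o⇒n≤o M N k)
         open ℚₚ.≤-Reasoning
     in begin-strict
       ∣ (seq x m ℚ.+ seq y m) ℚ.- (seq x n ℚ.+ seq y n) ∣
         ≡⟨ cong ∣_∣ (rearrange (seq x m) (seq y m) (seq x n) (seq y n)) ⟩
       ∣ (seq x m ℚ.- seq x n) ℚ.+ (seq y m ℚ.- seq y n) ∣
         ≤⟨ ℚₚ.∣p+q∣≤∣p∣+∣q∣ (seq x m ℚ.- seq x n) (seq y m ℚ.- seq y n) ⟩
       ∣ seq x m ℚ.- seq x n ∣ ℚ.+ ∣ seq y m ℚ.- seq y n ∣
         <⟨ ℚₚ.+-mono-< x< y< ⟩
       δ ℚ.+ δ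
         ≡⟨ halves ε ⟩
       ε ∎
  where
  rearrange : ∀ p q r s → (p ℚ.+ q) ℚ.- (r ℚ.+ s) ≡ (p ℚ.- r) ℚ.+ (q ℚ.- s)
  rearrange p q r s = trans (cong (p ℚ.+ q ℚ.+_) (ℚₚ.neg-distrib-+ r s))
                            (interchange p q (ℚ.- r) (ℚ.- s))
  halves : ∀ p → ½ ℚ.* p ℚ.+ ½ ℚ.* p ≡ p
  halves p = trans (sym (ℚₚ.*-distribʳ-+ p ½ ½)) (ℚₚ.*-identityˡ p)

sumℝ : List ℝ → ℝ
sumℝ = foldr _+ℝ_ 0ℝ

Interval : ℚ → ℚ → Pred ℝ 0ℓ
Interval p q x = fromℚ p <ℝ x × x <ℝ fromℚ q

Closure : Pred ℝ 0ℓ → Pred ℝ 0ℓ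
Closure S x = ∀ p q → x ∈ Interval p q → Satisfiable (Interval p q ∩ S)

Interior : Pred ℝ 0ℓ → Pred ℝ 0ℓ
Interior S x = ∃[ p ] ∃[ q ] x ∈ Interval p q × Interval p q ⊆ S

NowhereDense : Pred ℝ 0ℓ → Set
NowhereDense S = Empty (Interior (Closure S))

Meager : Pred (Pred ℝ 0ℓ) 1ℓ
Meager S = ∃[ N ] (∀ (n : ℕ) → NowhereDense (N n)) × S ≐ ⋃ ℕ N

------------------------------------------------------------------------
-- Cardinals

-- A cardinal is represented by a setoid, up to bijection.  Setoids give
-- the correct count for families of sets, where equality is extensional
-- and membership proofs are irrelevant.

Cardinal : Set₁
Cardinal = Setoid 0ℓ 0ℓ

infix 4 _≼_ _≺_

_≼_ : Setoid a ℓ₁ → Setoid b ℓ₂ → Set (a ⊔ b ⊔ ℓ₁ ⊔ ℓ₂)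
κ ≼ μ = Injection κ μ

_≺_ : Setoid a ℓ₁ → Setoid b ℓ₂ → Set (a ⊔ b ⊔ ℓ₁ ⊔ ℓ₂)
κ ≺ μ = κ ≼ μ × ¬ (μ ≼ κ)

FamilySetoid : {X : Set} → Pred (Pred X 0ℓ) ℓ → Setoid (1ℓ ⊔ ℓ) 0ℓ
FamilySetoid {X = X} 𝒜 = On.setoid {B = ∃ 𝒜} (≐-setoid X 0ℓ) proj₁

_HasCardinality_ : {X : Set} → Pred (Pred X 0ℓ) ℓ → Cardinal → Set (1ℓ ⊔ ℓ)
𝒜 HasCardinality κ = Bijection κ (FamilySetoid 𝒜)

-- A predicate rather than an operation: producing the minimum of a class
-- of cardinals requires excluded middle and choice.

IsMinimum : Pred Cardinal ℓ → Cardinal → Set (1ℓ ⊔ ℓ)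
IsMinimum C κ = κ ∈ C × (∀ μ → μ ∈ C → κ ≼ μ)

𝔠 : Cardinal
𝔠 = ℕ →-setoid Bool

Is𝔠⁺ : Pred Cardinal 1ℓ
Is𝔠⁺ = IsMinimum (λ μ → 𝔠 ≺ μ)

IsMeagerCover : Pred (Pred (Pred ℝ 0ℓ) 0ℓ) 1ℓ
IsMeagerCover 𝒞 = 𝒞 ⊆ Meager × (∀ x → ∃[ S ] S ∈ 𝒞 × x ∈ S)

IsCovM : Pred Cardinal 1ℓ
IsCovM = IsMinimum λ κ → ∃[ 𝒞 ] IsMeagerCover 𝒞 × 𝒞 HasCardinality κ

------------------------------------------------------------------------
-- Ideals on ω

Subset : Set₁
Subset = Pred ℕ 0ℓ

Family : (ℓ : Level) → Set (1ℓ ⊔ lsuc ℓ)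
Family ℓ = Pred Subset ℓ

FinSet : Set
FinSet = List ℕ

⟦_⟧ : FinSet → Subset
⟦ F ⟧ n = n ∈ₗ F

#_ : FinSet → ℕ
# F = length (deduplicate ℕₚ._≟_ F)

Finite : Subset → Set
Finite S = ∃[ F ] S ⊆ ⟦ F ⟧

record IsIdeal (𝓙 : Family 0ℓ) : Set₁ where
  field
    ∪-closed : ∀ {S T} → S ∈ 𝓙 → T ∈ 𝓙 → S ∪ T ∈ 𝓙
    ⊆-closed : ∀ {S T} → S ⊆ T → T ∈ 𝓙 → S ∈ 𝓙
    finite   : ∀ {S} → Finite S → S ∈ 𝓙
    proper   : U ∉ 𝓙

Tall : Family 0ℓ → Set₁
Tall 𝓙 = ∀ S → ¬ Finite S → ∃[ T ] T ⊆ S × ¬ Finite T × T ∈ 𝓙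

-- The sum of a nonnegative family is the supremum of its finite subsums.

Summable : (ℕ → ℝ) → Family 0ℓ
Summable g S = ∃[ M ] (∀ ns → Unique ns → All (_∈ S) ns → sumℝ (map g ns) ≤ℝ M)

record TallSummable (g : ℕ → ℝ) : Set₁ where
  field
    nonneg    : ∀ n → 0ℝ ≤ℝ g n
    divergent : U ∉ Summable g
    tall      : Tall (Summable g)

_↾_ : Family 0ℓ → Subset → Family 1ℓ
(𝓙 ↾ A) S = ∃[ B ] B ∈ 𝓙 × S ≐ B ∩ A

-- Functions on A.  The membership proof is irrelevant, so that the value
-- depends on the element alone.

_⟶ω : Subset → Set
A ⟶ω = ∀ n → .(n ∈ A) → ℕ

preimage : (A : Subset) → A ⟶ω → Subset → Subset
preimage A f B n = Σ[ n∈A ∈ n ∈ A ] f n n∈A ∈ B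

-- KatetovAbove A 𝓚 𝓘 : the family 𝓚 of subsets of A is ≤_K-above 𝓘.

KatetovAbove : Subset → Family ℓ → Family ℓ′ → Set (1ℓ ⊔ ℓ ⊔ ℓ′)
KatetovAbove A 𝓚 𝓘 = Σ[ f ∈ A ⟶ω ] (∀ B → B ∈ 𝓘 → preimage A f B ∈ 𝓚)

ToOne : Family 0ℓ → (A : Subset) → A ⟶ω → Set
ToOne 𝓙 A f = ∀ n → preimage A f (_≡ n) ∈ 𝓙

-- Open and Borel in 𝒫(ω) ≅ {0,1}^ω.

Open : Family 0ℓ → Set₁
Open 𝒰 = ∀ S → S ∈ 𝒰 →
  ∃[ n ] (∀ T → (∀ m → m ℕ.< n → (m ∈ S) ⇔ (m ∈ T)) → T ∈ 𝒰)

data Borel : Family 0ℓ → Set₁ where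
  open-set   : ∀ {𝒰} → Open 𝒰 → Borel 𝒰
  complement : ∀ {𝒰} → Borel 𝒰 → Borel (∁ 𝒰)
  union      : ∀ {𝒰 : ℕ → Family 0ℓ} → (∀ n → Borel (𝒰 n)) → Borel (⋃ ℕ 𝒰)
  ≐-closed   : ∀ {𝒰 𝒱} → 𝒰 ≐ 𝒱 → Borel 𝒰 → Borel 𝒱

------------------------------------------------------------------------
-- The game G(𝓙, A, f)

record StrategyI : Set where
  field
    first   : ℕ
    -- The answer (F_n , k_{n+1}) to the moves G_0 , … , G_n of Player II.
    respond : List FinSet → FinSet × ℕ

module Play (σ : StrategyI) (G : ℕ → FinSet) where
  open StrategyI σ

  response : ℕ → FinSet × ℕ
  response n = respond (applyUpTo G (suc n))

  F : ℕ → FinSet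
  F n = proj₁ (response n)

  k : ℕ → ℕ
  k zero    = first
  k (suc n) = proj₂ (response n)

IsWinning : Family 0ℓ → (A : Subset) → A ⟶ω → StrategyI → Set₁
IsWinning 𝓙 A f σ = ∀ G → let open Play σ G in
  (∀ n → Empty (⟦ F n ⟧ ∩ ⟦ G n ⟧) × # F n ℕ.≤ k n) ×
  preimage A f (⋃ ℕ λ n → ⟦ F n ⟧) ∉ (𝓙 ↾ A)

PlayerIWins : Family 0ℓ → (A : Subset) → A ⟶ω → Set₁
PlayerIWins 𝓙 A f = ∃[ σ ] IsWinning 𝓙 A f σ

------------------------------------------------------------------------
-- The cardinal 𝔣𝔦𝔭(𝓘, 𝓙, 𝓕)

⋂ₗ : List Subset → Subset
⋂ₗ = foldr _∩_ U

HasFIP⁺ : Family 0ℓ → Family 0ℓ → Set₁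
HasFIP⁺ 𝓙 𝒜 = Satisfiable 𝒜 × (∀ Ss → All (_∈ 𝒜) Ss → ⋂ₗ Ss ∉ 𝓙)

_∪｛_｝ : Family 0ℓ → Subset → Family 0ℓ
(𝒜 ∪｛ S ｝) T = T ∈ 𝒜 ⊎ T ≐ S

Extendable : Family 0ℓ → Family 0ℓ → Pred (ℕ → ℕ) 0ℓ → Family 0ℓ → Set₁
Extendable 𝓘 𝓙 𝓕 𝒜 = ∀ f → f ∈ 𝓕 → ∃[ B ] B ∈ 𝓘 × HasFIP⁺ 𝓙 (𝒜 ∪｛ f ⊢ B ｝)

IsFip : Family 0ℓ → Family 0ℓ → Pred (ℕ → ℕ) 0ℓ → Pred Cardinal 1ℓ
IsFip 𝓘 𝓙 𝓕 = IsMinimum λ κ →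
  Is𝔠⁺ κ ⊎
  (∃[ 𝒜 ] HasFIP⁺ 𝓙 𝒜 × ¬ Extendable 𝓘 𝓙 𝓕 𝒜 × 𝒜 HasCardinality κ)

ω^ω : Pred (ℕ → ℕ) 0ℓ
ω^ω = U

module Submission where

-- Say that n is heavy for a 𝓙-positive set A if A ∩ f⁻¹{n} is 𝓙-positive.  A sequence c of finite sets,
-- those c n of g-mass above 2⁻ⁿ being dropped, unites to a set B in the summable ideal.  If A has infinitely
-- many heavy points, a Cohen-generic B contains one of them; if A has none, f is 𝓙-to-one on A, and a generic
-- B contains all answers of Player I in some run of the game against his winning strategy, where Player II
-- demands such long initial segments that the answers are small.  In both cases A ∩ f⁻¹[B] is 𝓙-positive;
-- heavy points that are finite in number for some A are thrown into B.  So each finite subfamily of 𝒜 is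
-- served by comeagerly many B, and if no B serves all of 𝒜 we get a cover of the line by |𝒜|^{<ω} meager
-- sets; this number is |𝒜| unless 𝒜 is countable, when some c is generic for all the requirements.
--
-- Borel determinacy is avoided as follows.  A Borel ideal is generated by the sets coded by a closed subset
-- of the Baire space.  In the unfolded game Player II also builds a point of that closed set, waiting w(i)
-- rounds before he commits to the value w(i).  After each round there are only finitely many ways in which he
-- can have committed so far; so if Player I wins the unfolded game he wins the game itself by playing the
-- union of his answers to all of them.  Otherwise Player II wins the unfolded game, and there are blocks
-- [mᵢ, mᵢ₊₁) so long that, while Player I has played numbers below mᵢ only, Player II demands numbers below
-- mᵢ₊₁ only.  Giving the points of the i-th block weight 2⁻ⁱ defines a tall summable ideal which 𝓙 ↾ A is
-- above: almost every slice of a set of finite weight is short enough to be played, and the even and the odd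
-- slices make up two runs that Player II wins.

open import Defs
open import Algebra.Bundles using (CommutativeMonoid)
open import Axiom.ExcludedMiddle using (ExcludedMiddle)
open import Axiom.Extensionality.Propositional using (Extensionality)
open import Data.Bool.Base using (Bool; true; false; not; if_then_else_)
open import Data.Bool.Properties using (⇔→≡; not-¬; ¬-not)
open import Data.Empty using (⊥; ⊥-elim)
import Data.Integer.Base as ℤ
open import Data.Integer.Base using (ℤ; +_)
import Data.Integer.DivMod as ℤ
import Data.Integer.Properties as ℤₚ
open import Data.Integer.Tactic.RingSolver using (solve-∀)
open import Data.List.Base
  using (List; []; _∷_; _++_; _∷ʳ_; length; applyUpTo; map; upTo; replicate; deduplicate; drop;
         concatMap; filter; cartesianProduct; cartesianProductWith)
open import Data.List.Membership.Propositional using () renaming (_∈_ to _∈ₗ_)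
open import Data.List.Membership.Propositional.Properties
  using (∈-upTo⁺; ∈-upTo⁻; ∈-++⁺ˡ; ∈-++⁺ʳ; ∈-++⁻; ∈-map⁺; ∈-∃++; ∈-deduplicate⁻; ∈-deduplicate⁺; ∈-concat⁺′;
         ∈-filter⁺; ∈-filter⁻; ∈-cartesianProduct⁺; ∈-cartesianProductWith⁺)
import Data.List.Properties as Listₚ
import Data.List.Relation.Unary.All as All
open import Data.List.Relation.Unary.All using (All; []; _∷_)
import Data.List.Relation.Unary.All.Properties as Allₚ
open import Data.List.Relation.Unary.AllPairs using ([]; _∷_)
open import Data.List.Relation.Unary.Any using (here; there)
import Data.Nat.Base as ℕ
open import Data.Nat.Base using (ℕ; zero; suc; z≤n; s≤s)
open import Data.Nat.ListAction using (sum)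
import Data.Nat.Properties as ℕₚ
open import Data.List.Relation.Unary.Unique.DecPropositional.Properties ℕₚ._≟_ using (deduplicate-!)
open import Data.List.Relation.Unary.Unique.Propositional using (Unique)
import Data.List.Relation.Unary.Unique.Propositional.Properties as Uniqueₚ
open import Data.Product.Base using (Σ; Σ-syntax; ∃; ∃-syntax; _×_; _,_; proj₁; proj₂)
import Data.Rational.Base as ℚ
open import Data.Rational.Base using (ℚ; 0ℚ; 1ℚ; ½; ∣_∣)
import Data.Rational.Properties as ℚₚ
open import Algebra.Properties.CommutativeSemigroup
  (CommutativeMonoid.commutativeSemigroup ℚₚ.+-0-commutativeMonoid) using (interchange; x∙yz≈y∙xz)
import Data.Rational.Unnormalised.Base as ℚᵘ
import Data.Rational.Unnormalised.Properties as ℚᵘₚ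
open import Data.Sum.Base using (_⊎_; inj₁; inj₂)
import Data.Unit.Base as Unit
open import Function.Base using (_∘_; id)
open import Function.Bundles using (mk⇔; Injection; Bijection)
open import Level using (Level; 0ℓ)
open import Relation.Binary.Bundles using (Setoid)
import Relation.Binary.Construct.On as On
open import Relation.Binary.Definitions using (tri<; tri≈; tri>)
open import Relation.Binary.PropositionalEquality
  using (_≡_; _≢_; refl; sym; trans; cong; cong₂; subst; subst₂)
open import Relation.Binary.PropositionalEquality.WithK using (≡-irrelevant)
open import Relation.Nullary.Decidable.Core using (Dec; yes; no)
open import Relation.Nullary.Negation using (¬_)
open import Relation.Unary using (Pred; _∈_; _∉_; _⊆_; _≐_; ∅; ∁; _∪_; ⋃; _⊢_)
open import Relation.Unary.Properties using (≐-refl; ≐-sym; ≐-trans)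
open import Relation.Unary.Relation.Binary.Equality using (≐-setoid)

private
  variable
    a ℓ : Level
    A : Set a

-- Coding of pairs and lists by numbers; limits of growing lists

shift : (ℕ → A) → ℕ → ℕ → A
shift z n i = z (n ℕ.+ i)

-- The walk (0,0), (0,1), (1,0), (0,2), (1,1), … along the antidiagonals.
next-pair : ℕ × ℕ → ℕ × ℕ
next-pair (zero  , b) = suc b , 0
next-pair (suc a , b) = a , suc b

unpair : ℕ → ℕ × ℕ
unpair zero    = 0 , 0
unpair (suc n) = next-pair (unpair n)

-- The induction runs the walk backwards: `(a , suc b)` is preceded by `(suc a , b)`, and
-- `(suc a , 0)` by `(0 , a)` on the previous diagonal.
pair-on-diagonal : ∀ s a b → a ℕ.+ b ≡ s → ∃[ n ] unpair n ≡ (a , b)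
pair-on-diagonal zero    zero    zero    refl = 0 , refl
pair-on-diagonal (suc s) a       (suc b) eq   =
  let (n , e) = pair-on-diagonal (suc s) (suc a) b (trans (sym (ℕₚ.+-suc a b)) eq)
  in suc n , cong next-pair e
pair-on-diagonal (suc s) (suc a) zero    eq   =
  let (n , e) = pair-on-diagonal s 0 a (trans (sym (ℕₚ.+-identityʳ a)) (ℕₚ.suc-injective eq))
  in suc n , cong next-pair e

pair : ℕ → ℕ → ℕ
pair a b = proj₁ (pair-on-diagonal (a ℕ.+ b) a b refl)

unpair-pair : ∀ a b → unpair (pair a b) ≡ (a , b)
unpair-pair a b = proj₂ (pair-on-diagonal (a ℕ.+ b) a b refl)

unpair-≤ : ∀ n → proj₁ (unpair n) ℕ.+ proj₂ (unpair n) ℕ.≤ n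
unpair-≤ zero = z≤n
unpair-≤ (suc n) with unpair n | unpair-≤ n
... | zero  , b | h = s≤s (subst (ℕ._≤ n) (sym (ℕₚ.+-identityʳ b)) h)
... | suc a , b | h = ℕₚ.m≤n⇒m≤1+n (subst (ℕ._≤ n) (sym (ℕₚ.+-suc a b)) h)

≤-pair : ∀ a b → b ℕ.≤ pair a b
≤-pair a b = ℕₚ.≤-trans
  (subst (λ p → b ℕ.≤ proj₁ p ℕ.+ proj₂ p) (sym (unpair-pair a b)) (ℕₚ.m≤n+m b a))
  (unpair-≤ (pair a b))

-- The length is stored in front of the nested pairs, so decoding recurses on it and every number
-- decodes to some list.
decode-length : ℕ → ℕ → List ℕ
decode-length zero    m = []
decode-length (suc k) m = proj₁ (unpair m) ∷ decode-length k (proj₂ (unpair m))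

decode : ℕ → List ℕ
decode n = decode-length (proj₁ (unpair n)) (proj₂ (unpair n))

code-tail : List ℕ → ℕ
code-tail []      = 0
code-tail (x ∷ l) = pair x (code-tail l)

code : List ℕ → ℕ
code l = pair (length l) (code-tail l)

decode-length-code : ∀ l → decode-length (length l) (code-tail l) ≡ l
decode-length-code [] = refl
decode-length-code (x ∷ l) rewrite unpair-pair x (code-tail l) = cong (x ∷_) (decode-length-code l)

decode-code : ∀ l → decode (code l) ≡ l
decode-code l rewrite unpair-pair (length l) (code-tail l) = decode-length-code l

lookup-or : A → List A → ℕ → A
lookup-or d []      _       = d
lookup-or d (x ∷ l) zero    = x
lookup-or d (x ∷ l) (suc n) = lookup-or d l n

applyUpTo-lookup : ∀ (d : A) l → applyUpTo (lookup-or d l) (length l) ≡ l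
applyUpTo-lookup d []      = refl
applyUpTo-lookup d (x ∷ l) = cong (x ∷_) (applyUpTo-lookup d l)

lookup-++ : ∀ (d : A) l e n → n ℕ.< length l → lookup-or d (l ++ e) n ≡ lookup-or d l n
lookup-++ d (x ∷ l) e zero    _         = refl
lookup-++ d (x ∷ l) e (suc n) (s≤s n<l) = lookup-++ d l e n n<l

applyUpTo-cong : ∀ {f g : ℕ → A} n → (∀ i → i ℕ.< n → f i ≡ g i) → applyUpTo f n ≡ applyUpTo g n
applyUpTo-cong zero    _  = refl
applyUpTo-cong (suc n) eq = cong₂ _∷_ (eq 0 (s≤s z≤n)) (applyUpTo-cong n λ i i<n → eq (suc i) (s≤s i<n))

applyUpTo-injective : ∀ {f g : ℕ → A} n → applyUpTo f n ≡ applyUpTo g n → ∀ i → i ℕ.< n → f i ≡ g i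
applyUpTo-injective (suc n) eq zero    _         = Listₚ.∷-injectiveˡ eq
applyUpTo-injective (suc n) eq (suc i) (s≤s i<n) = applyUpTo-injective n (Listₚ.∷-injectiveʳ eq) i i<n

-- An entry never changes once some list of the chain is long enough to contain it. The generic
-- sequence, the runs of the game and the point of the base that Player II builds are all obtained
-- as such limits.
chain-limit : (d : A) (l : ℕ → List A) → (∀ n → ∃[ e ] l (suc n) ≡ l n ++ e) →
              (∀ N → ∃[ n ] N ℕ.≤ length (l n)) →
              ∃[ w ] ∀ n → l n ≡ applyUpTo w (length (l n))
chain-limit {A = A} d l step unbounded = w , λ n →
  trans (sym (applyUpTo-lookup d (l n))) (applyUpTo-cong (length (l n)) λ i i<n → agree i n i<n)
  where
  extend : ∀ n k → ∃[ e ] l (k ℕ.+ n) ≡ l n ++ e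
  extend n zero    = [] , sym (Listₚ.++-identityʳ (l n))
  extend n (suc k) =
    let (e , p) = extend n k
        (e′ , p′) = step (k ℕ.+ n)
    in e ++ e′ , trans p′ (trans (cong (_++ e′) p) (Listₚ.++-assoc (l n) e e′))
  extend-≤ : ∀ {n m} → n ℕ.≤ m → ∃[ e ] l m ≡ l n ++ e
  extend-≤ {n} {m} n≤m = subst (λ j → ∃[ e ] l j ≡ l n ++ e) (ℕₚ.m∸n+n≡m n≤m) (extend n (m ℕ.∸ n))
  mono : ∀ {n m i} → n ℕ.≤ m → i ℕ.< length (l n) → lookup-or d (l m) i ≡ lookup-or d (l n) i
  mono {n} {m} {i} n≤m i<n =
    let (e , p) = extend-≤ n≤m
    in trans (cong (λ x → lookup-or d x i) p) (lookup-++ d (l n) e i i<n)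
  t : ℕ → ℕ
  t i = proj₁ (unbounded (suc i))
  w : ℕ → A
  w i = lookup-or d (l (t i)) i
  agree : ∀ i n → i ℕ.< length (l n) → lookup-or d (l n) i ≡ w i
  agree i n i<n = trans (sym (mono (ℕₚ.m≤m⊔n n (t i)) i<n))
                        (mono (ℕₚ.m≤n⊔m n (t i)) (proj₂ (unbounded (suc i))))

module _ (em : ∀ {ℓ} → ExcludedMiddle ℓ) (ext : ∀ {a b} → Extensionality a b) where

  -- Classical logic and choice

  by-contradiction : {P : Set ℓ} → ¬ ¬ P → P
  by-contradiction {P = P} h with em {P = P}
  ... | yes x = x
  ... | no ¬x = ⊥-elim (h ¬x)

  ¬∀⇒∃¬ : {P : A → Set ℓ} → ¬ (∀ x → P x) → ∃ λ x → ¬ P x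
  ¬∀⇒∃¬ h = by-contradiction λ none → h λ x → by-contradiction λ ¬px → none (x , ¬px)

  abstract
    -- Excluded middle turns a proposition of any level into one in Set.
    truth : Set ℓ → Bool
    truth P with em {P = P}
    ... | yes _ = true
    ... | no  _ = false

    truth⁺ : {P : Set ℓ} → P → truth P ≡ true
    truth⁺ {P = P} x with em {P = P}
    ... | yes _ = refl
    ... | no ¬x = ⊥-elim (¬x x)

    truth⁻ : {P : Set ℓ} → truth P ≡ true → P
    truth⁻ {P = P} e with em {P = P} | e
    ... | yes x | _ = x
    ... | no  _ | ()

  truth-cong : ∀ {ℓ′} {P : Set ℓ} {Q : Set ℓ′} → (P → Q) → (Q → P) → truth P ≡ truth Q
  truth-cong f g = ⇔→≡ {z = true} (mk⇔ (λ e → truth⁺ (f (truth⁻ e))) (λ e → truth⁺ (g (truth⁻ e))))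

  -- Excluded middle, being a function on types, serves as a choice function. The predicate is
  -- Boolean-valued so that extensionality makes equivalent predicates equal, and equal predicates
  -- yield the same witness.
  choose-or : A → (A → Bool) → A
  choose-or {A = A} d P with em {P = Σ A λ x → P x ≡ true}
  ... | yes (x , _) = x
  ... | no  _       = d

  choose-or-spec : ∀ (d : A) (P : A → Bool) x → P x ≡ true → P (choose-or d P) ≡ true
  choose-or-spec {A = A} d P x e with em {P = Σ A λ x → P x ≡ true}
  ... | yes (_ , e′) = e′
  ... | no  none     = ⊥-elim (none (x , e))

  -- `rep x` uses `x` itself as the default, so representatives agree on a class only because the
  -- default does not matter when a witness exists.
  choose-or-default : ∀ (d d′ : A) (P : A → Bool) x → P x ≡ true → choose-or d P ≡ choose-or d′ P
  choose-or-default {A = A} d d′ P x e with em {P = Σ A λ x → P x ≡ true}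
  ... | yes _    = refl
  ... | no  none = ⊥-elim (none (x , e))

  module Representatives {c ℓ} (S : Setoid c ℓ) where
    open Setoid S using (Carrier; _≈_) renaming (refl to ≈-refl; sym to ≈-sym; trans to ≈-trans)

    rep : Carrier → Carrier
    rep x = choose-or x λ y → truth (x ≈ y)

    rep-≈ : ∀ x → x ≈ rep x
    rep-≈ x = truth⁻ (choose-or-spec x (λ y → truth (x ≈ y)) x (truth⁺ ≈-refl))

    rep-cong : ∀ {x y} → x ≈ y → rep x ≡ rep y
    rep-cong {x} {y} x≈y = trans
      (cong (choose-or x) (ext λ z → truth-cong (≈-trans (≈-sym x≈y)) (≈-trans x≈y)))
      (choose-or-default x y (λ z → truth (y ≈ z)) y (truth⁺ ≈-refl))

  unbounded⇐infinite : {S : Subset} → ¬ Finite S → ∀ N → ∃[ x ] x ∈ S × N ℕ.≤ x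
  unbounded⇐infinite {S} inf N = by-contradiction λ none → inf
    (upTo N , λ {x} x∈S → ∈-upTo⁺ (ℕₚ.≰⇒> λ N≤x → none (x , x∈S , N≤x)))

  list-bound : (l : List ℕ) → ∃[ N ] ∀ {x} → x ∈ₗ l → x ℕ.< N
  list-bound [] = 0 , λ ()
  list-bound (x ∷ l) = let (N , h) = list-bound l in suc x ℕ.⊔ N ,
    λ { (here refl) → ℕₚ.m≤m⊔n (suc x) N
      ; (there y∈l) → ℕₚ.<-≤-trans (h y∈l) (ℕₚ.m≤n⊔m (suc x) N) }

  infinite⇐unbounded : {S : Subset} → (∀ N → ∃[ x ] x ∈ S × N ℕ.≤ x) → ¬ Finite S
  infinite⇐unbounded unb (l , S⊆l) =
    let (N , below) = list-bound l
        (x , x∈S , N≤x) = unb N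
    in ℕₚ.<⇒≱ (below (S⊆l x∈S)) N≤x

  -- Zorn's lemma and cardinal arithmetic

  module _ {D : Set} where

    infix 4 _⊑_
    _⊑_ : (S S′ : D → Bool) → Set
    S ⊑ S′ = ∀ d → S d ≡ true → S′ d ≡ true

    ⊑-antisym : ∀ {S S′} → S ⊑ S′ → S′ ⊑ S → S ≡ S′
    ⊑-antisym h h′ = ext λ d → ⇔→≡ {z = true} (mk⇔ (h d) (h′ d))

    Union : ((D → Bool) → Bool) → D → Bool
    Union C d = truth (∃[ S ] C S ≡ true × S d ≡ true)

    ⊑-Union : ∀ C S → C S ≡ true → S ⊑ Union C
    ⊑-Union C S S∈C d d∈S = truth⁺ (S , S∈C , d∈S)

    Union-⊑ : ∀ C S → (∀ S′ → C S′ ≡ true → S′ ⊑ S) → Union C ⊑ S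
    Union-⊑ C S h d d∈ = let (S′ , S′∈C , d∈S′) = truth⁻ d∈ in h S′ S′∈C d d∈S′

    IsChain : ((D → Bool) → Bool) → Set
    IsChain C = ∀ S S′ → C S ≡ true → C S′ ≡ true → S ⊑ S′ ⊎ S′ ⊑ S

    module _ (S₀ : D → Bool) (next : (D → Bool) → D → Bool) (inflationary : ∀ S → S ⊑ next S) where

      -- The witness `S` in `gather` keeps the unions nonempty; the empty union need not lie above
      -- `S₀`.
      data Tower : (D → Bool) → Set where
        ground  : Tower S₀
        climb  : ∀ {S} → Tower S → Tower (next S)
        gather : ∀ C S → C S ≡ true → (∀ S′ → C S′ ≡ true → Tower S′) → Tower (Union C)

      ground-⊑ : ∀ {S} → Tower S → S₀ ⊑ S
      ground-⊑ ground                _ d∈ = d∈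
      ground-⊑ (climb {S} t)        d d∈ = inflationary S d (ground-⊑ t d d∈)
      ground-⊑ (gather C S S∈C ts)  d d∈ = ⊑-Union C S S∈C d (ground-⊑ (ts S S∈C) d d∈)

      -- The Bourbaki–Witt argument: members of the tower are comparable because all are extreme.
      Extreme : (D → Bool) → Set
      Extreme S = ∀ {S′} → Tower S′ → S′ ⊑ S → S ⊑ S′ ⊎ next S′ ⊑ S

      extreme-compares : ∀ {S S′} → Tower S → Extreme S → Tower S′ → S′ ⊑ S ⊎ next S ⊑ S′
      extreme-compares t ex ground = inj₁ (ground-⊑ t)
      extreme-compares {S} t ex (climb {S′} t′) with extreme-compares t ex t′
      ... | inj₂ le = inj₂ λ d d∈ → inflationary S′ d (le d d∈)
      ... | inj₁ le with ex t′ le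
      ...   | inj₂ le′ = inj₁ le′
      ...   | inj₁ ge  = inj₂ (subst (λ x → next S ⊑ next x) (⊑-antisym ge le) λ _ d∈ → d∈)
      extreme-compares {S} t ex (gather C S₁ S₁∈C ts) with em {P = ∃[ S′ ] C S′ ≡ true × next S ⊑ S′}
      ... | yes (S′ , S′∈C , le) = inj₂ λ d d∈ → ⊑-Union C S′ S′∈C d (le d d∈)
      ... | no none = inj₁ (Union-⊑ C S λ S′ S′∈C → below S′ S′∈C (extreme-compares t ex (ts S′ S′∈C)))
        where
        below : ∀ S′ → C S′ ≡ true → S′ ⊑ S ⊎ next S ⊑ S′ → S′ ⊑ S
        below S′ S′∈C (inj₁ le) = le
        below S′ S′∈C (inj₂ ge) = ⊥-elim (none (S′ , S′∈C , ge))

      all-extreme : ∀ {S} → Tower S → Extreme S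
      all-extreme ground t′ _ = inj₁ (ground-⊑ t′)
      all-extreme (climb {S} t) {S′} t′ le with extreme-compares t (all-extreme t) t′
      ... | inj₂ ge  = inj₁ ge
      ... | inj₁ le′ with all-extreme t t′ le′
      ...   | inj₁ ge  = inj₂ (subst (λ x → next x ⊑ next S) (⊑-antisym ge le′) λ _ d∈ → d∈)
      ...   | inj₂ le″ = inj₂ λ d d∈ → inflationary S d (le″ d d∈)
      all-extreme (gather C S₁ S₁∈C ts) {S′} t′ le with em {P = ∃[ S ] C S ≡ true × ¬ S ⊑ S′}
      ... | no none = inj₁ (Union-⊑ C S′ λ S S∈C → by-contradiction λ ¬le → none (S , S∈C , ¬le))
      ... | yes (S , S∈C , ¬le) with extreme-compares (ts S S∈C) (all-extreme (ts S S∈C)) t′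
      ...   | inj₂ ge  = ⊥-elim (¬le λ d d∈ → ge d (inflationary S d d∈))
      ...   | inj₁ le′ with all-extreme (ts S S∈C) t′ le′
      ...     | inj₁ ge  = ⊥-elim (¬le ge)
      ...     | inj₂ le″ = inj₂ λ d d∈ → ⊑-Union C S S∈C d (le″ d d∈)

      tower-chain : ∀ {S S′} → Tower S → Tower S′ → S ⊑ S′ ⊎ S′ ⊑ S
      tower-chain {S} t t′ with extreme-compares t (all-extreme t) t′
      ... | inj₁ le = inj₂ le
      ... | inj₂ ge = inj₁ λ d d∈ → ge d (inflationary S d d∈)

    -- Without a maximal member every member of `𝔉` has a strictly larger one, and this defines
    -- `next`. The union `Ω` of the whole tower belongs to the tower, hence so does `next Ω`, which
    -- is then contained in `Ω`.
    zorn : (𝔉 : (D → Bool) → Set) (S₀ : D → Bool) → 𝔉 S₀ →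
           (∀ C S → C S ≡ true → (∀ S′ → C S′ ≡ true → 𝔉 S′) → IsChain C → 𝔉 (Union C)) →
           ∃[ S ] 𝔉 S × (∀ S′ → 𝔉 S′ → S ⊑ S′ → S′ ⊑ S)
    zorn 𝔉 S₀ S₀∈𝔉 closed = by-contradiction λ none → contra none
      where
      module _ (none : ¬ (∃[ S ] 𝔉 S × (∀ S′ → 𝔉 S′ → S ⊑ S′ → S′ ⊑ S))) where
        larger : ∀ S → ∃[ S′ ] S ⊑ S′ × (𝔉 S → 𝔉 S′ × ¬ (S′ ⊑ S))
        larger S with em {P = 𝔉 S}
        ... | no S∉𝔉 = S , (λ _ d∈ → d∈) , λ S∈𝔉 → ⊥-elim (S∉𝔉 S∈𝔉)
        ... | yes S∈𝔉 with em {P = ∃[ S′ ] 𝔉 S′ × S ⊑ S′ × ¬ (S′ ⊑ S)}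
        ...   | yes (S′ , S′∈𝔉 , le , ¬ge) = S′ , le , λ _ → S′∈𝔉 , ¬ge
        ...   | no maximal = ⊥-elim (none (S , S∈𝔉 , λ S′ S′∈𝔉 le →
                  by-contradiction λ ¬ge → maximal (S′ , S′∈𝔉 , le , ¬ge)))
        next : (D → Bool) → D → Bool
        next S = proj₁ (larger S)
        T : (D → Bool) → Set
        T = Tower S₀ next λ S → proj₁ (proj₂ (larger S))
        tower-⊆ : ∀ {S} → T S → 𝔉 S
        tower-⊆ ground = S₀∈𝔉
        tower-⊆ (climb {S} t) = proj₁ (proj₂ (proj₂ (larger S)) (tower-⊆ t))
        tower-⊆ (gather C S S∈C ts) = closed C S S∈C (λ S′ S′∈C → tower-⊆ (ts S′ S′∈C))
          λ S S′ S∈C S′∈C → tower-chain S₀ next _ (ts S S∈C) (ts S′ S′∈C)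
        Ω : D → Bool
        Ω = Union λ S → truth (T S)
        Ω∈T : T Ω
        Ω∈T = gather (λ S → truth (T S)) S₀ (truth⁺ ground) λ S → truth⁻
        contra : ⊥
        contra = proj₂ (proj₂ (proj₂ (larger Ω)) (tower-⊆ Ω∈T))
                   (⊑-Union (λ S → truth (T S)) (next Ω) (truth⁺ (climb Ω∈T)))

  InjectionOn : {A : Set} {B : Set} → (A → Set) → (B → Set) → (A → B) → Set
  InjectionOn P Q h = (∀ {x} → P x → Q (h x)) × (∀ {x x′} → P x → P x′ → h x ≡ h x′ → x ≡ x′)

  -- A maximal partial matching between `P` and `Q` exhausts one of the two sides, for otherwise one
  -- more pair could be added. The points `a₀` and `b₀` are values for unmatched arguments.
  comparable : {A B : Set} → A → B → (P : A → Set) (Q : B → Set) →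
               (∃[ h ] InjectionOn P Q h) ⊎ (∃[ h ] InjectionOn Q P h)
  comparable {A} {B} a₀ b₀ P Q = compare
    where
    record Matching (S : A × B → Bool) : Set where
      field
        within : ∀ {x y} → S (x , y) ≡ true → P x × Q y
        fun    : ∀ {x y y′} → S (x , y) ≡ true → S (x , y′) ≡ true → y ≡ y′
        inj    : ∀ {x x′ y} → S (x , y) ≡ true → S (x′ , y) ≡ true → x ≡ x′
    open Matching

    closed : ∀ C S → C S ≡ true → (∀ S′ → C S′ ≡ true → Matching S′) → IsChain C → Matching (Union C)
    closed C _ _ match chain = record
      { within = λ e → let (S , S∈C , p) = truth⁻ e in within (match S S∈C) p
      ; fun    = λ e e′ → both e e′ λ m → fun m
      ; inj    = λ e e′ → both e e′ λ m → inj m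
      }
      where
      both : ∀ {d d′} {R : Set} → Union C d ≡ true → Union C d′ ≡ true →
             (∀ {S} → Matching S → S d ≡ true → S d′ ≡ true → R) → R
      both e e′ k with truth⁻ e | truth⁻ e′
      ... | S , S∈C , p | S′ , S′∈C , p′ with chain S S′ S∈C S′∈C
      ...   | inj₁ le = k (match S′ S′∈C) (le _ p) p′
      ...   | inj₂ ge = k (match S S∈C) p (ge _ p′)

    compare : (∃[ h ] InjectionOn P Q h) ⊎ (∃[ h ] InjectionOn Q P h)
    compare with zorn Matching (λ _ → false) (record { within = λ () ; fun = λ () ; inj = λ () }) closed
    ... | S , m , maximal with em {P = ∃[ x ] P x × ¬ (∃[ y ] S (x , y) ≡ true)}
                             | em {P = ∃[ y ] Q y × ¬ (∃[ x ] S (x , y) ≡ true)}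
    ... | no left | _ = inj₁ (h , (λ p → proj₂ (within m (spec p))) ,
            λ {x} {x′} p p′ e → inj m (subst (λ y → S (x , y) ≡ true) e (spec p)) (spec p′))
      where
      h : A → B
      h x = choose-or b₀ λ y → S (x , y)
      spec : ∀ {x} → P x → S (x , h x) ≡ true
      spec {x} p with by-contradiction (λ none → left (x , p , none))
      ... | y , e = choose-or-spec b₀ (λ y → S (x , y)) y e
    ... | yes _ | no right = inj₂ (h , (λ q → proj₁ (within m (spec q))) ,
            λ {y} {y′} q q′ e → fun m (subst (λ x → S (x , y) ≡ true) e (spec q)) (spec q′))
      where
      h : B → A
      h y = choose-or a₀ λ x → S (x , y)
      spec : ∀ {y} → Q y → S (h y , y) ≡ true
      spec {y} q with by-contradiction (λ none → right (y , q , none))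
      ... | x , e = choose-or-spec a₀ (λ x → S (x , y)) x e
    ... | yes (x₁ , p₁ , free₁) | yes (y₁ , q₁ , free₂) =
      ⊥-elim (free₁ (y₁ , maximal S′ m′ (λ _ d∈ → truth⁺ (inj₁ d∈)) (x₁ , y₁) (truth⁺ (inj₂ refl))))
      where
      S′ : A × B → Bool
      S′ d = truth (S d ≡ true ⊎ d ≡ (x₁ , y₁))
      m′ : Matching S′
      m′ .within e with truth⁻ e
      ... | inj₁ e    = within m e
      ... | inj₂ refl = p₁ , q₁
      m′ .fun e e′ with truth⁻ e | truth⁻ e′
      ... | inj₁ e    | inj₁ e′   = fun m e e′
      ... | inj₁ e    | inj₂ refl = ⊥-elim (free₁ (_ , e))
      ... | inj₂ refl | inj₁ e′   = ⊥-elim (free₁ (_ , e′))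
      ... | inj₂ refl | inj₂ refl = refl
      m′ .inj e e′ with truth⁻ e | truth⁻ e′
      ... | inj₁ e    | inj₁ e′   = inj m e e′
      ... | inj₁ e    | inj₂ refl = ⊥-elim (free₂ (_ , e))
      ... | inj₂ refl | inj₁ e′   = ⊥-elim (free₂ (_ , e′))
      ... | inj₂ refl | inj₂ refl = refl

  map-injectionOn : ∀ {A B : Set} {P : A → Set} {Q : B → Set} {h} → InjectionOn P Q h →
                    InjectionOn (All P) (All Q) (map h)
  map-injectionOn {P = P} {Q} {h} (maps , injective) = all , inj
    where
    all : ∀ {l} → All P l → All Q (map h l)
    all []       = []
    all (p ∷ ps) = maps p ∷ all ps
    inj : ∀ {l l′} → All P l → All P l′ → map h l ≡ map h l′ → l ≡ l′
    inj []       []         _ = refl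
    inj (p ∷ ps) (p′ ∷ ps′) e =
      cong₂ _∷_ (injective p p′ (Listₚ.∷-injectiveˡ e)) (inj ps ps′ (Listₚ.∷-injectiveʳ e))

  ∘-injectionOn : ∀ {A B C : Set} {P : A → Set} {Q : B → Set} {R : C → Set} {g h} →
                  InjectionOn Q R g → InjectionOn P Q h → InjectionOn P R (g ∘ h)
  ∘-injectionOn (mg , ig) (mh , ih) = (λ p → mg (mh p)) , λ p p′ e → ih p p′ (ig (mh p) (mh p′) e)

  -- Elements of `X` become one-element lists and elements of `Y` two-element lists over `X`, so the
  -- lengths keep the two kinds apart after coding by `g`.
  absorb : ∀ {K : Set} {X Y : K → Set} {g : List K → K} {j : K → K} → (∀ {z} → X z → ¬ Y z) →
           InjectionOn (All X) X g → InjectionOn Y X j → ∃[ e ] InjectionOn (λ z → X z ⊎ Y z) X e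
  absorb {K} {X} {Y} {g} {j} disjoint (mg , ig) (mj , ij) = e , maps , injective
    where
    e : K → K
    e z with em {P = X z}
    ... | yes _ = g (z ∷ [])
    ... | no  _ = g (j z ∷ j z ∷ [])
    e-X : ∀ {z} → X z → e z ≡ g (z ∷ [])
    e-X {z} x with em {P = X z}
    ... | yes _ = refl
    ... | no ¬x = ⊥-elim (¬x x)
    e-Y : ∀ {z} → Y z → e z ≡ g (j z ∷ j z ∷ [])
    e-Y {z} y with em {P = X z}
    ... | yes x = ⊥-elim (disjoint x y)
    ... | no  _ = refl
    maps : ∀ {z} → X z ⊎ Y z → X (e z)
    maps (inj₁ x) = subst X (sym (e-X x)) (mg (x ∷ []))
    maps (inj₂ y) = subst X (sym (e-Y y)) (mg (mj y ∷ mj y ∷ []))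
    injective : ∀ {z z′} → X z ⊎ Y z → X z′ ⊎ Y z′ → e z ≡ e z′ → z ≡ z′
    injective (inj₁ x) (inj₁ x′) p = Listₚ.∷-injectiveˡ
      (ig (x ∷ []) (x′ ∷ []) (trans (sym (e-X x)) (trans p (e-X x′))))
    injective (inj₂ y) (inj₂ y′) p = ij y y′ (Listₚ.∷-injectiveˡ
      (ig (mj y ∷ mj y ∷ []) (mj y′ ∷ mj y′ ∷ []) (trans (sym (e-Y y)) (trans p (e-Y y′)))))
    injective (inj₁ x) (inj₂ y) p
      with () ← ig (x ∷ []) (mj y ∷ mj y ∷ []) (trans (sym (e-X x)) (trans p (e-Y y)))
    injective (inj₂ y) (inj₁ x) p
      with () ← ig (mj y ∷ mj y ∷ []) (x ∷ []) (trans (sym (e-Y y)) (trans p (e-X x)))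

  module _ {K : Set} (i : ℕ → K) (i-inj : ∀ {m n} → i m ≡ i n → m ≡ n) where

    private
      D : Set
      D = K ⊎ (List K × K)
      X : (D → Bool) → K → Set
      X S z = S (inj₁ z) ≡ true
      G : (D → Bool) → List K → K → Set
      G S l y = S (inj₂ (l , y)) ≡ true

      -- A subset of `D` holds both a set `X S` and the graph `G S` of an injection of the finite
      -- lists over `X S` into `X S`, so that inclusion of subsets of `D` extends both at once.
      record ListInjection (S : D → Bool) : Set where
        field
          total  : ∀ {l} → All (X S) l → ∃[ y ] G S l y
          within : ∀ {l y} → G S l y → All (X S) l × X S y
          fun    : ∀ {l y y′} → G S l y → G S l y′ → y ≡ y′
          inj    : ∀ {l l′ y} → G S l y → G S l′ y → l ≡ l′
      open ListInjection

      S₀ : D → Bool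
      S₀ (inj₁ z)       = truth (∃[ n ] i n ≡ z)
      S₀ (inj₂ (l , y)) = truth (∃[ ns ] map i ns ≡ l × i (code ns) ≡ y)

      S₀-list : ∀ {l} → All (X S₀) l → ∃[ ns ] map i ns ≡ l
      S₀-list []       = [] , refl
      S₀-list (x ∷ xs) =
        let (n , e) = truth⁻ x
            (ns , e′) = S₀-list xs
        in n ∷ ns , cong₂ _∷_ e e′

      S₀-all : ∀ ns → All (X S₀) (map i ns)
      S₀-all []       = []
      S₀-all (n ∷ ns) = truth⁺ (n , refl) ∷ S₀-all ns

      S₀-good : ListInjection S₀
      S₀-good .total xs = let (ns , e) = S₀-list xs in i (code ns) , truth⁺ (ns , e , refl)
      S₀-good .within e with truth⁻ e
      ... | ns , refl , refl = S₀-all ns , truth⁺ (code ns , refl)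
      S₀-good .fun e e′ with truth⁻ e | truth⁻ e′
      ... | ns , refl , refl | ns′ , p , refl = cong (i ∘ code) (sym (Listₚ.map-injective i-inj p))
      S₀-good .inj e e′ with truth⁻ e | truth⁻ e′
      ... | ns , refl , refl | ns′ , refl , p = cong (map i)
        (trans (sym (decode-code ns)) (trans (cong decode (sym (i-inj p))) (decode-code ns′)))

      closed : ∀ C S → C S ≡ true → (∀ S′ → C S′ ≡ true → ListInjection S′) → IsChain C →
               ListInjection (Union C)
      closed C S₁ S₁∈C good chain = record
        { total  = λ xs → let (S , S∈C , xs′) = collect xs
                              (y , p) = total (good S S∈C) xs′
                          in y , truth⁺ (S , S∈C , p)
        ; within = λ e → let (S , S∈C , p) = truth⁻ e
                             (xs , x) = within (good S S∈C) p
                         in All.map (λ x → truth⁺ (S , S∈C , x)) xs , truth⁺ (S , S∈C , x)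
        ; fun    = λ e e′ → both e e′ λ m → fun m
        ; inj    = λ e e′ → both e e′ λ m → inj m
        }
        where
        both : ∀ {d d′} {R : Set} → Union C d ≡ true → Union C d′ ≡ true →
               (∀ {S} → ListInjection S → S d ≡ true → S d′ ≡ true → R) → R
        both e e′ k with truth⁻ e | truth⁻ e′
        ... | S , S∈C , p | S′ , S′∈C , p′ with chain S S′ S∈C S′∈C
        ...   | inj₁ le = k (good S′ S′∈C) (le _ p) p′
        ...   | inj₂ ge = k (good S S∈C) p (ge _ p′)
        collect : ∀ {l} → All (X (Union C)) l → ∃[ S ] C S ≡ true × All (X S) l
        collect [] = S₁ , S₁∈C , []
        collect (x ∷ xs) with truth⁻ x | collect xs
        ... | S , S∈C , p | S′ , S′∈C , ps with chain S S′ S∈C S′∈C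
        ...   | inj₁ le = S′ , S′∈C , le _ p ∷ ps
        ...   | inj₂ ge = S , S∈C , p ∷ All.map (ge _) ps

    -- Take a maximal `X` whose finite lists inject into it. If the complement of `X` embeds into
    -- `X`, all of `K` is absorbed by `X`. Otherwise `X` embeds into its complement, and enlarging
    -- `X` by that copy contradicts maximality.
    list-injection : ∃[ h ] (∀ {l l′ : List K} → h l ≡ h l′ → l ≡ l′)
    list-injection with zorn ListInjection S₀ S₀-good closed
    ... | S , good , maximal = conclude (comparable (i 0) (i 0) (λ z → ¬ X S z) (X S))
      where
      g : List K → K
      g l = choose-or (i 0) λ y → S (inj₂ (l , y))
      g-spec : ∀ {l} → All (X S) l → G S l (g l)
      g-spec {l} xs = let (y , e) = total good xs in choose-or-spec (i 0) (λ y → S (inj₂ (l , y))) y e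
      g-inj : InjectionOn (All (X S)) (X S) g
      g-inj = (λ xs → proj₂ (within good (g-spec xs))) ,
              λ {l} xs xs′ e → inj good (subst (G S l) e (g-spec xs)) (g-spec xs′)
      conclude : (∃[ j ] InjectionOn (λ z → ¬ X S z) (X S) j) ⊎ (∃[ j ] InjectionOn (X S) (λ z → ¬ X S z) j) →
                 ∃[ h ] (∀ {l l′ : List K} → h l ≡ h l′ → l ≡ l′)
      conclude (inj₁ (j , j-inj)) =
        let (e , e-inj) = absorb (λ x ¬x → ¬x x) g-inj j-inj
        in g ∘ map e , λ {l} {l′} → proj₂ (∘-injectionOn {R = X S} g-inj (map-injectionOn e-inj)) (everything l)
            (everything l′)
        where
        cases : ∀ z → X S z ⊎ ¬ X S z
        cases z with em {P = X S z}
        ... | yes x = inj₁ x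
        ... | no ¬x = inj₂ ¬x
        everything : ∀ l → All (λ z → X S z ⊎ ¬ X S z) l
        everything = All.universal cases
      conclude (inj₂ (j , mj , ij)) = ⊥-elim (mj x₀ (maximal S′ good′ (λ { (inj₁ _) e → truth⁺ (inj₁ e)
                                                                        ; (inj₂ _) e → truth⁺ (inj₁ e) })
                                                (inj₁ (j (g []))) (truth⁺ (inj₂ (g [] , x₀ , refl)))))
        where
        x₀ : X S (g [])
        x₀ = proj₁ g-inj []
        Y : K → Set
        Y z = ∃[ x ] X S x × j x ≡ z
        Y-disjoint : ∀ {z} → X S z → ¬ Y z
        Y-disjoint x (x′ , p , refl) = mj p x
        j⁻ : K → K
        j⁻ z = choose-or z λ x → truth (X S x × j x ≡ z)
        j⁻-spec : ∀ {z} → Y z → X S (j⁻ z) × j (j⁻ z) ≡ z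
        j⁻-spec {z} (x , p) = truth⁻ (choose-or-spec z (λ x → truth (X S x × j x ≡ z)) x (truth⁺ p))
        absorbed = absorb {j = j⁻} Y-disjoint g-inj
          ((λ y → proj₁ (j⁻-spec y)) , λ y y′ e →
            trans (sym (proj₂ (j⁻-spec y))) (trans (cong j e) (proj₂ (j⁻-spec y′))))
        X′ : K → Set
        X′ z = X S z ⊎ Y z
        g′ : List K → K
        g′ l = g (map (proj₁ absorbed) l)
        g′-inj : InjectionOn (All X′) (X S) g′
        g′-inj = ∘-injectionOn {R = X S} g-inj (map-injectionOn (proj₂ absorbed))
        -- Lists with an entry outside `X S` get values in the new copy `Y`, which no value of the
        -- old graph can equal.
        G′ : List K → K → Set
        G′ l y = G S l y ⊎ (All X′ l × ¬ All (X S) l × j (g′ l) ≡ y)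
        S′ : D → Bool
        S′ (inj₁ z)       = truth (X′ z)
        S′ (inj₂ (l , y)) = truth (G′ l y)
        good′ : ListInjection S′
        good′ .total {l} xs with em {P = All (X S) l}
        ... | yes xs′ = let (y , e) = total good xs′ in y , truth⁺ (inj₁ e)
        ... | no ¬xs  = j (g′ l) , truth⁺ (inj₂ (All.map truth⁻ xs , ¬xs , refl))
        good′ .within {l} e with truth⁻ e
        ... | inj₁ e = let (xs , x) = within good e in
                       All.map (λ x → truth⁺ (inj₁ x)) xs , truth⁺ (inj₁ x)
        ... | inj₂ (xs , _ , refl) = All.map truth⁺ xs , truth⁺ (inj₂ (g′ l , proj₁ g′-inj xs , refl))
        good′ .fun e e′ with truth⁻ e | truth⁻ e′
        ... | inj₁ e              | inj₁ e′               = fun good e e′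
        ... | inj₁ e              | inj₂ (_ , ¬xs , _)    = ⊥-elim (¬xs (proj₁ (within good e)))
        ... | inj₂ (_ , ¬xs , _)  | inj₁ e′               = ⊥-elim (¬xs (proj₁ (within good e′)))
        ... | inj₂ (_ , _ , refl) | inj₂ (_ , _ , refl)   = refl
        good′ .inj e e′ with truth⁻ e | truth⁻ e′
        ... | inj₁ e               | inj₁ e′              = inj good e e′
        ... | inj₁ e               | inj₂ (xs , _ , refl) = ⊥-elim (mj (proj₁ g′-inj xs) (proj₂ (within good e)))
        ... | inj₂ (xs , _ , refl) | inj₁ e′              = ⊥-elim (mj (proj₁ g′-inj xs) (proj₂ (within good e′)))
        ... | inj₂ (xs , _ , refl) | inj₂ (xs′ , _ , p)   =
          proj₂ g′-inj xs xs′ (sym (ij (proj₁ g′-inj xs′) (proj₁ g′-inj xs) p))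

  -- Either a finite list exhausts `K`, or one can always choose an element outside those chosen
  -- before.
  countable-or-ℕ-embeds : {K : Set} → K → (∃[ e ] ∀ (x : K) → ∃[ n ] e n ≡ x) ⊎
                          (∃[ i ] ∀ {m n} → i m ≡ i n → m ≡ n)
  countable-or-ℕ-embeds {K} d with em {P = ∃[ l ] ∀ (x : K) → x ∈ₗ l}
  ... | yes (l , full) = inj₁ (lookup-or d l , λ x → position (full x))
    where
    position : ∀ {l x} → x ∈ₗ l → ∃[ n ] lookup-or d l n ≡ x
    position (here refl) = 0 , refl
    position (there x∈l) = let (n , e) = position x∈l in suc n , e
  ... | no none = inj₂ (i , injective)
    where
    fresh : ∀ l → ∃[ x ] ¬ x ∈ₗ l
    fresh l = ¬∀⇒∃¬ λ full → none (l , full)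
    previous : ℕ → List K
    previous zero    = []
    previous (suc n) = proj₁ (fresh (previous n)) ∷ previous n
    i : ℕ → K
    i n = proj₁ (fresh (previous n))
    earlier : ∀ {m n} → m ℕ.<′ n → i m ∈ₗ previous n
    earlier (ℕ.<′-base) = here refl
    earlier (ℕ.≤′-step m<n) = there (earlier m<n)
    distinct : ∀ {m n} → m ℕ.< n → i m ≢ i n
    distinct {m} {n} m<n e =
      proj₂ (fresh (previous n)) (subst (_∈ₗ previous n) e (earlier (ℕₚ.<⇒<′ m<n)))
    injective : ∀ {m n} → i m ≡ i n → m ≡ n
    injective {m} {n} e with ℕₚ.<-cmp m n
    ... | tri< m<n _ _ = ⊥-elim (distinct m<n e)
    ... | tri≈ _ m≡n _ = m≡n
    ... | tri> _ _ n<m = ⊥-elim (distinct n<m (sym e))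

  -- Different indices may give the same set, so the cover is counted by the setoid `μ` that
  -- identifies them. Choosing one index for each set turns an embedding into `μ` into one into `κ`.
  covM≼index : ∀ {cov} → IsCovM cov → (κ : Cardinal) {I : Set} (M : I → Pred ℝ 0ℓ) → (∀ i → Meager (M i)) →
               (∀ x → ∃[ i ] x ∈ M i) → (j : I → Setoid.Carrier κ) →
               (∀ {i i′} → Setoid._≈_ κ (j i) (j i′) → i ≡ i′) → cov ≼ κ
  covM≼index {cov} (_ , minimal) κ {I} M meager covers j j-inj = record
    { to        = λ x → j (rep (to x))
    ; cong      = λ x≈y → Setoid.reflexive κ (cong j (rep-cong (to-cong x≈y)))
    ; injective = λ {x} {y} e → injective (Setoid.trans μ (rep-≈ (to x))
                    (Setoid.trans μ (Setoid.reflexive μ (j-inj e)) (Setoid.sym μ (rep-≈ (to y)))))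
    }
    where
    μ : Cardinal
    μ = On.setoid (≐-setoid ℝ 0ℓ) M
    𝒞 : Pred (Pred ℝ 0ℓ) 0ℓ
    𝒞 S = ∃[ i ] M i ≐ S
    cover : IsMeagerCover 𝒞
    cover = (λ (i , Mi≐S) → let (N , nd , Mi≐N) = meager i in N , nd , ≐-trans (≐-sym Mi≐S) Mi≐N) ,
            λ x → let (i , x∈Mi) = covers x in M i , (i , ≐-refl) , x∈Mi
    cardinality : 𝒞 HasCardinality μ
    cardinality = record
      { to        = λ i → M i , i , ≐-refl
      ; cong      = id
      ; bijective = id , λ (S , i , Mi≐S) → i , λ z≐i → ≐-trans z≐i Mi≐S
      }
    open Injection (minimal μ (𝒞 , cover , cardinality)) using (to; injective) renaming (cong to to-cong)
    open Representatives μ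

  -- Dyadic digits of reals

  /-≤ : ∀ i j m n .{{_ : ℕ.NonZero m}} .{{_ : ℕ.NonZero n}} →
        i ℤ.* + n ℤ.≤ j ℤ.* + m → i ℚ./ m ℚ.≤ j ℚ./ n
  /-≤ i j m@(suc m-1) n@(suc n-1) h = ℚₚ.toℚᵘ-cancel-≤
    (ℚᵘₚ.≤-respʳ-≃ (ℚᵘₚ.≃-sym (ℚₚ.toℚᵘ-fromℚᵘ (ℚᵘ.mkℚᵘ j n-1)))
      (ℚᵘₚ.≤-respˡ-≃ (ℚᵘₚ.≃-sym (ℚₚ.toℚᵘ-fromℚᵘ (ℚᵘ.mkℚᵘ i m-1))) (ℚᵘ.*≤* h)))

  /-<⁻ : ∀ i j m n .{{_ : ℕ.NonZero m}} .{{_ : ℕ.NonZero n}} →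
         i ℚ./ m ℚ.< j ℚ./ n → i ℤ.* + n ℤ.< j ℤ.* + m
  /-<⁻ i j m@(suc m-1) n@(suc n-1) h = ℚᵘₚ.drop-*<*
    (ℚᵘₚ.<-respʳ-≃ (ℚₚ.toℚᵘ-fromℚᵘ (ℚᵘ.mkℚᵘ j n-1))
      (ℚᵘₚ.<-respˡ-≃ (ℚₚ.toℚᵘ-fromℚᵘ (ℚᵘ.mkℚᵘ i m-1)) (ℚₚ.toℚᵘ-mono-< h)))

  /-< : ∀ i j m n .{{_ : ℕ.NonZero m}} .{{_ : ℕ.NonZero n}} →
        i ℤ.* + n ℤ.< j ℤ.* + m → i ℚ./ m ℚ.< j ℚ./ n
  /-< i j m@(suc m-1) n@(suc n-1) h = ℚₚ.toℚᵘ-cancel-<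
    (ℚᵘₚ.<-respʳ-≃ (ℚᵘₚ.≃-sym (ℚₚ.toℚᵘ-fromℚᵘ (ℚᵘ.mkℚᵘ j n-1)))
      (ℚᵘₚ.<-respˡ-≃ (ℚᵘₚ.≃-sym (ℚₚ.toℚᵘ-fromℚᵘ (ℚᵘ.mkℚᵘ i m-1))) (ℚᵘ.*<* h)))

  2^-nonZero : ∀ N → ℕ.NonZero (2 ℕ.^ N)
  2^-nonZero N = ℕₚ.m^n≢0 2 N

  dyadic : ℤ → ℕ → ℚ
  dyadic k N = ℚ._/_ k (2 ℕ.^ N) {{2^-nonZero N}}

  dyadic-double : ∀ k N → dyadic (+ 2 ℤ.* k) (suc N) ≡ dyadic k N
  dyadic-double k N = ℚₚ.≤-antisym
    (/-≤ (+ 2 ℤ.* k) k (2 ℕ.^ suc N) (2 ℕ.^ N) {{2^-nonZero (suc N)}} {{2^-nonZero N}} (ℤₚ.≤-reflexive cross))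
    (/-≤ k (+ 2 ℤ.* k) (2 ℕ.^ N) (2 ℕ.^ suc N) {{2^-nonZero N}} {{2^-nonZero (suc N)}} (ℤₚ.≤-reflexive (sym cross)))
    where
    ring : ∀ k e → + 2 ℤ.* k ℤ.* e ≡ k ℤ.* (+ 2 ℤ.* e)
    ring = solve-∀
    cross : + 2 ℤ.* k ℤ.* + (2 ℕ.^ N) ≡ k ℤ.* + (2 ℕ.^ suc N)
    cross = trans (ring k (+ (2 ℕ.^ N))) (cong (k ℤ.*_) (sym (ℤₚ.pos-* 2 (2 ℕ.^ N))))

  n<2^n : ∀ n → n ℕ.< 2 ℕ.^ n
  n<2^n zero    = s≤s z≤n
  n<2^n (suc n) = ℕₚ.≤-trans (ℕₚ.+-mono-≤ (ℕₚ.≤-trans (s≤s z≤n) (n<2^n n)) (n<2^n n))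
    (ℕₚ.≤-reflexive (cong (2 ℕ.^ n ℕ.+_) (sym (ℕₚ.+-identityʳ (2 ℕ.^ n)))))

  dyadic-between : ∀ {p q} → p ℚ.< q → ∃[ k ] ∃[ N ] p ℚ.≤ dyadic k N × dyadic (k ℤ.+ + 1) N ℚ.≤ q
  dyadic-between {p} {q} p<q = k , N ,
    subst (ℚ._≤ dyadic k N) (ℚₚ.↥p/↧p≡p p) (/-≤ P k D E {{_}} {{2^-nonZero N}} left) ,
    subst (dyadic (k ℤ.+ + 1) N ℚ.≤_) (ℚₚ.↥p/↧p≡p q) (/-≤ (k ℤ.+ + 1) Q E D′ {{2^-nonZero N}} right)
    where
    P = ℚ.↥ p
    Q = ℚ.↥ q
    D = ℚ.↧ₙ p
    D′ = ℚ.↧ₙ q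
    -- The difference of `q` and `p` is at least 1/(D D′), and 2^N exceeds 2 D D′. Hence two steps
    -- of length 2^-N from c/2^N, the last grid point not above `p`, do not pass `q`.
    N = 2 ℕ.* (D ℕ.* D′)
    E = 2 ℕ.^ N
    r = (P ℤ.* + E) ℤ.%ℕ D
    c = (P ℤ.* + E) ℤ./ℕ D
    k = c ℤ.+ + 1
    division : P ℤ.* + E ≡ + r ℤ.+ c ℤ.* + D
    division = ℤ.a≡a%ℕn+[a/ℕn]*n (P ℤ.* + E) D
    open ℤₚ.≤-Reasoning
    left : P ℤ.* + E ℤ.≤ k ℤ.* + D
    left = begin
      P ℤ.* + E          ≡⟨ division ⟩
      + r ℤ.+ c ℤ.* + D   ≤⟨ ℤₚ.+-monoˡ-≤ (c ℤ.* + D) (ℤ.+≤+ (ℕₚ.<⇒≤ (ℤ.n%ℕd<d (P ℤ.* + E) D))) ⟩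
      + D ℤ.+ c ℤ.* + D   ≡⟨ ring c (+ D) ⟩
      k ℤ.* + D          ∎
      where
      ring : ∀ c d → d ℤ.+ c ℤ.* d ≡ (c ℤ.+ + 1) ℤ.* d
      ring = solve-∀
    gap : P ℤ.* + D′ ℤ.+ + 1 ℤ.≤ Q ℤ.* + D
    gap = subst (ℤ._≤ Q ℤ.* + D) (ℤₚ.+-comm (+ 1) (P ℤ.* + D′)) (ℤₚ.i<j⇒suc[i]≤j (ℚₚ.drop-*<* p<q))
    small : + 2 ℤ.* (+ D ℤ.* + D′) ℤ.≤ + E
    small = subst (ℤ._≤ + E) (trans (ℤₚ.pos-* 2 (D ℕ.* D′)) (cong (+ 2 ℤ.*_) (ℤₚ.pos-* D D′)))
                  (ℤ.+≤+ (ℕₚ.<⇒≤ (n<2^n N)))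
    right : (k ℤ.+ + 1) ℤ.* + D′ ℤ.≤ Q ℤ.* + E
    right = ℤₚ.*-cancelʳ-≤-pos _ _ (+ D) (begin
      (k ℤ.+ + 1) ℤ.* + D′ ℤ.* + D                          ≡⟨ ring₁ c (+ D) (+ D′) ⟩
      c ℤ.* + D ℤ.* + D′ ℤ.+ + 2 ℤ.* (+ D ℤ.* + D′)           ≤⟨ ℤₚ.+-mono-≤
          (ℤₚ.*-monoʳ-≤-nonNeg (+ D′) (ℤ.[n/ℕd]*d≤n (P ℤ.* + E) D)) small ⟩
      P ℤ.* + E ℤ.* + D′ ℤ.+ + E                             ≡⟨ ring₂ P (+ E) (+ D′) ⟩
      (P ℤ.* + D′ ℤ.+ + 1) ℤ.* + E                           ≤⟨ ℤₚ.*-monoʳ-≤-nonNeg (+ E) gap ⟩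
      Q ℤ.* + D ℤ.* + E                                     ≡⟨ ring₃ Q (+ D) (+ E) ⟩
      Q ℤ.* + E ℤ.* + D                                     ∎)
      where
      ring₁ : ∀ c d d′ → ((c ℤ.+ + 1) ℤ.+ + 1) ℤ.* d′ ℤ.* d ≡ c ℤ.* d ℤ.* d′ ℤ.+ + 2 ℤ.* (d ℤ.* d′)
      ring₁ = solve-∀
      ring₂ : ∀ p e d → p ℤ.* e ℤ.* d ℤ.+ e ≡ (p ℤ.* d ℤ.+ + 1) ℤ.* e
      ring₂ = solve-∀
      ring₃ : ∀ p d e → p ℤ.* d ℤ.* e ≡ p ℤ.* e ℤ.* d
      ring₃ = solve-∀

  p<p+ε : ∀ p {ε} → 0ℚ ℚ.< ε → p ℚ.< p ℚ.+ ε
  p<p+ε p {ε} 0<ε = subst (ℚ._< p ℚ.+ ε) (ℚₚ.+-identityʳ p) (ℚₚ.+-monoʳ-< p 0<ε)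

  0<q-p : ∀ {p q} → p ℚ.< q → 0ℚ ℚ.< q ℚ.- p
  0<q-p {p} {q} p<q = subst (ℚ._< q ℚ.- p) (ℚₚ.+-inverseʳ p) (ℚₚ.+-monoˡ-< (ℚ.- p) p<q)

  p+[q-p]≡q : ∀ p q → p ℚ.+ (q ℚ.- p) ≡ q
  p+[q-p]≡q p q = trans (cong (p ℚ.+_) (ℚₚ.+-comm q (ℚ.- p))) (trans (sym (ℚₚ.+-assoc p (ℚ.- p) q))
    (trans (cong (ℚ._+ q) (ℚₚ.+-inverseʳ p)) (ℚₚ.+-identityˡ q)))

  fromℚ-mono-< : ∀ {p q} → p ℚ.< q → fromℚ p <ℝ fromℚ q
  fromℚ-mono-< {p} {q} p<q = q ℚ.- p , 0<q-p p<q , 0 , λ _ _ → ℚₚ.≤-reflexive (p+[q-p]≡q p q)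

  ≤-<ℝ-trans : ∀ {p q} x → p ℚ.≤ q → fromℚ q <ℝ x → fromℚ p <ℝ x
  ≤-<ℝ-trans x p≤q (ε , 0<ε , N , h) = ε , 0<ε , N , λ n N≤n → ℚₚ.≤-trans (ℚₚ.+-monoˡ-≤ ε p≤q) (h n N≤n)

  <ℝ-≤-trans : ∀ {p q} x → x <ℝ fromℚ p → p ℚ.≤ q → x <ℝ fromℚ q
  <ℝ-≤-trans x (ε , 0<ε , N , h) p≤q = ε , 0<ε , N , λ n N≤n → ℚₚ.≤-trans (h n N≤n) p≤q

  interval-nonempty : ∀ p q x → x ∈ Interval p q → p ℚ.< q
  interval-nonempty p q x ((ε , 0<ε , M , h) , (δ , 0<δ , N , k)) =
    ℚₚ.<-≤-trans (p<p+ε p 0<ε) (ℚₚ.≤-trans (h n (ℕₚ.m≤m⊔n M N))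
      (ℚₚ.≤-trans (ℚₚ.<⇒≤ (p<p+ε (seq x n) 0<δ)) (k n (ℕₚ.m≤n⊔m M N))))
    where n = M ℕ.⊔ N

  interval-⊆ : ∀ p q p′ q′ → p ℚ.≤ p′ → q′ ℚ.≤ q → Interval p′ q′ ⊆ Interval p q
  interval-⊆ p q p′ q′ p≤p′ q′≤q {x} (l , r) = ≤-<ℝ-trans x p≤p′ l , <ℝ-≤-trans x r q′≤q

  Cell : ℤ → ℕ → Pred ℝ 0ℓ
  Cell k N = Interval (dyadic k N) (dyadic (k ℤ.+ + 1) N)

  -- `true` stands for the left half. Midpoints and points outside the cell receive a digit as well;
  -- its value is immaterial, because digits are evaluated inside open cells only.
  left-half : ℤ → ℕ → ℝ → Bool
  left-half k N x = truth (x <ℝ fromℚ (dyadic (+ 2 ℤ.* k ℤ.+ + 1) (suc N)))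

  child : ℤ → Bool → ℤ
  child k true  = + 2 ℤ.* k
  child k false = + 2 ℤ.* k ℤ.+ + 1

  digits-in : ℤ → ℕ → ℝ → ℕ → Bool
  digits-in k N x zero    = left-half k N x
  digits-in k N x (suc n) = digits-in (child k (left-half k N x)) (suc N) x n

  dyadic-mono-≤ : ∀ {i j} N → i ℤ.≤ j → dyadic i N ℚ.≤ dyadic j N
  dyadic-mono-≤ {i} {j} N i≤j = /-≤ i j (2 ℕ.^ N) (2 ℕ.^ N) {{2^-nonZero N}} {{2^-nonZero N}}
      (ℤₚ.*-monoʳ-≤-nonNeg (+ (2 ℕ.^ N)) i≤j)

  double-suc : ∀ k → (+ 2 ℤ.* k ℤ.+ + 1) ℤ.+ + 1 ≡ + 2 ℤ.* (k ℤ.+ + 1)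
  double-suc = solve-∀

  child-⊆ : ∀ k N b → Cell (child k b) (suc N) ⊆ Cell k N
  child-⊆ k N true {x} = interval-⊆ _ _ (dyadic (+ 2 ℤ.* k) (suc N)) (dyadic (+ 2 ℤ.* k ℤ.+ + 1) (suc N))
    (ℚₚ.≤-reflexive (sym (dyadic-double k N)))
    (subst (dyadic (+ 2 ℤ.* k ℤ.+ + 1) (suc N) ℚ.≤_) (dyadic-double (k ℤ.+ + 1) N)
      (dyadic-mono-≤ (suc N) (subst (+ 2 ℤ.* k ℤ.+ + 1 ℤ.≤_) (double-suc k) (ℤₚ.i≤i+j _ (+ 1))))) {x}
  child-⊆ k N false {x} = interval-⊆ _ _ (dyadic (+ 2 ℤ.* k ℤ.+ + 1) (suc N))
      (dyadic (+ 2 ℤ.* k ℤ.+ + 1 ℤ.+ + 1) (suc N))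
    (subst (ℚ._≤ dyadic (+ 2 ℤ.* k ℤ.+ + 1) (suc N)) (dyadic-double k N)
      (dyadic-mono-≤ (suc N) (ℤₚ.i≤i+j (+ 2 ℤ.* k) (+ 1))))
    (ℚₚ.≤-reflexive (trans (cong (λ j → dyadic j (suc N)) (double-suc k)) (dyadic-double (k ℤ.+ + 1) N))) {x}

  child-digit : ∀ k N b x → x ∈ Cell (child k b) (suc N) → left-half k N x ≡ b
  child-digit k N true  x (_ , r) = truth⁺ r
  child-digit k N false x (l , _) =
    let c = dyadic (+ 2 ℤ.* k ℤ.+ + 1) (suc N) in ¬-not λ e →
          ℚₚ.<-irrefl refl (interval-nonempty c c x (l , truth⁻ e))

  Extends : (ℕ → Bool) → List Bool → Set
  Extends z []      = Unit.⊤
  Extends z (b ∷ t) = z 0 ≡ b × Extends (z ∘ suc) t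

  walk : ℤ → ℕ → List Bool → ℤ × ℕ
  walk k N []      = k , N
  walk k N (b ∷ t) = walk (child k b) (suc N) t

  walk-++ : ∀ k N s t → walk k N (s ++ t) ≡ walk (proj₁ (walk k N s)) (proj₂ (walk k N s)) t
  walk-++ k N []      t = refl
  walk-++ k N (b ∷ s) t = walk-++ (child k b) (suc N) s t

  CellAt : ℤ × ℕ → Pred ℝ 0ℓ
  CellAt (k , N) = Cell k N

  walk-⊆ : ∀ k N t → CellAt (walk k N t) ⊆ Cell k N
  walk-⊆ k N []      x∈ = x∈
  walk-⊆ k N (b ∷ t) {x} x∈ = child-⊆ k N b {x} (walk-⊆ (child k b) (suc N) t {x} x∈)

  walk-digits : ∀ k N t x → x ∈ CellAt (walk k N t) → Extends (digits-in k N x) t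
  walk-digits k N []      x x∈ = Unit.tt
  walk-digits k N (b ∷ t) x x∈ = first , subst (λ c → Extends (digits-in (child k c) (suc N) x) t) (sym first)
                                               (walk-digits (child k b) (suc N) t x x∈)
    where
    first : left-half k N x ≡ b
    first = child-digit k N b x (walk-⊆ (child k b) (suc N) t {x} x∈)

  halve : ∀ k → ∃[ j ] ∃[ b ] child j b ≡ k
  halve k with k ℤ.%ℕ 2 | ℤ.n%ℕd<d k 2 | ℤ.a≡a%ℕn+[a/ℕn]*n k 2
  ... | 0 | _ | eq = k ℤ./ℕ 2 , true , sym (trans eq (ring (k ℤ./ℕ 2)))
    where
    ring : ∀ j → + 0 ℤ.+ j ℤ.* + 2 ≡ + 2 ℤ.* j
    ring = solve-∀
  ... | 1 | _ | eq = k ℤ./ℕ 2 , false , sym (trans eq (ring (k ℤ./ℕ 2)))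
    where
    ring : ∀ j → + 1 ℤ.+ j ℤ.* + 2 ≡ + 2 ℤ.* j ℤ.+ + 1
    ring = solve-∀
  ... | suc (suc _) | s≤s (s≤s ()) | _

  reach : ∀ N k → ∃[ m ] ∃[ s ] walk m 0 s ≡ (k , N)
  reach zero    k = k , [] , refl
  reach (suc N) k =
    let (j , b , e) = halve k
        (m , s , e′) = reach N j
    in m , s ∷ʳ b , trans (walk-++ m 0 s (b ∷ []))
         (trans (cong (λ (k , N) → child k b , suc N) e′) (cong (_, suc N) e))

  floor-unique : ∀ {m n} x → x ∈ Cell m 0 → x ∈ Cell n 0 → m ≡ n
  floor-unique {m} {n} x (l , r) (l′ , r′) = ℤₚ.≤-antisym
    (below (interval-nonempty (dyadic m 0) (dyadic (n ℤ.+ + 1) 0) x (l , r′)))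
    (below (interval-nonempty (dyadic n 0) (dyadic (m ℤ.+ + 1) 0) x (l′ , r)))
    where
    below : ∀ {i j} → dyadic i 0 ℚ.< dyadic (j ℤ.+ + 1) 0 → i ℤ.≤ j
    below {i} {j} h = ℤₚ.≮⇒≥ λ j<i → ℤₚ.<⇒≱ i<j+1
      (subst (ℤ._≤ i) (ℤₚ.+-comm (+ 1) j) (ℤₚ.i<j⇒suc[i]≤j j<i))
      where
      i<j+1 : i ℤ.< j ℤ.+ + 1
      i<j+1 = subst₂ ℤ._<_ (ℤₚ.*-identityʳ i) (ℤₚ.*-identityʳ (j ℤ.+ + 1)) (/-<⁻ i (j ℤ.+ + 1) 1 1 h)

  -- The default is met at integers only, and these form a nowhere dense set.
  floor-or-0 : ℝ → ℤ
  floor-or-0 x = choose-or (+ 0) λ m → truth (x ∈ Cell m 0)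

  digits : ℝ → ℕ → Bool
  digits x = digits-in (floor-or-0 x) 0 x

  floor-correct : ∀ m x → x ∈ Cell m 0 → floor-or-0 x ≡ m
  floor-correct m x x∈ = floor-unique x
    (truth⁻ (choose-or-spec (+ 0) (λ m → truth (x ∈ Cell m 0)) m (truth⁺ x∈))) x∈

  -- This carries category from bit sequences over to the reals: `s` is the address of a dyadic cell
  -- inside the interval, and every continuation `t` is the address of a subcell.
  digits-dense : ∀ {p q} → p ℚ.< q → ∃[ s ] ∀ t → ∃[ k ] ∃[ N ]
    Cell k N ⊆ Interval p q × (∀ x → x ∈ Cell k N → Extends (digits x) (s ++ t))
  digits-dense {p} {q} p<q = s , λ t → proj₁ (w t) , proj₂ (w t) ,
    (λ {x} x∈ → interval-⊆ _ _ (dyadic k N) (dyadic (k ℤ.+ + 1) N) p≤ ≤q {x} (subst (λ c → CellAt c x) e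
      (walk-⊆ _ _ t {x} (subst (λ c → CellAt c x) (walk-++ m 0 s t) x∈)))) ,
    λ x x∈ → subst (λ j → Extends (digits-in j 0 x) (s ++ t))
      (sym (floor-correct m x (walk-⊆ m 0 (s ++ t) {x} x∈))) (walk-digits m 0 (s ++ t) x x∈)
    where
    between = dyadic-between p<q
    k = proj₁ between
    N = proj₁ (proj₂ between)
    p≤ = proj₁ (proj₂ (proj₂ between))
    ≤q = proj₂ (proj₂ (proj₂ between))
    reached = reach N k
    m = proj₁ reached
    s = proj₁ (proj₂ reached)
    e = proj₂ (proj₂ reached)
    w : List Bool → ℤ × ℕ
    w t = walk m 0 (s ++ t)

  cell-inhabited : ∀ k N → ∃[ x ] x ∈ Cell k N
  cell-inhabited k N =
    let (x , l , r) = ℚₚ.<-dense {dyadic k N} {dyadic (k ℤ.+ + 1) N} k<k+1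
    in fromℚ x , fromℚ-mono-< l , fromℚ-mono-< r
    where
    k<k+1 : dyadic k N ℚ.< dyadic (k ℤ.+ + 1) N
    k<k+1 = /-< k (k ℤ.+ + 1) (2 ℕ.^ N) (2 ℕ.^ N) {{2^-nonZero N}} {{2^-nonZero N}}
      (ℤₚ.*-monoʳ-<-pos (+ (2 ℕ.^ N)) {{ℤ.positive (ℤ.+<+ (ℕ.>-nonZero⁻¹ (2 ℕ.^ N) {{2^-nonZero N}}))}}
        (subst (k ℤ.<_) (ℤₚ.+-comm (+ 1) k) (ℤₚ.suc[i]≤j⇒i<j ℤₚ.≤-refl)))

  extends-++ : ∀ {z} s t → Extends z (s ++ t) → Extends (λ i → z (length s ℕ.+ i)) t
  extends-++ []      t e       = e
  extends-++ (b ∷ s) t (_ , e) = extends-++ s t e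

  -- Any interval contains a cell with some address `s`; the subcell with address `s ++ t` contains
  -- no point with digits in `Z`, so the preimage of `Z` is not dense in the interval.
  nowhereDense : {Z : Pred (ℕ → Bool) 0ℓ} → (∀ s → ∃[ t ] ∀ z → Extends z (s ++ t) → z ∉ Z) →
                 NowhereDense (λ x → digits x ∈ Z)
  nowhereDense avoid x (p , q , x∈ , dense) =
    let (s , cells) = digits-dense (interval-nonempty p q x x∈)
        (t , avoids) = avoid s
        (k , N , sub , ext-t) = cells t
        (y , y∈) = cell-inhabited k N
        (y′ , y′∈ , y′∈Z) = dense {y} (sub {y} y∈) (dyadic k N) (dyadic (k ℤ.+ + 1) N) y∈
    in avoids (digits y′) (ext-t y′ y′∈) y′∈Z

  -- The fibres of `digits` cover the line, and each is nowhere dense: negating the next bit of `b`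
  -- leaves the fibre over `b`. This settles the case in which the invariant is the successor of the
  -- continuum.
  covM≼𝔠 : ∀ {cov} → IsCovM cov → cov ≼ 𝔠
  covM≼𝔠 {cov} covM = covM≼index covM 𝔠 (λ b x → digits x ≡ b)
    (λ b → (λ _ x → digits x ≡ b) , (λ _ → nowhereDense {Z = _≡ b} (differ b)) , (λ p → 0 , p) , proj₂)
    (λ x → digits x , refl) id ext
    where
    differ : ∀ b s → ∃[ t ] ∀ z → Extends z (s ++ t) → ¬ z ≡ b
    differ b s = not (b (length s ℕ.+ 0)) ∷ [] , λ { z e refl → not-¬ refl (proj₁ (extends-++ s _ e)) }

  -- Sums of reals

  <⇒≱ℚ : ∀ {p q} → p ℚ.< q → ¬ q ℚ.≤ p
  <⇒≱ℚ p<q q≤p = ℚₚ.<-irrefl refl (ℚₚ.<-≤-trans p<q q≤p)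

  ½ε+½ε : ∀ ε → ½ ℚ.* ε ℚ.+ ½ ℚ.* ε ≡ ε
  ½ε+½ε ε = trans (sym (ℚₚ.*-distribʳ-+ ε ½ ½)) (ℚₚ.*-identityˡ ε)

  0<½ε : ∀ {ε} → 0ℚ ℚ.< ε → 0ℚ ℚ.< ½ ℚ.* ε
  0<½ε {ε} 0<ε = subst (ℚ._< ½ ℚ.* ε) (ℚₚ.*-zeroʳ ½) (ℚₚ.*-monoʳ-<-pos ½ 0<ε)

  ∣p-q∣<ε⇒p≤q+ε : ∀ {p q ε} → ∣ p ℚ.- q ∣ ℚ.< ε → p ℚ.≤ q ℚ.+ ε
  ∣p-q∣<ε⇒p≤q+ε {p} {q} {ε} h = subst (ℚ._≤ q ℚ.+ ε) (p+[q-p]≡q q p)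
    (ℚₚ.+-monoʳ-≤ q (ℚₚ.≤-trans (≤-abs (p ℚ.- q)) (ℚₚ.<⇒≤ h)))
    where
    ≤-abs : ∀ r → r ℚ.≤ ∣ r ∣
    ≤-abs r with ℚₚ.≤-total 0ℚ r
    ... | inj₁ 0≤r = ℚₚ.≤-reflexive (sym (ℚₚ.0≤p⇒∣p∣≡p 0≤r))
    ... | inj₂ r≤0 = ℚₚ.≤-trans r≤0 (ℚₚ.0≤∣p∣ r)

  -- The order of Defs, as a record type so that its arguments can be inferred.
  infix 4 _⊴_
  record _⊴_ (x y : ℝ) : Set where
    constructor eventually
    field
      below : ∀ ε → 0ℚ ℚ.< ε → ∃[ N ] ∀ n → N ℕ.≤ n → seq x n ℚ.≤ seq y n ℚ.+ ε

  ⊴⇒≤ℝ : ∀ {x y} → x ⊴ y → x ≤ℝ y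
  ⊴⇒≤ℝ {x} {y} (eventually below) (ε , 0<ε , M , gap) =
    <⇒≱ℚ y+½ε<y+ε (ℚₚ.≤-trans (gap n (ℕₚ.m≤m⊔n M N)) (h n (ℕₚ.m≤n⊔m M N)))
    where
    N = proj₁ (below (½ ℚ.* ε) (0<½ε 0<ε))
    h = proj₂ (below (½ ℚ.* ε) (0<½ε 0<ε))
    n = M ℕ.⊔ N
    y+½ε<y+ε : seq y n ℚ.+ ½ ℚ.* ε ℚ.< seq y n ℚ.+ ε
    y+½ε<y+ε = ℚₚ.+-monoʳ-< (seq y n) (subst (½ ℚ.* ε ℚ.<_) (½ε+½ε ε) (p<p+ε (½ ℚ.* ε) (0<½ε 0<ε)))

  ≤ℝ⇒⊴ : ∀ x y → x ≤ℝ y → x ⊴ y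
  ≤ℝ⇒⊴ x y x≤y = eventually λ ε 0<ε → by-contradiction λ none → x≤y (gap ε 0<ε none)
    where
    module _ (ε : ℚ) (0<ε : 0ℚ ℚ.< ε) (none : ¬ (∃[ N ] ∀ n → N ℕ.≤ n → seq x n ℚ.≤ seq y n ℚ.+ ε)) where
      open ℚₚ.≤-Reasoning
      -- A quarter of `ε` for each of the two Cauchy errors, which leaves half of `ε` as the witness
      -- for `y <ℝ x`.
      δ = ½ ℚ.* (½ ℚ.* ε)
      0<δ = 0<½ε (0<½ε 0<ε)
      X = proj₁ (cauchy x δ 0<δ)
      Y = proj₁ (cauchy y δ 0<δ)
      x-N = proj₂ (cauchy x δ 0<δ)
      y-N = proj₂ (cauchy y δ 0<δ)
      N = X ℕ.⊔ Y
      ring : ∀ y d h → ((y ℚ.+ d) ℚ.+ h) ℚ.+ d ≡ y ℚ.+ (h ℚ.+ (d ℚ.+ d))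
      ring y d h = trans (ℚₚ.+-assoc (y ℚ.+ d) h d) (trans (interchange y d h d) (ℚₚ.+-assoc y h (d ℚ.+ d)))
      cancel : ∀ {a b} → a ℚ.+ δ ℚ.< b ℚ.+ δ → a ℚ.≤ b
      cancel h = ℚₚ.≮⇒≥ λ b<a → ℚₚ.<-asym h (ℚₚ.+-monoˡ-< δ b<a)
      gap : y <ℝ x
      gap = ½ ℚ.* ε , 0<½ε 0<ε , N , λ n N≤n →
        let (m , h) = ¬∀⇒∃¬ λ all → none (N , all)
            N≤m = by-contradiction λ N≰m → h λ N≤m → ⊥-elim (N≰m N≤m)
            far : seq y m ℚ.+ ε ℚ.< seq x m
            far = ℚₚ.≰⇒> λ le → h λ _ → le
            xₘ≤ = ∣p-q∣<ε⇒p≤q+ε {seq x m} {seq x n} (x-N m n (ℕₚ.m⊔n≤o⇒m≤o X Y N≤m) (ℕₚ.m⊔n≤o⇒m≤o X Y N≤n))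
            yₙ≤ = ∣p-q∣<ε⇒p≤q+ε {seq y n} {seq y m} (y-N n m (ℕₚ.m⊔n≤o⇒n≤o X Y N≤n) (ℕₚ.m⊔n≤o⇒n≤o X Y N≤m))
        in cancel (begin-strict
             (seq y n ℚ.+ ½ ℚ.* ε) ℚ.+ δ          ≤⟨ ℚₚ.+-monoˡ-≤ δ (ℚₚ.+-monoˡ-≤ (½ ℚ.* ε) yₙ≤) ⟩
             ((seq y m ℚ.+ δ) ℚ.+ ½ ℚ.* ε) ℚ.+ δ  ≡⟨ ring (seq y m) δ (½ ℚ.* ε) ⟩
             seq y m ℚ.+ (½ ℚ.* ε ℚ.+ (δ ℚ.+ δ))  ≡⟨ cong (λ z → seq y m ℚ.+ (½ ℚ.* ε ℚ.+ z)) (½ε+½ε (½ ℚ.* ε)) ⟩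
             seq y m ℚ.+ (½ ℚ.* ε ℚ.+ ½ ℚ.* ε)    ≡⟨ cong (seq y m ℚ.+_) (½ε+½ε ε) ⟩
             seq y m ℚ.+ ε                       <⟨ far ⟩
             seq x m                            ≤⟨ xₘ≤ ⟩
             seq x n ℚ.+ δ                       ∎)

  ⊴-reflexive : ∀ {x y} → (∀ n → seq x n ≡ seq y n) → x ⊴ y
  ⊴-reflexive {x} {y} eq = eventually λ ε 0<ε → 0 , λ n _ →
    subst (ℚ._≤ seq y n ℚ.+ ε) (sym (eq n)) (ℚₚ.<⇒≤ (p<p+ε (seq y n) 0<ε))

  ⊴-refl : ∀ {x} → x ⊴ x
  ⊴-refl = ⊴-reflexive λ _ → refl

  ⊴-trans : ∀ {x y z} → x ⊴ y → y ⊴ z → x ⊴ z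
  ⊴-trans {z = z} (eventually x⊴y) (eventually y⊴z) = eventually λ ε 0<ε →
    let (M , h) = x⊴y (½ ℚ.* ε) (0<½ε 0<ε)
        (N , k) = y⊴z (½ ℚ.* ε) (0<½ε 0<ε)
    in M ℕ.⊔ N , λ n le → ℚₚ.≤-trans (h n (ℕₚ.m⊔n≤o⇒m≤o M N le))
         (ℚₚ.≤-trans (ℚₚ.+-monoˡ-≤ (½ ℚ.* ε) (k n (ℕₚ.m⊔n≤o⇒n≤o M N le)))
           (ℚₚ.≤-reflexive (trans (ℚₚ.+-assoc (seq z n) (½ ℚ.* ε) (½ ℚ.* ε)) (cong (seq z n ℚ.+_) (½ε+½ε ε)))))

  +ℝ-mono : ∀ {x x′ y y′} → x ⊴ x′ → y ⊴ y′ → x +ℝ y ⊴ x′ +ℝ y′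
  +ℝ-mono {x′ = x′} {y′ = y′} (eventually x⊴x′) (eventually y⊴y′) = eventually λ ε 0<ε →
    let (M , h) = x⊴x′ (½ ℚ.* ε) (0<½ε 0<ε)
        (N , k) = y⊴y′ (½ ℚ.* ε) (0<½ε 0<ε)
    in M ℕ.⊔ N , λ n le → ℚₚ.≤-trans
         (ℚₚ.+-mono-≤ (h n (ℕₚ.m⊔n≤o⇒m≤o M N le)) (k n (ℕₚ.m⊔n≤o⇒n≤o M N le)))
         (ℚₚ.≤-reflexive (trans (interchange (seq x′ n) (½ ℚ.* ε) (seq y′ n) (½ ℚ.* ε))
                                (cong (seq x′ n ℚ.+ seq y′ n ℚ.+_) (½ε+½ε ε))))

  fromℚ-mono : ∀ {p q} → p ℚ.≤ q → fromℚ p ⊴ fromℚ q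
  fromℚ-mono {p} {q} p≤q = eventually λ ε 0<ε → 0 , λ _ _ → ℚₚ.≤-trans p≤q (ℚₚ.<⇒≤ (p<p+ε q 0<ε))

  sum-insert : ∀ (g : ℕ → ℝ) x l l′ → g x +ℝ sumℝ (map g (l ++ l′)) ⊴ sumℝ (map g (l ++ x ∷ l′))
  sum-insert g x []      l′ = ⊴-refl
  sum-insert g x (y ∷ l) l′ = ⊴-trans
    (⊴-reflexive {g x +ℝ (g y +ℝ S)} {g y +ℝ (g x +ℝ S)} λ n → x∙yz≈y∙xz (seq (g x) n) (seq (g y) n) (seq S n))
    (+ℝ-mono {g y} {g y} {g x +ℝ S} ⊴-refl (sum-insert g x l l′))
    where
    S = sumℝ (map g (l ++ l′))

  sum-nonneg : ∀ {g : ℕ → ℝ} → (∀ n → 0ℝ ⊴ g n) → ∀ l → 0ℝ ⊴ sumℝ (map g l)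
  sum-nonneg nonneg []      = ⊴-refl
  sum-nonneg nonneg (x ∷ l) = ⊴-trans (⊴-reflexive {0ℝ} {0ℝ +ℝ 0ℝ} λ _ → refl)
                                      (+ℝ-mono {0ℝ} {_} {0ℝ} (nonneg x) (sum-nonneg nonneg l))

  sum-⊆ : ∀ {g : ℕ → ℝ} → (∀ n → 0ℝ ⊴ g n) → ∀ {ns} l → Unique ns → (∀ {x} → x ∈ₗ ns → x ∈ₗ l) →
          sumℝ (map g ns) ⊴ sumℝ (map g l)
  sum-⊆ nonneg {[]} l _ _ = sum-nonneg nonneg l
  sum-⊆ {g} nonneg {x ∷ ns} l (x∉ns ∷ unique) sub =
    subst (λ l → sumℝ (map g (x ∷ ns)) ⊴ sumℝ (map g l)) (sym l≡) (⊴-trans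
      (+ℝ-mono {g x} {g x} {sumℝ (map g ns)} {sumℝ (map g (l₁ ++ l₂))} ⊴-refl (sum-⊆ nonneg (l₁ ++ l₂) unique rest))
      (sum-insert g x l₁ l₂))
    where
    split = ∈-∃++ (sub (here refl))
    l₁ = proj₁ split
    l₂ = proj₁ (proj₂ split)
    l≡ : l ≡ l₁ ++ x ∷ l₂
    l≡ = proj₂ (proj₂ split)
    rest : ∀ {y} → y ∈ₗ ns → y ∈ₗ l₁ ++ l₂
    rest y∈ns with ∈-++⁻ l₁ (subst (_ ∈ₗ_) l≡ (sub (there y∈ns)))
    ... | inj₁ y∈l₁         = ∈-++⁺ˡ y∈l₁
    ... | inj₂ (here refl)  = ⊥-elim (All.lookup x∉ns y∈ns refl)
    ... | inj₂ (there y∈l₂) = ∈-++⁺ʳ l₁ y∈l₂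

  sum-++ : ∀ (g : ℕ → ℝ) l l′ n →
           seq (sumℝ (map g (l ++ l′))) n ≡ seq (sumℝ (map g l) +ℝ sumℝ (map g l′)) n
  sum-++ g []      l′ n = sym (ℚₚ.+-identityˡ _)
  sum-++ g (x ∷ l) l′ n = trans (cong (seq (g x) n ℚ.+_) (sum-++ g l l′ n)) (sym (ℚₚ.+-assoc (seq (g x) n) _ _))

  infixr 8 _×ℚ_
  _×ℚ_ : ℕ → ℚ → ℚ
  zero  ×ℚ q = 0ℚ
  suc m ×ℚ q = q ℚ.+ m ×ℚ q

  fromℚ-+ : ∀ p q → fromℚ p +ℝ fromℚ q ⊴ fromℚ (p ℚ.+ q)
  fromℚ-+ p q = ⊴-reflexive λ _ → refl

  sum-≤-× : ∀ (g : ℕ → ℝ) q {l} → All (λ x → g x ⊴ fromℚ q) l → sumℝ (map g l) ⊴ fromℚ (length l ×ℚ q)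
  sum-≤-× g q []       = ⊴-refl
  sum-≤-× g q (_∷_ {x} {l} h hs) = ⊴-trans
    (+ℝ-mono {g x} {fromℚ q} {sumℝ (map g l)} {fromℚ (length l ×ℚ q)} h (sum-≤-× g q hs)) (fromℚ-+ q _)

  ×-≤-sum : ∀ (g : ℕ → ℝ) q {l} → All (λ x → fromℚ q ⊴ g x) l → fromℚ (length l ×ℚ q) ⊴ sumℝ (map g l)
  ×-≤-sum g q []       = ⊴-refl
  ×-≤-sum g q (_∷_ {x} {l} h hs) = ⊴-trans (⊴-reflexive {y = fromℚ q +ℝ fromℚ (length l ×ℚ q)} λ _ → refl)
                                            (+ℝ-mono {fromℚ q} {g x} {fromℚ (length l ×ℚ q)} {sumℝ (map g l)} h
                                                (×-≤-sum g q hs))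

  ×ℚ-* : ∀ m q → m ×ℚ q ≡ m ×ℚ 1ℚ ℚ.* q
  ×ℚ-* zero    q = sym (ℚₚ.*-zeroˡ q)
  ×ℚ-* (suc m) q = trans (cong₂ ℚ._+_ (sym (ℚₚ.*-identityˡ q)) (×ℚ-* m q)) (sym (ℚₚ.*-distribʳ-+ q 1ℚ (m ×ℚ 1ℚ)))

  ≤-×ℚ-∣↥∣ : ∀ p → p ℚ.≤ ℤ.∣ ℚ.↥ p ∣ ×ℚ 1ℚ
  ≤-×ℚ-∣↥∣ p = subst₂ ℚ._≤_ (ℚₚ.↥p/↧p≡p p) (sym (×ℚ-1 ℤ.∣ ℚ.↥ p ∣))
    (/-≤ (ℚ.↥ p) (+ ℤ.∣ ℚ.↥ p ∣) (ℚ.↧ₙ p) 1 (numerator (ℚ.↥ p) (ℚ.denominator-1 p)))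
    where
    numerator : ∀ i d → i ℤ.* + 1 ℤ.≤ + ℤ.∣ i ∣ ℤ.* + suc d
    numerator (+ n)        d = subst₂ ℤ._≤_ (sym (ℤₚ.*-identityʳ (+ n))) (ℤₚ.pos-* n (suc d))
        (ℤ.+≤+ (ℕₚ.m≤m*n n (suc d)))
    numerator ℤ.-[1+ n ]   d = ℤ.-≤+
    ×ℚ-1 : ∀ m → m ×ℚ 1ℚ ≡ + m ℚ./ 1
    ×ℚ-1 zero    = refl
    ×ℚ-1 (suc m) = trans (cong (1ℚ ℚ.+_) (×ℚ-1 m)) (ℚₚ.toℚᵘ-injective (begin
      ℚ.toℚᵘ (1ℚ ℚ.+ + m ℚ./ 1)                   ≈⟨ ℚₚ.toℚᵘ-homo-+ 1ℚ (+ m ℚ./ 1) ⟩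
      ℚᵘ.1ℚᵘ ℚᵘ.+ ℚ.toℚᵘ (+ m ℚ./ 1)              ≈⟨ ℚᵘₚ.+-congʳ ℚᵘ.1ℚᵘ (ℚₚ.toℚᵘ-fromℚᵘ (ℚᵘ.mkℚᵘ (+ m) 0)) ⟩
      ℚᵘ.1ℚᵘ ℚᵘ.+ ℚᵘ.mkℚᵘ (+ m) 0                 ≈⟨ ℚᵘ.*≡*
          (cong (λ i → (+ 1 ℤ.+ i) ℤ.* + 1) (ℤₚ.*-identityʳ (+ m))) ⟩
      ℚᵘ.mkℚᵘ (+ suc m) 0                        ≈⟨ ℚᵘₚ.≃-sym (ℚₚ.toℚᵘ-fromℚᵘ (ℚᵘ.mkℚᵘ (+ suc m) 0)) ⟩
      ℚ.toℚᵘ (+ suc m ℚ./ 1)                     ∎))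
      where open ℚᵘₚ.≃-Reasoning

  archimedean : ∀ q {ε} → 0ℚ ℚ.< ε → ∃[ m ] q ℚ.≤ m ×ℚ ε
  archimedean q {ε} 0<ε = m , subst₂ ℚ._≤_ cancel (sym (×ℚ-* m ε))
    (ℚₚ.*-monoʳ-≤-nonNeg ε {{ℚₚ.pos⇒nonNeg ε}} (≤-×ℚ-∣↥∣ r))
    where
    instance
      positive : ℚ.Positive ε
      positive = ℚ.positive 0<ε
      nonzero : ℚ.NonZero ε
      nonzero = ℚₚ.pos⇒nonZero ε
    r = q ℚ.* ℚ.1/ ε
    m = ℤ.∣ ℚ.↥ r ∣
    cancel : r ℚ.* ε ≡ q
    cancel = trans (ℚₚ.*-assoc q (ℚ.1/ ε) ε) (trans (cong (q ℚ.*_) (ℚₚ.*-inverseˡ ε)) (ℚₚ.*-identityʳ q))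

  2^- : ℕ → ℚ
  2^- zero    = 1ℚ
  2^- (suc n) = ½ ℚ.* 2^- n

  0<2^- : ∀ n → 0ℚ ℚ.< 2^- n
  0<2^- zero    = ℚₚ.positive⁻¹ 1ℚ
  0<2^- (suc n) = 0<½ε (0<2^- n)

  2^-suc-≤ : ∀ n → 2^- (suc n) ℚ.≤ 2^- n
  2^-suc-≤ n = subst (2^- (suc n) ℚ.≤_) (½ε+½ε (2^- n)) (ℚₚ.<⇒≤ (p<p+ε (2^- (suc n)) (0<2^- (suc n))))

  2^-antitone : ∀ n k → 2^- (k ℕ.+ n) ℚ.≤ 2^- n
  2^-antitone n zero    = ℚₚ.≤-refl
  2^-antitone n (suc k) = ℚₚ.≤-trans (2^-suc-≤ (k ℕ.+ n)) (2^-antitone n k)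

  -- In essence k ≤ 2^k. It bounds the mass of `k` points each of which weighs at most 2^-(k+n).
  k×2^-≤ : ∀ k n → k ×ℚ 2^- (k ℕ.+ n) ℚ.≤ 2^- n
  k×2^-≤ zero    n = ℚₚ.<⇒≤ (0<2^- n)
  k×2^-≤ (suc k) n = begin
    2^- (suc k ℕ.+ n) ℚ.+ k ×ℚ 2^- (suc k ℕ.+ n)
      ≤⟨ ℚₚ.+-mono-≤ (ℚₚ.*-monoˡ-≤-nonNeg ½ (2^-antitone n k)) (ℚₚ.≤-reflexive (halved k (2^- (k ℕ.+ n)))) ⟩
    ½ ℚ.* 2^- n ℚ.+ ½ ℚ.* (k ×ℚ 2^- (k ℕ.+ n))
      ≤⟨ ℚₚ.+-monoʳ-≤ (½ ℚ.* 2^- n) (ℚₚ.*-monoˡ-≤-nonNeg ½ (k×2^-≤ k n)) ⟩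
    ½ ℚ.* 2^- n ℚ.+ ½ ℚ.* 2^- n ≡⟨ ½ε+½ε (2^- n) ⟩
    2^- n ∎
    where
    open ℚₚ.≤-Reasoning
    halved : ∀ k q → k ×ℚ (½ ℚ.* q) ≡ ½ ℚ.* (k ×ℚ q)
    halved zero    q = sym (ℚₚ.*-zeroʳ ½)
    halved (suc k) q = trans (cong (½ ℚ.* q ℚ.+_) (halved k q)) (sym (ℚₚ.*-distribˡ-+ ½ q (k ×ℚ q)))

  blocks : (ℕ → List ℕ) → ℕ → List ℕ
  blocks F zero    = []
  blocks F (suc N) = F 0 ++ blocks (F ∘ suc) N

  ∈-blocks : ∀ {F : ℕ → List ℕ} {x n N} → n ℕ.< N → x ∈ₗ F n → x ∈ₗ blocks F N
  ∈-blocks {F} {n = zero}  {suc N} _         x∈ = ∈-++⁺ˡ x∈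
  ∈-blocks {F} {n = suc n} {suc N} (s≤s n<N) x∈ = ∈-++⁺ʳ (F 0) (∈-blocks n<N x∈)

  -- Twice 2^-i is the whole geometric tail from `i` on; the offset `i` lets the induction strip off
  -- the first block.
  sum-blocks : ∀ (g : ℕ → ℝ) F i N → (∀ n → sumℝ (map g (F n)) ⊴ fromℚ (2^- (i ℕ.+ n))) →
               sumℝ (map g (blocks F N)) ⊴ fromℚ (2^- i ℚ.+ 2^- i)
  sum-blocks g F i zero small = fromℚ-mono (ℚₚ.<⇒≤ (ℚₚ.+-mono-< (0<2^- i) (0<2^- i)))
  sum-blocks g F i (suc N) small = ⊴-trans
    (⊴-reflexive {sumℝ (map g (blocks F (suc N)))} {sumℝ (map g (F 0)) +ℝ sumℝ (map g (blocks (F ∘ suc) N))}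
        (sum-++ g (F 0) (blocks (F ∘ suc) N)))
    (⊴-trans
      (+ℝ-mono {sumℝ (map g (F 0))} {fromℚ (2^- i)} {sumℝ (map g (blocks (F ∘ suc) N))}
          {fromℚ (2^- (suc i) ℚ.+ 2^- (suc i))}
        (subst (λ j → sumℝ (map g (F 0)) ⊴ fromℚ (2^- j)) (ℕₚ.+-identityʳ i) (small 0))
        (sum-blocks g (F ∘ suc) (suc i) N λ n →
          subst (λ j → sumℝ (map g (F (suc n))) ⊴ fromℚ (2^- j)) (ℕₚ.+-suc i n) (small (suc n))))
      (⊴-reflexive {fromℚ (2^- i) +ℝ fromℚ (2^- (suc i) ℚ.+ 2^- (suc i))} λ _ → cong (2^- i ℚ.+_) (½ε+½ε (2^- i))))

  summable-⋃ : ∀ {g} → (∀ n → 0ℝ ⊴ g n) → (F : ℕ → List ℕ) → (∀ n → sumℝ (map g (F n)) ⊴ fromℚ (2^- n)) →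
               ∀ {S} → (∀ {x} → x ∈ S → ∃[ n ] x ∈ₗ F n) → S ∈ Summable g
  summable-⋃ {g} nonneg F small {S} cover = fromℚ (1ℚ ℚ.+ 1ℚ) , λ ns unique ns∈S →
    let (N , sub) = within ns∈S
    in ⊴⇒≤ℝ (⊴-trans (sum-⊆ nonneg (blocks F N) unique sub) (sum-blocks g F 0 N small))
    where
    grow : ∀ {F M N y} → M ℕ.≤ N → y ∈ₗ blocks F M → y ∈ₗ blocks F N
    grow {F} {suc M} {suc N} (s≤s M≤N) y∈ with ∈-++⁻ (F 0) y∈
    ... | inj₁ y∈F0 = ∈-++⁺ˡ y∈F0
    ... | inj₂ y∈   = ∈-++⁺ʳ (F 0) (grow M≤N y∈)
    within : ∀ {ns} → All (_∈ S) ns → ∃[ N ] (∀ {x} → x ∈ₗ ns → x ∈ₗ blocks F N)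
    within [] = 0 , λ ()
    within (x∈S ∷ ns∈S) with within ns∈S | cover x∈S
    ... | N , sub | n , x∈Fn = suc n ℕ.⊔ N , λ
      { (here refl) → ∈-blocks (ℕₚ.m≤m⊔n (suc n) N) x∈Fn
      ; (there y∈)  → grow (ℕₚ.m≤n⊔m (suc n) N) (sub y∈) }

  -- Since chunks of mass 1 occur arbitrarily far out, any number of disjoint ones can be collected,
  -- and their total exceeds every bound.
  not-summable : ∀ {g S} →
    (∀ N → ∃[ ns ] Unique ns × All (λ x → x ∈ S × N ℕ.≤ x) ns × fromℚ 1ℚ ⊴ sumℝ (map g ns)) → S ∉ Summable g
  not-summable {g} {S} chunk (M , bound) =
    let (N , close) = cauchy M 1ℚ (ℚₚ.positive⁻¹ 1ℚ)
        -- One unit pays for the distance of later terms of `M` from `seq M N`, the other for the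
        -- strict inequality.
        (m , q≤m) = archimedean (seq M N ℚ.+ 1ℚ ℚ.+ 1ℚ) (ℚₚ.positive⁻¹ 1ℚ)
        (ns , unique , ns∈S , big) = chunks m
    in ⊴⇒≤ℝ (⊴-trans big (≤ℝ⇒⊴ (sumℝ (map g ns)) M (bound ns unique ns∈S)))
         (1ℚ , ℚₚ.positive⁻¹ 1ℚ , N , λ n N≤n →
           ℚₚ.≤-trans (ℚₚ.+-monoˡ-≤ 1ℚ (∣p-q∣<ε⇒p≤q+ε {seq M n} {seq M N} (close n N N≤n ℕₚ.≤-refl))) q≤m)
    where
    chunks : ∀ m → ∃[ ns ] Unique ns × All (_∈ S) ns × fromℚ (m ×ℚ 1ℚ) ⊴ sumℝ (map g ns)
    chunks zero = [] , [] , [] , ⊴-refl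
    chunks (suc m) =
      let (ns , unique , ns∈S , big) = chunks m
          (N , below) = list-bound ns
          (ns′ , unique′ , ns′∈ , big′) = chunk N
      in ns′ ++ ns ,
         Uniqueₚ.++⁺ unique′ unique (λ (x∈ns′ , x∈ns) → ℕₚ.<⇒≱ (below x∈ns) (proj₂ (All.lookup ns′∈ x∈ns′))) ,
         Allₚ.++⁺ (All.map proj₁ ns′∈) ns∈S ,
         ⊴-trans (⊴-reflexive {y = fromℚ 1ℚ +ℝ fromℚ (m ×ℚ 1ℚ)} λ _ → refl)
           (⊴-trans (+ℝ-mono {fromℚ 1ℚ} {sumℝ (map g ns′)} {fromℚ (m ×ℚ 1ℚ)} {sumℝ (map g ns)} big′ big)
             (⊴-reflexive {sumℝ (map g ns′) +ℝ sumℝ (map g ns)} {sumℝ (map g (ns′ ++ ns))} λ n →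
                 sym (sum-++ g ns′ ns n)))

  distinct-elements : ∀ {S} → ¬ Finite S → ∀ N m →
                      ∃[ ns ] Unique ns × All (λ x → x ∈ S × N ℕ.≤ x) ns × length ns ≡ m
  distinct-elements inf N zero    = [] , [] , [] , refl
  distinct-elements inf N (suc m) =
    let (ns , unique , ns∈ , len) = distinct-elements inf N m
        (M , below) = list-bound ns
        (x , x∈S , le) = unbounded⇐infinite inf (M ℕ.⊔ N)
    in x ∷ ns ,
       All.tabulate (λ {y} y∈ns x≡y → ℕₚ.<⇒≱ (below y∈ns) (subst (M ℕ.≤_) x≡y (ℕₚ.m⊔n≤o⇒m≤o M N le))) ∷ unique ,
       (x∈S , ℕₚ.m⊔n≤o⇒n≤o M N le) ∷ ns∈ , cong suc len

  Vanishing : (ℕ → ℝ) → Set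
  Vanishing g = ∀ n → ∃[ m ] ∀ i → m ℕ.≤ i → g i ⊴ fromℚ (2^- n)

  -- If `g` failed to be below 2^-n infinitely often, tallness would give an infinite summable set
  -- of such points; but a fixed number of them already has mass 1.
  tall⇒vanishing : ∀ {g} → Tall (Summable g) → Vanishing g
  tall⇒vanishing {g} tall n = by-contradiction λ none →
    let (T , T⊆S , T-inf , T-sum) = tall (λ i → ¬ g i ⊴ fromℚ (2^- n)) (infinite⇐unbounded λ N →
          let (i , h) = ¬∀⇒∃¬ λ all → none (N , all)
          in i , (λ le → h λ _ → le) , by-contradiction λ N≰i → h λ N≤i → ⊥-elim (N≰i N≤i))
        (m , 1≤m) = archimedean 1ℚ (0<2^- n)
    in not-summable {g} (λ N →
         let (ns , unique , ns∈ , len) = distinct-elements T-inf N m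
         in ns , unique , ns∈ , ⊴-trans
              (fromℚ-mono (subst (λ k → 1ℚ ℚ.≤ k ×ℚ 2^- n) (sym len) 1≤m))
              (×-≤-sum g (2^- n) (All.map (λ (x∈T , _) → large _ (T⊆S x∈T)) ns∈))) T-sum
    where
    large : ∀ x → ¬ g x ⊴ fromℚ (2^- n) → fromℚ (2^- n) ⊴ g x
    large x h = ≤ℝ⇒⊴ _ _ λ (ε , 0<ε , N , less) → h (eventually λ δ 0<δ → N , λ i N≤i →
      ℚₚ.≤-trans (ℚₚ.<⇒≤ (p<p+ε (seq (g x) i) 0<ε)) (ℚₚ.≤-trans (less i N≤i) (ℚₚ.<⇒≤ (p<p+ε (2^- n) 0<δ))))

  -- Choose `t j` in `S` with weight at most 2^-j. Since `t j` is also at least `j`, the range is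
  -- infinite even if values repeat.
  vanishing⇒tall : ∀ {g} → (∀ n → 0ℝ ⊴ g n) → Vanishing g → Tall (Summable g)
  vanishing⇒tall {g} nonneg vanishing S inf = (λ x → ∃[ j ] x ≡ t j) ,
    (λ { (j , refl) → proj₁ (proj₂ (pick j)) }) ,
    infinite⇐unbounded (λ N → t N , (N , refl) , ℕₚ.m⊔n≤o⇒m≤o N _ (proj₂ (proj₂ (pick N)))) ,
    summable-⋃ nonneg (λ j → t j ∷ [])
      (λ j → ⊴-trans (⊴-reflexive {g (t j) +ℝ 0ℝ} {g (t j)} λ n → ℚₚ.+-identityʳ _)
               (proj₂ (vanishing j) (t j) (ℕₚ.m⊔n≤o⇒n≤o j _ (proj₂ (proj₂ (pick j))))))
      (λ { (j , refl) → j , here refl })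
    where
    pick : ∀ j → ∃[ x ] x ∈ S × j ℕ.⊔ proj₁ (vanishing j) ℕ.≤ x
    pick j = unbounded⇐infinite inf (j ℕ.⊔ proj₁ (vanishing j))
    t : ℕ → ℕ
    t j = proj₁ (pick j)

  -- Category and generic sequences of finite sets

  -- An adaptive Cohen requirement: in state `q` at time `n` the machine hopes for `c n` to be
  -- `want q n`, and it changes its state only when this happens. `Generic` asks for infinitely many
  -- hits.
  record Machine : Set₁ where
    field
      State : Set
      start : State
      want  : State → ℕ → FinSet
      next  : State → ℕ → State

    Hit : (ℕ → FinSet) → State → ℕ → Set
    Hit c q n = c n ≡ want q n

    state : (ℕ → FinSet) → ℕ → State
    state c zero    = start
    state c (suc n) = if truth (Hit c (state c n) n) then next (state c n) n else state c n

    Generic : (ℕ → FinSet) → Set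
    Generic c = ∀ n → ∃[ m ] n ℕ.≤ m × Hit c (state c m) m

    state-hit : ∀ c n → Hit c (state c n) n → state c (suc n) ≡ next (state c n) n
    state-hit c n hit = cong (λ b → if b then next (state c n) n else state c n) (truth⁺ hit)

    state-miss : ∀ c n → ¬ Hit c (state c n) n → state c (suc n) ≡ state c n
    state-miss c n miss = cong (λ b → if b then next (state c n) n else state c n) (¬-not λ e → miss (truth⁻ e))

    state-cong : ∀ {c c′} n → (∀ i → i ℕ.< n → c i ≡ c′ i) → state c n ≡ state c′ n
    state-cong zero    eq = refl
    state-cong {c} {c′} (suc n) eq = trans
      (cong (λ q → if truth (c n ≡ want q n) then next q n else q) (state-cong n λ i i<n → eq i (ℕₚ.m≤n⇒m≤1+n i<n)))
      (cong (λ F → if truth (F ≡ want (state c′ n) n) then next (state c′ n) n else state c′ n) (eq n ℕₚ.≤-refl))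

  open Machine using (Generic)

  -- A bit sequence is read as finite sets: the n-th is coded by the length of
  -- the run of ones that starts at position n.

  Run : (ℕ → Bool) → ℕ → Set
  Run z zero    = z 0 ≡ false
  Run z (suc k) = z 0 ≡ true × Run (z ∘ suc) k

  run-unique : ∀ {z} k k′ → Run z k → Run z k′ → k ≡ k′
  run-unique zero    zero     _       _        = refl
  run-unique zero    (suc k′) e       (e′ , _) with () ← trans (sym e) e′
  run-unique (suc k) zero     (e , _) e′       with () ← trans (sym e) e′
  run-unique (suc k) (suc k′) (_ , r) (_ , r′) = cong suc (run-unique k k′ r r′)

  run-length : (ℕ → Bool) → ℕ
  run-length z = choose-or 0 λ k → truth (Run z k)

  run-length-≡ : ∀ {z k} → Run z k → run-length z ≡ k
  run-length-≡ {z} {k} r = run-unique _ k (truth⁻ (choose-or-spec 0 (λ k → truth (Run z k)) k (truth⁺ r))) r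

  read : (ℕ → Bool) → ℕ → FinSet
  read z n = decode (run-length (shift z n))

  first-false : List Bool → ℕ
  first-false []          = 0
  first-false (false ∷ u) = 0
  first-false (true  ∷ u) = suc (first-false u)

  run-first-false : ∀ {z} u rest → Extends z ((u ∷ʳ false) ++ rest) → Run z (first-false (u ∷ʳ false))
  run-first-false []          rest (e , _) = e
  run-first-false (false ∷ u) rest (e , _) = e
  run-first-false (true  ∷ u) rest (e , h) = e , run-first-false u rest h

  run-drop : ∀ {z} u rest → Extends z ((u ∷ʳ false) ++ rest) → ∀ i → i ℕ.≤ length u →
             Run (shift z i) (first-false (drop i (u ∷ʳ false)))
  run-drop u       rest h       zero    _         = run-first-false u rest h
  run-drop (b ∷ u) rest (_ , h) (suc i) (s≤s i≤u) = run-drop u rest h i i≤u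

  first-false-ones : ∀ k → first-false (replicate k true ∷ʳ false) ≡ k
  first-false-ones zero    = refl
  first-false-ones (suc k) = cong suc (first-false-ones k)

  length-∷ʳ : ∀ {a} {A : Set a} (l : List A) x → length (l ∷ʳ x) ≡ suc (length l)
  length-∷ʳ l x = trans (Listₚ.length-++ l) (ℕₚ.+-comm (length l) 1)

  not-generic-meager : ∀ M → Meager (λ x → ¬ Generic M (read (digits x)))
  not-generic-meager M = (λ n x → Stuck n (digits x)) , (λ n → nowhereDense {Z = Stuck n} (escape n)) ,
    (λ not-generic → let (n , h) = ¬∀⇒∃¬ not-generic in n , λ m n≤m hit → h (m , n≤m , hit)) ,
    λ (n , stuck) generic → let (m , n≤m , hit) = generic n in stuck m n≤m hit
    where
    open Machine M using (Hit; state; want)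
    Stuck : ℕ → (ℕ → Bool) → Set
    Stuck n z = ∀ m → n ℕ.≤ m → ¬ Hit (read z) (state (read z) m) m
    escape : ∀ n s → ∃[ t ] ∀ z → Extends z (s ++ t) → ¬ Stuck n z
    -- The ones push the position past `n`, and the zero ends every run begun so far, which fixes
    -- all sets read before position `m` and thereby the state at `m`. The last run then codes the
    -- very set wanted at `m`.
    escape n s = replicate n true ++ (false ∷ replicate k true ∷ʳ false) , λ z h stuck →
      let h₁ = subst (Extends z) assoc h
          agree : ∀ i → i ℕ.< m → read z i ≡ c i
          agree i i<m = cong decode (run-length-≡
              (run-drop u _ h₁ i (ℕₚ.≤-pred (subst (i ℕ.<_) (length-∷ʳ u false) i<m))))
          h₂ = extends-++ (u ∷ʳ false) _ h₁
          last : run-length (shift z m) ≡ k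
          last = trans (run-length-≡ (run-first-false (replicate k true) []
              (subst (Extends (shift z m)) (sym (Listₚ.++-identityʳ _)) h₂))) (first-false-ones k)
      in stuck m n≤m (trans (cong decode last)
          (trans (decode-code _) (cong (λ q → want q m) (sym (Machine.state-cong M m agree)))))
      where
      u = s ++ replicate n true
      m = length (u ∷ʳ false)
      c : ℕ → FinSet
      c i = decode (first-false (drop i (u ∷ʳ false)))
      k = code (want (state c m) m)
      n≤m : n ℕ.≤ m
      n≤m = ℕₚ.≤-trans (ℕₚ.≤-trans (ℕₚ.≤-reflexive (sym (Listₚ.length-replicate n)))
          (ℕₚ.≤-trans (ℕₚ.m≤n+m _ (length s)) (ℕₚ.≤-reflexive (sym (Listₚ.length-++ s)))))
              (ℕₚ.≤-trans (ℕₚ.n≤1+n (length u)) (ℕₚ.≤-reflexive (sym (length-∷ʳ u false))))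
      assoc : s ++ (replicate n true ++ (false ∷ replicate k true ∷ʳ false)) ≡ (u ∷ʳ false) ++
          (replicate k true ∷ʳ false)
      assoc = trans (sym (Listₚ.++-assoc s (replicate n true) _)) (sym (Listₚ.++-assoc u (false ∷ []) _))

  -- A Rasiowa-Sikorski construction: at time `pair i n`, which is at least `n`, the sequence gives
  -- the `i`-th machine what it wants.
  simultaneously-generic : (M : ℕ → Machine) → ∃[ c ] ∀ i → Generic (M i) c
  simultaneously-generic M = c , λ i n →
    let m = pair i n
        scheduled : proj₁ (unpair m) ≡ i
        scheduled = cong proj₁ (unpair-pair i n)
    in m , ≤-pair i n , subst (λ j → Machine.Hit (M j) c (Machine.state (M j) c m) m) scheduled (c-spec m)
    where
    demand : (ℕ → FinSet) → ℕ → FinSet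
    demand c n = Machine.want (M (proj₁ (unpair n))) (Machine.state (M (proj₁ (unpair n))) c n) n
    initial : ℕ → List FinSet
    initial zero    = []
    initial (suc n) = initial n ∷ʳ demand (lookup-or [] (initial n)) n
    length-initial : ∀ n → length (initial n) ≡ n
    length-initial zero    = refl
    length-initial (suc n) = trans (length-∷ʳ (initial n) _) (cong suc (length-initial n))
    limit = chain-limit [] initial (λ n → _ , refl) λ N → N , ℕₚ.≤-reflexive (sym (length-initial N))
    c = proj₁ limit
    initial-≡ : ∀ n → initial n ≡ applyUpTo c n
    initial-≡ n = trans (proj₂ limit n) (cong (applyUpTo c) (length-initial n))
    c-spec : ∀ n → c n ≡ demand c n
    c-spec n = trans (sym (last (applyUpTo-snoc c n)))
      (cong (λ q → Machine.want (M (proj₁ (unpair n))) q n) (Machine.state-cong (M (proj₁ (unpair n))) n before))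
      where
      before : ∀ i → i ℕ.< n → lookup-or [] (initial n) i ≡ c i
      before = applyUpTo-injective n (trans (cong (applyUpTo (lookup-or [] (initial n))) (sym (length-initial n)))
        (trans (applyUpTo-lookup [] (initial n)) (initial-≡ n)))
      applyUpTo-snoc : ∀ {a} {A : Set a} (c : ℕ → A) n → applyUpTo c (suc n) ≡ applyUpTo c n ∷ʳ c n
      applyUpTo-snoc c n = sym (Listₚ.applyUpTo-∷ʳ c n)
      last : applyUpTo c (suc n) ≡ applyUpTo c n ∷ʳ c n → demand (lookup-or [] (initial n)) n ≡ c n
      last e = Listₚ.∷ʳ-injectiveʳ (initial n) (applyUpTo c n) (trans (initial-≡ (suc n)) e)

  -- The set collected by a sequence of finite sets, and generic runs of the game

  Small : (ℕ → ℝ) → ℕ → FinSet → Set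
  Small g n F = sumℝ (map g (deduplicate ℕₚ._≟_ F)) ⊴ fromℚ (2^- n)

  collected : (ℕ → FinSet → Set) → (ℕ → FinSet) → Subset
  collected P c x = ∃[ n ] P n (c n) × x ∈ₗ c n

  collected-summable : ∀ {g} → (∀ n → 0ℝ ⊴ g n) → ∀ c → collected (Small g) c ∈ Summable g
  collected-summable {g} nonneg c = summable-⋃ nonneg (λ n → proj₁ (kept n)) (λ n → proj₁ (proj₂ (kept n)))
    λ (n , small , x∈) → n , proj₂ (proj₂ (kept n)) small x∈
    where
    kept : ∀ n → ∃[ F ] sumℝ (map g F) ⊴ fromℚ (2^- n) × (Small g n (c n) → ∀ {x} → x ∈ₗ c n → x ∈ₗ F)
    kept n = keep em
      where
      keep : Dec (Small g n (c n)) → ∃[ F ] sumℝ (map g F) ⊴ fromℚ (2^- n) ×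
          (Small g n (c n) → ∀ {x} → x ∈ₗ c n → x ∈ₗ F)
      keep (yes small) = deduplicate ℕₚ._≟_ (c n) , small , λ _ → ∈-deduplicate⁺ ℕₚ._≟_
      keep (no ¬small) = [] , fromℚ-mono (ℚₚ.<⇒≤ (0<2^- n)) , λ small → ⊥-elim (¬small small)

  small-far : ∀ {g} → Vanishing g → ∀ n k →
              ∃[ m ] ∀ F → (∀ {x} → x ∈ₗ F → m ℕ.≤ x) → # F ℕ.≤ k → Small g n F
  small-far {g} vanishing n k = proj₁ (vanishing (k ℕ.+ n)) , λ F far #F≤k →
    let D = deduplicate ℕₚ._≟_ F
        small : ∀ {x} → x ∈ₗ D → g x ⊴ fromℚ (2^- (# F ℕ.+ n))
        small x∈ = ⊴-trans (proj₂ (vanishing (k ℕ.+ n)) _ (far (∈-deduplicate⁻ ℕₚ._≟_ F x∈)))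
          (fromℚ-mono (subst (λ j → 2^- j ℚ.≤ 2^- (# F ℕ.+ n))
            (trans (sym (ℕₚ.+-assoc (k ℕ.∸ # F) (# F) n)) (cong (ℕ._+ n) (ℕₚ.m∸n+n≡m #F≤k)))
            (2^-antitone (# F ℕ.+ n) (k ℕ.∸ # F))))
    in ⊴-trans (sum-≤-× g (2^- (# F ℕ.+ n)) {D} (All.tabulate small)) (fromℚ-mono (k×2^-≤ (# F) n))

  applyUpTo-∷ʳ-lookup : ∀ {a} {A : Set a} (d : A) l x →
    applyUpTo (lookup-or d (l ∷ʳ x)) (length l) ≡ l × applyUpTo (lookup-or d (l ∷ʳ x)) (suc (length l)) ≡ l ∷ʳ x
  applyUpTo-∷ʳ-lookup d l x =
    trans (applyUpTo-cong (length l) (λ i → lookup-++ d l (x ∷ []) i)) (applyUpTo-lookup d l) ,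
    trans (cong (applyUpTo (lookup-or d (l ∷ʳ x))) (sym (length-∷ʳ l x))) (applyUpTo-lookup d (l ∷ʳ x))

  module GenericRun {𝓙 : Family 0ℓ} (ideal : IsIdeal 𝓙) {P : ℕ → FinSet → Set}
                    (far : ∀ n k → ∃[ m ] ∀ F → (∀ {x} → x ∈ₗ F → m ℕ.≤ x) → # F ℕ.≤ k → P n F)
                    {A : Subset} {f : A ⟶ω} (σ : StrategyI) (winning : IsWinning 𝓙 A f σ) where
    open StrategyI σ
    open IsIdeal ideal

    bound : List FinSet → ℕ
    bound []       = first
    bound (G ∷ Gs) = proj₂ (respond (G ∷ Gs))

    bound-applyUpTo : ∀ G n → Play.k σ G n ≡ bound (applyUpTo G n)
    bound-applyUpTo G zero    = refl
    bound-applyUpTo G (suc n) = refl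

    -- `IsWinning` speaks of infinite plays, so the finite history is continued by empty moves of
    -- Player II.
    legal : ∀ Gs G → (∀ {x} → x ∈ₗ proj₁ (respond (Gs ∷ʳ G)) → ¬ x ∈ₗ G) ×
                     # (proj₁ (respond (Gs ∷ʳ G))) ℕ.≤ bound Gs
    legal Gs G =
      (λ {x} x∈F x∈G → disjoint x (subst (λ l → x ∈ₗ proj₁ (respond l)) (sym history) x∈F ,
          subst (x ∈ₗ_) (sym last) x∈G)) ,
      subst₂ (λ l k → # proj₁ (respond l) ℕ.≤ k) history
        (trans (bound-applyUpTo G′ (length Gs)) (cong bound (proj₁ (applyUpTo-∷ʳ-lookup [] Gs G)))) size
      where
      G′ = lookup-or [] (Gs ∷ʳ G)
      disjoint = proj₁ (proj₁ (winning G′) (length Gs))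
      size = proj₂ (proj₁ (winning G′) (length Gs))
      history : applyUpTo G′ (suc (length Gs)) ≡ Gs ∷ʳ G
      history = proj₂ (applyUpTo-∷ʳ-lookup [] Gs G)
      last : G′ (length Gs) ≡ G
      last = Listₚ.∷ʳ-injectiveʳ (applyUpTo G′ (length Gs)) Gs
        (trans (Listₚ.applyUpTo-∷ʳ G′ (length Gs)) history)

    -- Player II's n-th move excludes so much that Player I's answer is small at time n.
    gap : List FinSet → ℕ → FinSet
    gap Gs n = upTo (proj₁ (far n (bound Gs)))

    -- The state records the moves of Player II so far, and a hit is Player I's answer to the next
    -- one. Infinitely many hits therefore trace out a complete run against `σ`.
    machine : Machine
    machine = record
      { State = List FinSet
      ; start = []
      ; want  = λ Gs n → proj₁ (respond (Gs ∷ʳ gap Gs n))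
      ; next  = λ Gs n → Gs ∷ʳ gap Gs n
      }
    open Machine machine using (state; want; Hit; state-hit; state-miss)

    want-small : ∀ Gs n → P n (want Gs n)
    want-small Gs n = proj₂ (far n (bound Gs)) (want Gs n)
      (λ x∈ → ℕₚ.≮⇒≥ λ x<m → proj₁ (legal Gs (gap Gs n)) x∈ (∈-upTo⁺ x<m)) (proj₂ (legal Gs (gap Gs n)))

    -- The states along `c` grow to an infinite play `G` of Player II. Each answer to it equals some
    -- small `c n` and is therefore collected, while the answers have positive preimage because `σ`
    -- wins.
    generic-positive : ∀ c → Generic machine c → preimage A f (collected P c) ∉ 𝓙
    generic-positive c generic B∈𝓙 = proj₂ (winning G)
      (preimage A f (⋃ ℕ λ n → ⟦ Play.F σ G n ⟧) ,
       ⊆-closed (λ {x} (x∈A , j , y∈F) → x∈A , played⊆ j y∈F) B∈𝓙 ,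
       (λ p → p , proj₁ p) , proj₁)
      where
      growth : ∀ n → ∃[ e ] state c (suc n) ≡ state c n ++ e
      growth n with em {P = Hit c (state c n) n}
      ... | yes hit = _ , state-hit c n hit
      ... | no miss = [] , trans (state-miss c n miss) (sym (Listₚ.++-identityʳ _))
      unbounded : ∀ N → ∃[ n ] N ℕ.≤ length (state c n)
      unbounded zero    = 0 , z≤n
      unbounded (suc N) with unbounded N
      ... | n , N≤n with generic n
      ...   | m , n≤m , hit = suc m , subst (suc N ℕ.≤_)
                (sym (trans (cong length (state-hit c m hit)) (length-∷ʳ (state c m) _)))
                (s≤s (ℕₚ.≤-trans N≤n (grows n≤m)))
        where
        grows : ∀ {m n} → m ℕ.≤ n → length (state c m) ℕ.≤ length (state c n)
        grows {m} {n} m≤n = subst (λ j → length (state c m) ℕ.≤ length (state c j)) (ℕₚ.m∸n+n≡m m≤n) (grow (n ℕ.∸ m))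
          where
          grow : ∀ k → length (state c m) ℕ.≤ length (state c (k ℕ.+ m))
          grow zero    = ℕₚ.≤-refl
          grow (suc k) = ℕₚ.≤-trans (grow k) (subst (length (state c (k ℕ.+ m)) ℕ.≤_)
            (sym (trans (cong length (proj₂ (growth (k ℕ.+ m)))) (Listₚ.length-++ (state c (k ℕ.+ m)))))
                (ℕₚ.m≤m+n _ _))
      limit = chain-limit [] (state c) growth unbounded
      G = proj₁ limit
      played-by : ∀ n j → j ℕ.< length (state c n) → ∀ {x} → x ∈ₗ Play.F σ G j → x ∈ collected P c
      played-by (suc n) j j<len {x} x∈F with em {P = Hit c (state c n) n}
      ... | no miss = played-by n j (subst (λ l → j ℕ.< length l) (state-miss c n miss) j<len) x∈F
      ... | yes hit with ℕₚ.m≤n⇒m<n∨m≡n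
          (ℕₚ.≤-pred (subst (j ℕ.<_) (trans (cong length (state-hit c n hit)) (length-∷ʳ (state c n) _)) j<len))
      ...   | inj₁ j<len′ = played-by n j j<len′ x∈F
      ...   | inj₂ refl   = n , subst (P n) (sym hit) (want-small (state c n) n) ,
                subst (x ∈ₗ_) (sym hit) (subst (λ l → x ∈ₗ proj₁ (respond l)) history x∈F)
        where
        history : applyUpTo G (suc (length (state c n))) ≡ state c n ∷ʳ gap (state c n) n
        history = trans (cong (applyUpTo G) (sym (trans (cong length (state-hit c n hit)) (length-∷ʳ (state c n) _))))
          (trans (sym (proj₂ limit (suc n))) (state-hit c n hit))
      played⊆ : ∀ j {x} → x ∈ₗ Play.F σ G j → x ∈ collected P c
      played⊆ j = let (n , j<len) = unbounded (suc j) in played-by n j j<len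

  -- From winning strategies to cov(M) ≤ fip

  idle : Machine
  idle = record { State = Unit.⊤ ; start = Unit.tt ; want = λ _ _ → [] ; next = λ q _ → q }

  WinsEverywhere : Family 0ℓ → Set₁
  WinsEverywhere 𝓙 = ∀ A → A ∉ 𝓙 → (f : A ⟶ω) → ToOne 𝓙 A f → PlayerIWins 𝓙 A f

  module Capture {𝓙 : Family 0ℓ} (ideal : IsIdeal 𝓙) (wins : WinsEverywhere 𝓙)
                 {P : ℕ → FinSet → Set}
                 (far : ∀ n k → ∃[ m ] ∀ F → (∀ {x} → x ∈ₗ F → m ℕ.≤ x) → # F ℕ.≤ k → P n F)
                 (f : ℕ → ℕ) {K : Set} (fam : K → Subset) where
    open IsIdeal ideal

    meet : List K → Subset
    meet s = ⋂ₗ (map fam s)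

    meet-++ˡ : ∀ s s′ → meet (s ++ s′) ⊆ meet s
    meet-++ˡ []      s′ _       = Unit.tt
    meet-++ˡ (k ∷ s) s′ (x , h) = x , meet-++ˡ s s′ h

    meet-++ʳ : ∀ s s′ → meet (s ++ s′) ⊆ meet s′
    meet-++ʳ []      s′ h       = h
    meet-++ʳ (k ∷ s) s′ (_ , h) = meet-++ʳ s s′ h

    Heavy : Subset → Subset
    Heavy A n = (λ x → f x ≡ n × x ∈ A) ∉ 𝓙

    Captures : Subset → Subset → Machine → Set
    Captures Z A M = ∀ c → Generic M c → (λ x → f x ∈ collected P c ∪ Z × x ∈ A) ∉ 𝓙

    heavy-captures : ∀ {Z A n} → n ∈ Heavy A → n ∈ Z → Captures Z A idle
    heavy-captures heavy n∈Z c _ h = heavy (⊆-closed (λ { (refl , x∈A) → inj₂ n∈Z , x∈A }) h)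

    -- At time `n` the machine wants the singleton of a heavy point lying so far out that the
    -- singleton passes the test `P n`.
    infinite-captures : ∀ {A} → ¬ Finite (Heavy A) → ∃[ M ] Captures ∅ A M
    infinite-captures {A} inf = M , captures
      where
      pick : ∀ n → ∃[ i ] i ∈ Heavy A × proj₁ (far n 1) ℕ.≤ i
      pick n = unbounded⇐infinite inf (proj₁ (far n 1))
      M : Machine
      M = record { State = Unit.⊤ ; start = Unit.tt ; want = λ _ n → proj₁ (pick n) ∷ [] ; next = λ q _ → q }
      captures : Captures ∅ A M
      captures c generic h =
        let (m , _ , hit) = generic 0
            (i , heavy , m≤i) = pick m
            small = proj₂ (far m 1) (i ∷ []) (λ { (here e) → subst (proj₁ (far m 1) ℕ.≤_) (sym e) m≤i }) ℕₚ.≤-refl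
        in heavy (⊆-closed (λ {x} (e , x∈A) →
             inj₁ (m , subst (P m) (sym hit) small , subst (f x ∈ₗ_) (sym hit) (here e)) , x∈A) h)

    -- Without heavy points `f` is 𝓙-to-one on `A′`, so the game is available there; positivity
    -- passes from `A′` to the larger set `A`.
    toOne-captures : ∀ {A A′ Z} → A′ ⊆ A → A′ ∉ 𝓙 → (∀ n → n ∉ Heavy A′) → ∃[ M ] Captures Z A M
    toOne-captures {A} {A′} A′⊆A A′∉𝓙 none =
      let (σ , winning) = wins A′ A′∉𝓙 (λ n _ → f n) toOne
          open GenericRun ideal far σ winning
      in machine , λ c generic h → generic-positive c generic
           (⊆-closed (λ (x∈A′ , y∈) → inj₁ y∈ , A′⊆A x∈A′) h)
      where
      toOne : ToOne 𝓙 A′ (λ n _ → f n)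
      toOne n = ⊆-closed (λ (x∈A′ , e) → e , x∈A′) (by-contradiction (none n))

    -- If `meet s₀` has finitely many heavy points, these form `Z`. For any `s`, a heavy point of
    -- `meet (s₀ ++ s)` is heavy for both `meet s₀` and `meet s`, hence lies in `Z` and serves `s`;
    -- if there is none, the game is played on `meet (s₀ ++ s)`.
    capture : (∀ s → meet s ∉ 𝓙) → ∃[ Z ] Finite Z × ∀ s → ∃[ M ] Captures Z (meet s) M
    capture positive with em {P = ∃[ s₀ ] Finite (Heavy (meet s₀))}
    ... | no none = ∅ , ([] , λ ()) , λ s → infinite-captures λ fin → none (s , fin)
    ... | yes (s₀ , fin) = Heavy (meet s₀) , fin , cases
      where
      cases : ∀ s → ∃[ M ] Captures (Heavy (meet s₀)) (meet s) M
      cases s with em {P = ∃[ n ] n ∈ Heavy (meet (s₀ ++ s))}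
      ... | yes (n , heavy) = idle , heavy-captures {Heavy (meet s₀)} {n = n} (grow (meet-++ʳ s₀ s))
          (grow (meet-++ˡ s₀ s))
        where
        grow : ∀ {A} → meet (s₀ ++ s) ⊆ A → n ∈ Heavy A
        grow sub h = heavy (⊆-closed (λ (e , x∈) → e , sub x∈) h)
      ... | no light = toOne-captures {Z = Heavy (meet s₀)} (meet-++ʳ s₀ s) (positive (s₀ ++ s)) λ n heavy →
          light (n , heavy)

  covM≼non-extendable :
    ∀ {𝓘 𝓙 : Family 0ℓ} → IsIdeal 𝓘 → IsIdeal 𝓙 → ∃[ g ] (TallSummable g × Summable g ⊆ 𝓘) → WinsEverywhere 𝓙 →
    ∀ {cov} → IsCovM cov → ∀ {κ 𝒜} → HasFIP⁺ 𝓙 𝒜 → ¬ Extendable 𝓘 𝓙 ω^ω 𝒜 → 𝒜 HasCardinality κ → cov ≼ κ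
  covM≼non-extendable {𝓘} {𝓙} ideal𝓘 ideal𝓙 (g , tallSummable , g⊆𝓘) wins {cov} covM {κ} {𝒜} ((S₀ , S₀∈𝒜) , fip)
      ¬ext card =
    conclude (countable-or-ℕ-embeds (proj₁ (index S₀∈𝒜)))
    where
    open TallSummable tallSummable using (nonneg; tall)
    open Bijection card using (to; surjective)
    open Setoid κ using (Carrier) renaming (_≈_ to _≈κ_; sym to ≈-sym; trans to ≈-trans; reflexive to ≈-reflexive)
    open Representatives κ

    nonneg-⊴ : ∀ n → 0ℝ ⊴ g n
    nonneg-⊴ n = ≤ℝ⇒⊴ 0ℝ (g n) (nonneg n)

    -- One representative for each class of `κ`, so that the results on plain types with
    -- propositional equality apply.
    K : Set
    K = Σ[ x ∈ Carrier ] rep x ≡ x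

    K-injective : ∀ {k k′ : K} → proj₁ k ≈κ proj₁ k′ → k ≡ k′
    K-injective {x , p} {y , q} x≈y = same (trans (sym p) (trans (rep-cong x≈y) q)) p q
      where
      same : ∀ {x y} → x ≡ y → (p : rep x ≡ x) (q : rep y ≡ y) → _≡_ {A = K} (x , p) (y , q)
      same refl p q = cong (_ ,_) (≡-irrelevant p q)

    fam : K → Subset
    fam (x , _) = proj₁ (to x)

    fam∈𝒜 : ∀ k → fam k ∈ 𝒜
    fam∈𝒜 (x , _) = proj₂ (to x)

    index : ∀ {S} → S ∈ 𝒜 → ∃[ k ] fam k ≐ S
    index {S} S∈𝒜 = let (x , h) = surjective (S , S∈𝒜) in
      (rep x , rep-cong (≈-sym (rep-≈ x))) , h (≈-sym (rep-≈ x))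

    f : ℕ → ℕ
    f = proj₁ (¬∀⇒∃¬ ¬ext)

    no-extension : ¬ (∃[ B ] B ∈ 𝓘 × HasFIP⁺ 𝓙 (𝒜 ∪｛ f ⊢ B ｝))
    no-extension h = proj₂ (¬∀⇒∃¬ ¬ext) λ _ → h

    open Capture ideal𝓙 wins {Small g} (small-far (tall⇒vanishing tall)) f fam

    captured : ∃[ Z ] Finite Z × ∀ s → ∃[ M ] Captures Z (meet s) M
    captured = capture λ s → fip (map fam s) (all s)
      where
      all : ∀ s → All (_∈ 𝒜) (map fam s)
      all []      = []
      all (k ∷ s) = fam∈𝒜 k ∷ all s

    Z = proj₁ captured
    M : List K → Machine
    M s = proj₁ (proj₂ (proj₂ captured) s)

    -- Such a `c` would yield a set `B` that extends the family: the intersection of finitely many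
    -- members of the enlarged family contains some `meet s` intersected with the preimage of `B`.
    not-all-generic : ∀ c → ¬ (∀ s → Generic (M s) c)
    not-all-generic c generic = no-extension (B , B∈𝓘 , (S₀ , inj₁ S₀∈𝒜) , λ Ss Ss∈ h →
      let (s , sub) = meets Ss∈
      in proj₂ (proj₂ (proj₂ captured) s) c (generic s) (IsIdeal.⊆-closed ideal𝓙 (λ {x} → sub {x}) h))
      where
      B : Subset
      B = collected (Small g) c ∪ Z
      B∈𝓘 : B ∈ 𝓘
      B∈𝓘 = IsIdeal.∪-closed ideal𝓘 (g⊆𝓘 (collected-summable nonneg-⊴ c))
          (IsIdeal.finite ideal𝓘 (proj₁ (proj₂ captured)))
      meets : ∀ {Ss} → All (_∈ (𝒜 ∪｛ f ⊢ B ｝)) Ss → ∃[ s ] ∀ {x} → f x ∈ B × x ∈ meet s → x ∈ ⋂ₗ Ss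
      meets [] = [] , λ _ → Unit.tt
      meets (inj₁ S∈𝒜 ∷ Ss∈) = let (s , sub) = meets Ss∈
                                   (k , sub′ , _) = index S∈𝒜
                               in k ∷ s , λ (fx∈B , x∈k , x∈s) → sub′ x∈k , sub (fx∈B , x∈s)
      meets (inj₂ (_ , sub′) ∷ Ss∈) = let (s , sub) = meets Ss∈
                                      in s , λ (fx∈B , x∈s) → sub′ fx∈B , sub (fx∈B , x∈s)

    conclude : (∃[ e ] ∀ (k : K) → ∃[ n ] e n ≡ k) ⊎ (∃[ i ] ∀ {m n} → i m ≡ i n → m ≡ n) → cov ≼ κ
    -- Countably many requirements are met by a single sequence, so this case is contradictory.
    conclude (inj₁ (e , onto)) =
      let (c , generic) = simultaneously-generic (λ n → M (map e (decode n)))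
      in ⊥-elim (not-all-generic c λ s →
           let (ns , eq) = lift s
           in subst (λ s → Generic (M s) c) (trans (cong (map e) (decode-code ns)) eq) (generic (code ns)))
      where
      lift : ∀ s → ∃[ ns ] map e ns ≡ s
      lift []      = [] , refl
      lift (k ∷ s) = let (n , eq) = onto k
                         (ns , eqs) = lift s
                     in n ∷ ns , cong₂ _∷_ eq eqs
    -- Every real fails some requirement `M s`; the meager sets of failures are indexed by lists
    -- over `K`, and these lists inject into `κ`.
    conclude (inj₂ (i , i-inj)) =
      let (h , h-inj) = list-injection i i-inj
      in covM≼index covM κ (λ s x → ¬ Generic (M s) (read (digits x))) (λ s → not-generic-meager (M s))
           (λ x → ¬∀⇒∃¬ (not-all-generic (read (digits x)))) (λ s → proj₁ (h s))
           (λ e → h-inj (K-injective e))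

  covM≼fip :
    ∀ {𝓘 𝓙 : Family 0ℓ} → IsIdeal 𝓘 → IsIdeal 𝓙 → ∃[ g ] (TallSummable g × Summable g ⊆ 𝓘) → WinsEverywhere 𝓙 →
    ∀ {cov fip} → IsCovM cov → IsFip 𝓘 𝓙 ω^ω fip → cov ≼ fip
  covM≼fip ideal𝓘 ideal𝓙 summable wins {cov} {fip} covM (inj₁ (((𝔠≼fip , _) , _)) , _) = record
    { to        = λ x → 𝔠→fip.to (cov→𝔠.to x)
    ; cong      = λ e → 𝔠→fip.cong (cov→𝔠.cong e)
    ; injective = λ e → cov→𝔠.injective (𝔠→fip.injective e)
    }
    where
    module cov→𝔠 = Injection (covM≼𝔠 covM)
    module 𝔠→fip = Injection 𝔠≼fip
  covM≼fip ideal𝓘 ideal𝓙 summable wins covM (inj₂ (𝒜 , hasFIP , ¬ext , card) , _) =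
    covM≼non-extendable ideal𝓘 ideal𝓙 summable wins covM hasFIP ¬ext card

  -- Borel families are analytic

  AgreeBelow : ℕ → Subset → Subset → Set
  AgreeBelow n S T = ∀ m → m ℕ.< n → (m ∈ S → m ∈ T) × (m ∈ T → m ∈ S)

  _≡[<_]_ : (ℕ → ℕ) → ℕ → (ℕ → ℕ) → Set
  w ≡[< n ] v = ∀ i → i ℕ.< n → w i ≡ v i

  -- `𝒰` is the projection of a closed set of pairs (set, point of the Baire space); closedness says
  -- that a finite part of a pair already witnesses its failure to be a code.
  record Analytic (𝒰 : Family 0ℓ) : Set₁ where
    field
      Code     : Subset → (ℕ → ℕ) → Set
      closed   : ∀ S w → ¬ Code S w → ∃[ n ] ∀ T v → AgreeBelow n S T → w ≡[< n ] v → ¬ Code T v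
      sound    : ∀ {S w} → Code S w → S ∈ 𝒰
      complete : ∀ {S} → S ∈ 𝒰 → ∃[ w ] Code S w

  open Analytic

  -- The first value of the code names a basic neighbourhood inside `𝒰`. `Basic` quantifies over all
  -- subsets, and `truth` brings it down to `Set`.
  analytic-open : ∀ {𝒰} → Open 𝒰 → Analytic 𝒰
  analytic-open {𝒰} 𝒰-open = record
    { Code     = λ S w → truth (Basic S (w 0)) ≡ true
    ; closed   = λ S w miss → suc (w 0) , λ T v agree w≡v hit →
        miss (truth⁺ λ T′ agree′ → truth⁻ {P = Basic T (v 0)} hit T′ λ m m<v0 →
          let m<w0 = subst (m ℕ.<_) (sym (w≡v 0 (s≤s z≤n))) m<v0
              (to , from) = agree m (ℕₚ.m≤n⇒m≤1+n m<w0)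
              (to′ , from′) = agree′ m m<w0
          in (λ x → to′ (from x)) , λ x → to (from′ x))
    ; sound    = λ {S} {w} hit → truth⁻ {P = Basic S (w 0)} hit S λ m _ → id , id
    ; complete = λ {S} S∈𝒰 → let (n , h) = 𝒰-open S S∈𝒰 in (λ _ → n) , truth⁺ λ T agree →
        h T λ m m<n → mk⇔ (proj₁ (agree m m<n)) (proj₂ (agree m m<n))
    }
    where
    Basic : Subset → ℕ → Set₁
    Basic S n = ∀ T → AgreeBelow n S T → T ∈ 𝒰

  analytic-closed : ∀ {𝒰} → Open 𝒰 → Analytic (∁ 𝒰)
  analytic-closed {𝒰} 𝒰-open = record
    { Code     = λ S _ → S ∉ 𝒰
    ; closed   = λ S w miss → let (n , h) = 𝒰-open S (by-contradiction miss) in n , λ T v agree _ T∉𝒰 →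
        T∉𝒰 (h T λ m m<n → mk⇔ (proj₁ (agree m m<n)) (proj₂ (agree m m<n)))
    ; sound    = id
    ; complete = λ S∉𝒰 → (λ _ → 0) , S∉𝒰
    }

  analytic-⋃ : ∀ {𝒰 : ℕ → Family 0ℓ} → (∀ n → Analytic (𝒰 n)) → Analytic (⋃ ℕ 𝒰)
  analytic-⋃ a = record
    { Code     = λ S w → Code (a (w 0)) S (w ∘ suc)
    ; closed   = λ S w miss → let (n , h) = closed (a (w 0)) S (w ∘ suc) miss in suc n , λ T v agree w≡v hit →
        h T (v ∘ suc) (λ m m<n → agree m (ℕₚ.m≤n⇒m≤1+n m<n)) (λ i i<n → w≡v (suc i) (s≤s i<n))
          (subst (λ i → Code (a i) T (v ∘ suc)) (sym (w≡v 0 (s≤s z≤n))) hit)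
    ; sound    = λ {S} {w} hit → w 0 , sound (a (w 0)) hit
    ; complete = λ (n , S∈) → let (w , hit) = complete (a n) S∈ in (λ { zero → n ; (suc i) → w i }) , hit
    }

  -- A code interleaves one code for each of the countably many sets. If the `i`-th fails, its
  -- failure is seen on finitely many places `pair i j`.
  analytic-⋂ : ∀ {𝒰 : ℕ → Family 0ℓ} → (∀ n → Analytic (∁ (𝒰 n))) → Analytic (∁ (⋃ ℕ 𝒰))
  analytic-⋂ a = record
    { Code     = λ S w → ∀ i → Code (a i) S (w ∘ pair i)
    ; closed   = λ S w miss →
        let (i , missᵢ) = ¬∀⇒∃¬ miss
            (n , h) = closed (a i) S (w ∘ pair i) missᵢ
            (N , below) = list-bound (map (pair i) (upTo n))
        in n ℕ.⊔ N , λ T v agree w≡v hit →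
             h T (v ∘ pair i) (λ m m<n → agree m (ℕₚ.<-≤-trans m<n (ℕₚ.m≤m⊔n n N)))
               (λ j j<n → w≡v (pair i j) (ℕₚ.<-≤-trans (below (∈-map⁺ (pair i) (∈-upTo⁺ j<n))) (ℕₚ.m≤n⊔m n N)))
               (hit i)
    ; sound    = λ hit (n , S∈) → sound (a n) (hit n) S∈
    ; complete = λ {S} S∉ →
        let w : ∀ i → ∃[ w ] Code (a i) S w
            w i = complete (a i) λ S∈ → S∉ (i , S∈)
        in (λ m → proj₁ (w (proj₁ (unpair m))) (proj₂ (unpair m))) , λ i →
             subst (Code (a i) S) (ext λ j → cong (λ (i , j) → proj₁ (w i) j) (sym (unpair-pair i j))) (proj₂ (w i))
    }

  analytic-≐ : ∀ {𝒰 𝒱 : Family 0ℓ} → 𝒰 ⊆ 𝒱 → 𝒱 ⊆ 𝒰 → Analytic 𝒰 → Analytic 𝒱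
  analytic-≐ to from a = record
    { Code = Code a ; closed = closed a ; sound = λ hit → to (sound a hit) ; complete = λ S∈ → complete a (from S∈) }

  -- The induction treats a family together with its complement, so complementation merely exchanges
  -- the two.
  borel-analytic : ∀ {𝒰} → Borel 𝒰 → Analytic 𝒰 × Analytic (∁ 𝒰)
  borel-analytic (open-set 𝒰-open) = analytic-open 𝒰-open , analytic-closed 𝒰-open
  borel-analytic (complement b) =
    let (a , a′) = borel-analytic b in a′ , analytic-≐ (λ S∈ S∉ → S∉ S∈) by-contradiction a
  borel-analytic (union b) =
    analytic-⋃ (λ n → proj₁ (borel-analytic (b n))) , analytic-⋂ (λ n → proj₂ (borel-analytic (b n)))
  borel-analytic (≐-closed (to , from) b) =
    let (a , a′) = borel-analytic b in
    analytic-≐ to from a , analytic-≐ (λ S∉ S∈ → S∉ (from S∈)) (λ S∉ S∈ → S∉ (to S∈)) a′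

  -- A point w of the Baire space codes the set {n : (w n)₀ = 0}.
  Coded : (ℕ → ℕ) → Subset
  Coded w n = proj₁ (unpair (w n)) ≡ 0

  coded-agree : ∀ {w v n} → w ≡[< n ] v → ∀ m → m ℕ.< n → m ∈ Coded w → m ∈ Coded v
  coded-agree w≡v m m<n = subst (λ i → proj₁ (unpair i) ≡ 0) (w≡v m m<n)

  record ClosedBase (𝓙 : Family 0ℓ) : Set₁ where
    field
      Base          : (ℕ → ℕ) → Set
      base-closed   : ∀ w → ¬ Base w → ∃[ n ] ∀ v → w ≡[< n ] v → ¬ Base v
      base-sound    : ∀ {w} → Base w → Coded w ∈ 𝓙
      base-complete : ∀ {S} → S ∈ 𝓙 → ∃[ w ] Base w × S ⊆ Coded w

  -- The first components of a point describe a set, the second components a code that this set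
  -- belongs to 𝓙.
  closedBase : ∀ {𝓙} → Analytic 𝓙 → ClosedBase 𝓙
  closedBase {𝓙} a = record
    { Base          = λ w → Code a (Coded w) (rest w)
    ; base-closed   = λ w miss → let (n , h) = closed a (Coded w) (rest w) miss in n , λ v w≡v →
        h (Coded v) (rest v) (λ m m<n → coded-agree {w} {v} w≡v m m<n ,
            coded-agree {v} {w} (λ i i<n → sym (w≡v i i<n)) m m<n)
          (λ i i<n → cong (proj₂ ∘ unpair) (w≡v i i<n))
    ; base-sound    = sound a
    ; base-complete = λ {S} S∈𝓙 → let (v , hit) = complete a S∈𝓙 in
        -- `Coded (join S v)` equals `S` only extensionally. Closedness makes up for this: a failure
        -- of the joined pair would refute `S` and `v` as well.
        join S v , by-contradiction (λ miss → let (n , h) = closed a (Coded (join S v)) (rest (join S v)) miss in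
          h S v (λ m _ → coded-join⁻ S v m , coded-join⁺ S v m)
              (λ i _ → cong proj₂ (unpair-pair (bit S i) (v i))) hit) ,
        λ {m} → coded-join⁺ S v m
    }
    where
    rest : (ℕ → ℕ) → ℕ → ℕ
    rest w = proj₂ ∘ unpair ∘ w
    bit : Subset → ℕ → ℕ
    bit S n = if truth (n ∈ S) then 0 else 1
    join : Subset → (ℕ → ℕ) → ℕ → ℕ
    join S v n = pair (bit S n) (v n)
    coded-join⁺ : ∀ S v m → m ∈ S → m ∈ Coded (join S v)
    coded-join⁺ S v m m∈S = trans (cong proj₁ (unpair-pair (bit S m) (v m))) (cong (if_then 0 else 1) (truth⁺ m∈S))
    coded-join⁻ : ∀ S v m → m ∈ Coded (join S v) → m ∈ S
    coded-join⁻ S v m e = by-contradiction λ m∉S →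
      1≢0 (trans (cong (if_then 0 else 1) (sym (¬-not λ t → m∉S (truth⁻ t))))
                 (trans (sym (cong proj₁ (unpair-pair (bit S m) (v m)))) e))
      where
      1≢0 : 1 ≢ 0
      1≢0 ()

  -- The unfolded game

  length-⊆ : ∀ {ns} (l : List ℕ) → Unique ns → (∀ {x} → x ∈ₗ ns → x ∈ₗ l) → length ns ℕ.≤ length l
  length-⊆ {[]} l _ _ = z≤n
  length-⊆ {x ∷ ns} l (x∉ns ∷ unique) sub with ∈-∃++ (sub (here refl))
  ... | l₁ , l₂ , refl = subst (suc (length ns) ℕ.≤_)
      (sym (trans (Listₚ.length-++ l₁)
          (trans (ℕₚ.+-suc (length l₁) (length l₂)) (cong suc (sym (Listₚ.length-++ l₁))))))
                           (s≤s (length-⊆ (l₁ ++ l₂) unique rest))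
    where
    rest : ∀ {y} → y ∈ₗ ns → y ∈ₗ l₁ ++ l₂
    rest y∈ns with ∈-++⁻ l₁ (sub (there y∈ns))
    ... | inj₁ y∈l₁         = ∈-++⁺ˡ y∈l₁
    ... | inj₂ (here refl)  = ⊥-elim (All.lookup x∉ns y∈ns refl)
    ... | inj₂ (there y∈l₂) = ∈-++⁺ʳ l₁ y∈l₂

  Legal : ℕ → FinSet → FinSet → Set
  Legal k G F = (∀ {x} → x ∈ₗ F → ¬ x ∈ₗ G) × # F ℕ.≤ k

  module Unfolded {𝓙 : Family 0ℓ} (ideal : IsIdeal 𝓙) (closedBase : ClosedBase 𝓙) (A : Subset) (f : A ⟶ω) where
    open IsIdeal ideal
    open ClosedBase closedBase

    -- The commitments `u` can still be completed to a point of the base whose set covers everything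
    -- that `F` has contributed.
    Live : List ℕ → FinSet → Set
    Live u F = ∃[ w ] Base w × u ≡ applyUpTo w (length u) × preimage A f ⟦ F ⟧ ⊆ Coded w

    module _ (k : ℕ) (σ : List FinSet → FinSet × ℕ) where
      bound-after : List FinSet → ℕ
      bound-after []       = k
      bound-after (G ∷ Gs) = proj₂ (σ (G ∷ Gs))

    played : FinSet → (List FinSet → FinSet × ℕ) → List FinSet → FinSet
    played F σ []       = F
    played F σ (G ∷ Gs) = proj₁ (σ (G ∷ Gs)) ++ played F σ Gs

    -- In the unfolded game Player II also builds a point of Base: in every round he may
    -- commit to its next value, the number of rounds that he has waited.  Winning u F k:
    -- Player I, having played F, wins against the initial segment u when allowed k points.
    -- Histories of moves of Player II are listed backwards.
    data Winning (u : List ℕ) (F : FinSet) (k : ℕ) : Set where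
      dead : ¬ Live u F → Winning u F k
      plan : (σ : List FinSet → FinSet × ℕ) →
             (∀ Gs G → Legal (bound-after k σ Gs) G (proj₁ (σ (G ∷ Gs)))) →
             (∀ Gs G → Winning (u ∷ʳ length Gs) (played F σ (G ∷ Gs)) (proj₂ (σ (G ∷ Gs)))) →
             Winning u F k

    -- Player I plays the original game against all commitments of Player II at once:
    -- the threads are the positions of the unfolded game that are still possible.
    record Thread : Set where
      constructor thread
      field
        {u₀} : List ℕ
        {F₀} : FinSet
        {k₀} : ℕ
        σ    : List FinSet → FinSet × ℕ
        ok   : ∀ Gs G → Legal (bound-after k₀ σ Gs) G (proj₁ (σ (G ∷ Gs)))
        kids : ∀ Gs G → Winning (u₀ ∷ʳ length Gs) (played F₀ σ (G ∷ Gs)) (proj₂ (σ (G ∷ Gs)))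
        Gs   : List FinSet
    open Thread

    spawn : ∀ {u F k} → Winning u F k → List Thread
    spawn (dead _)         = []
    spawn (plan σ ok kids) = thread σ ok kids [] ∷ []

    answer : FinSet → Thread → FinSet
    answer G t = proj₁ (σ t (G ∷ Gs t))

    allowance : Thread → ℕ
    allowance t = bound-after (k₀ t) (σ t) (Gs t)

    -- In one round Player II of the unfolded game may go on waiting or commit now, and both
    -- continuations are kept.
    continue : FinSet → Thread → List Thread
    continue G t = thread (σ t) (ok t) (kids t) (G ∷ Gs t) ∷ spawn (kids t (Gs t) G)

    advance : List Thread → FinSet → List Thread
    advance ts G = concatMap (continue G) ts

    answers : List Thread → FinSet → FinSet
    answers ts G = concatMap (answer G) ts

    total : List Thread → ℕ
    total ts = sum (map allowance ts)

    reply : List Thread → List FinSet → FinSet × ℕ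
    -- A default: Player II has always moved before a reply is due.
    reply ts []            = [] , 0
    reply ts (G ∷ [])      = answers ts G , total (advance ts G)
    reply ts (G ∷ G′ ∷ Gs) = reply (advance ts G) (G′ ∷ Gs)

    threads : List Thread → (ℕ → FinSet) → ℕ → List Thread
    threads ts G zero    = ts
    threads ts G (suc n) = threads (advance ts (G 0)) (G ∘ suc) n

    threads-suc : ∀ ts G n → threads ts G (suc n) ≡ advance (threads ts G n) (G n)
    threads-suc ts G zero    = refl
    threads-suc ts G (suc n) = threads-suc (advance ts (G 0)) (G ∘ suc) n

    reply-≡ : ∀ ts G n → reply ts (applyUpTo G (suc n)) ≡
              (answers (threads ts G n) (G n) , total (advance (threads ts G n) (G n)))
    reply-≡ ts G zero    = refl
    reply-≡ ts G (suc n) = reply-≡ (advance ts (G 0)) (G ∘ suc) n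

    answers-legal : ∀ ts G → Legal (total ts) G (answers ts G)
    answers-legal ts G = disjoint ts ,
      ℕₚ.≤-trans (length-⊆ (deduplicated ts) (deduplicate-! (answers ts G))
          (λ x∈ → covers ts (∈-deduplicate⁻ ℕₚ._≟_ (answers ts G) x∈)))
        (size ts)
      where
      disjoint : ∀ ts {x} → x ∈ₗ answers ts G → ¬ x ∈ₗ G
      disjoint (t ∷ ts) x∈ with ∈-++⁻ (answer G t) x∈
      ... | inj₁ x∈t  = proj₁ (ok t (Gs t) G) x∈t
      ... | inj₂ x∈ts = disjoint ts x∈ts
      deduplicated : List Thread → List ℕ
      deduplicated []       = []
      deduplicated (t ∷ ts) = deduplicate ℕₚ._≟_ (answer G t) ++ deduplicated ts
      covers : ∀ ts {x} → x ∈ₗ answers ts G → x ∈ₗ deduplicated ts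
      covers (t ∷ ts) x∈ with ∈-++⁻ (answer G t) x∈
      ... | inj₁ x∈t  = ∈-++⁺ˡ (∈-deduplicate⁺ ℕₚ._≟_ x∈t)
      ... | inj₂ x∈ts = ∈-++⁺ʳ (deduplicate ℕₚ._≟_ (answer G t)) (covers ts x∈ts)
      size : ∀ ts → length (deduplicated ts) ℕ.≤ total ts
      size []       = z≤n
      size (t ∷ ts) = subst (ℕ._≤ total (t ∷ ts)) (sym (Listₚ.length-++ (deduplicate ℕₚ._≟_ (answer G t))))
                        (ℕₚ.+-mono-≤ (proj₂ (ok t (Gs t) G)) (size ts))

    winning⇒playerIWins : ∀ {k} → Winning [] [] k → PlayerIWins 𝓙 A f
    winning⇒playerIWins {k} p = strategy , wins
      where
      ts₀ = spawn p
      strategy : StrategyI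
      strategy = record { first = total ts₀ ; respond = reply ts₀ }
      wins : IsWinning 𝓙 A f strategy
      wins G = (λ n → (λ x (x∈F , x∈G) → proj₁ (legal n) x∈F x∈G) , proj₂ (legal n)) , positive
        where
        ts : ℕ → List Thread
        ts = threads ts₀ G
        F-≡ : ∀ n → Play.F strategy G n ≡ answers (ts n) (G n)
        F-≡ n = cong proj₁ (reply-≡ ts₀ G n)
        k-≡ : ∀ n → Play.k strategy G n ≡ total (ts n)
        k-≡ zero    = refl
        k-≡ (suc n) = trans (cong proj₂ (reply-≡ ts₀ G n)) (cong total (sym (threads-suc ts₀ G n)))
        legal : ∀ n → Legal (Play.k strategy G n) (G n) (Play.F strategy G n)
        legal n = subst₂ (λ k F → Legal k (G n) F) (sym (k-≡ n)) (sym (F-≡ n)) (answers-legal (ts n) (G n))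
        Fω : Subset
        Fω = ⋃ ℕ λ n → ⟦ Play.F strategy G n ⟧
        positive : preimage A f Fω ∉ (𝓙 ↾ A)
        positive (S , S∈𝓙 , sub , _) with base-complete S∈𝓙
        ... | w , w∈Base , S⊆w = follow p 0 id refl λ ()
          where
          -- The thread that commits to w never dies, against the well-foundedness of Winning.
          follow : ∀ {u F k} (q : Winning u F k) n → (∀ {t} → t ∈ₗ spawn q → t ∈ₗ ts n) →
                   u ≡ applyUpTo w (length u) → (∀ {x} → x ∈ₗ F → x ∈ Fω) → ⊥
          follow (dead ¬live) n _ u≡ F⊆ = ¬live (w , w∈Base , u≡ , λ (x∈A , fx∈F) → S⊆w (proj₁ (sub (x∈A , F⊆ fx∈F))))
          follow {u} {F} (plan σ ok kids) n here-now u≡ F⊆ =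
            let j = w (length u)
                (Gs , len , t∈ , F⊆′) = wait j
            in follow (kids Gs (G (j ℕ.+ n))) (suc (j ℕ.+ n)) (λ t′∈ → later (j ℕ.+ n) t∈ (there t′∈))
                 (commit Gs len) (extend-played (j ℕ.+ n) Gs t∈ F⊆′)
            where
            later : ∀ n {t t′} → t ∈ₗ ts n → t′ ∈ₗ continue (G n) t → t′ ∈ₗ ts (suc n)
            later n t∈ t′∈ = subst (_ ∈ₗ_) (sym (threads-suc ts₀ G n)) (∈-concat⁺′ t′∈ (∈-map⁺ (continue (G n)) t∈))
            extend-played : ∀ n Gs → thread {u} {F} σ ok kids Gs ∈ₗ ts n → (∀ {x} → x ∈ₗ played F σ Gs → x ∈ Fω) →
                            ∀ {x} → x ∈ₗ played F σ (G n ∷ Gs) → x ∈ Fω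
            extend-played n Gs t∈ F⊆ {x} x∈ with ∈-++⁻ (proj₁ (σ (G n ∷ Gs))) x∈
            ... | inj₂ x∈F = F⊆ x∈F
            ... | inj₁ x∈a = n , subst (x ∈ₗ_) (sym (F-≡ n)) (∈-concat⁺′ x∈a (∈-map⁺ (answer (G n)) t∈))
            wait : ∀ j → ∃[ Gs ] length Gs ≡ j × thread {u} {F} σ ok kids Gs ∈ₗ ts (j ℕ.+ n) ×
                                (∀ {x} → x ∈ₗ played F σ Gs → x ∈ Fω)
            wait zero    = [] , refl , here-now (here refl) , F⊆
            wait (suc j) =
              let (Gs , len , t∈ , F⊆′) = wait j
              in G (j ℕ.+ n) ∷ Gs , cong suc len , later (j ℕ.+ n) t∈ (here refl) , extend-played (j ℕ.+ n) Gs t∈ F⊆′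
            commit : ∀ Gs → length Gs ≡ w (length u) → u ∷ʳ length Gs ≡ applyUpTo w (length (u ∷ʳ length Gs))
            commit Gs len = trans (cong₂ _∷ʳ_ u≡ len)
              (trans (Listₚ.applyUpTo-∷ʳ w (length u)) (cong (applyUpTo w) (sym (length-∷ʳ u (length Gs)))))

  -- The play of Player II when Player I does not win the unfolded game

  module SecondPlayer {𝓙 : Family 0ℓ} (ideal : IsIdeal 𝓙) (closedBase : ClosedBase 𝓙) (A : Subset) (f : A ⟶ω) where
    open IsIdeal ideal
    open ClosedBase closedBase
    open Unfolded ideal closedBase A f

    -- Player II can force a commitment to a position not won by Player I, having waited n rounds.
    data Forcing (u : List ℕ) (n : ℕ) (F : FinSet) (k : ℕ) : Set where
      force : (G : FinSet) →
              (∀ F′ k′ → Legal k G F′ → Winning (u ∷ʳ n) (F′ ++ F) k′ → Forcing u (suc n) (F′ ++ F) k′) →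
              Forcing u n F k

    record Position : Set where
      constructor position
      field
        u : List ℕ
        n : ℕ
        F : FinSet
        k : ℕ
        p : Forcing u n F k
    open Position

    not-winning⇒live : ∀ {u F k} → ¬ Winning u F k → Live u F
    not-winning⇒live lost = by-contradiction λ ¬live → lost (dead ¬live)

    -- If Player II could not force, every `G` would have a legal reply after which a commitment is
    -- won by Player I while waiting still forces nothing. Such replies, made round after round,
    -- form a `plan`.
    not-winning⇒forcing : ∀ {u F k} → ¬ Winning u F k → Forcing u 0 F k
    not-winning⇒forcing {u} {F} {k} lost = by-contradiction λ ¬forcing → lost (winning ¬forcing)
      where
      reply-to : ∀ {n F k} → ¬ Forcing u n F k → ∀ G → ∃[ F′ ] ∃[ k′ ] Legal k G F′ ×
                 Winning (u ∷ʳ n) (F′ ++ F) k′ × ¬ Forcing u (suc n) (F′ ++ F) k′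
      reply-to ¬forcing G = by-contradiction λ none → ¬forcing (force G λ F′ k′ ok w →
        by-contradiction λ ¬forcing′ → none (F′ , k′ , ok , w , ¬forcing′))
      winning : ¬ Forcing u 0 F k → Winning u F k
      winning ¬forcing = plan σ ok kids
        where
        after : ∀ Gs → ∃[ F′ ] ∃[ k′ ] ¬ Forcing u (length Gs) F′ k′
        after []       = F , k , ¬forcing
        after (G ∷ Gs) =
          let (F₁ , k₁ , ¬forcing₁) = after Gs
              (F′ , k′ , _ , _ , ¬forcing′) = reply-to ¬forcing₁ G
          in F′ ++ F₁ , k′ , ¬forcing′
        move : ∀ Gs G → _
        move Gs G = reply-to (proj₂ (proj₂ (after Gs))) G
        σ : List FinSet → FinSet × ℕ
        σ []       = [] , 0
        σ (G ∷ Gs) = proj₁ (move Gs G) , proj₁ (proj₂ (move Gs G))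
        bound-≡ : ∀ Gs → bound-after k σ Gs ≡ proj₁ (proj₂ (after Gs))
        bound-≡ []       = refl
        bound-≡ (G ∷ Gs) = refl
        played-≡ : ∀ Gs → played F σ Gs ≡ proj₁ (after Gs)
        played-≡ []       = refl
        played-≡ (G ∷ Gs) = cong (proj₁ (move Gs G) ++_) (played-≡ Gs)
        ok : ∀ Gs G → Legal (bound-after k σ Gs) G (proj₁ (σ (G ∷ Gs)))
        ok Gs G = subst (λ k → Legal k G (proj₁ (σ (G ∷ Gs)))) (sym (bound-≡ Gs)) (proj₁ (proj₂ (proj₂ (move Gs G))))
        kids : ∀ Gs G → Winning (u ∷ʳ length Gs) (played F σ (G ∷ Gs)) (proj₂ (σ (G ∷ Gs)))
        kids Gs G = subst (λ F → Winning (u ∷ʳ length Gs) F (proj₂ (σ (G ∷ Gs)))) (sym (played-≡ (G ∷ Gs)))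
                      (proj₁ (proj₂ (proj₂ (proj₂ (move Gs G)))))

    demand : Position → FinSet
    demand (position u n F k (force G h)) = G

    -- After a legal move Player II waits as long as a commitment would lead to a position won by
    -- Player I, and commits as soon as it would not.
    proceed : ∀ {u n F k} (p : Forcing u n F k) F′ k′ →
              Dec (Legal k (demand (position u n F k p)) F′) → Dec (Winning (u ∷ʳ n) (F′ ++ F) k′) → Position
    proceed {u} {n} {F} {k} (force G h) F′ k′ (no _)   _         = position u n F k (force G h)
    proceed {u} {n} {F} {k} (force G h) F′ k′ (yes ok) (yes w)   = position u (suc n) (F′ ++ F) k′ (h F′ k′ ok w)
    proceed {u} {n} {F} {k} (force G h) F′ k′ (yes ok) (no lost) =
        position (u ∷ʳ n) 0 (F′ ++ F) k′ (not-winning⇒forcing lost)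

    -- Illegal moves of Player I are ignored.
    after-move : Position → FinSet × ℕ → Position
    after-move s (F′ , k′) = proceed (p s) F′ k′ em em

    after-legal : ∀ s F′ k′ → Legal (k s) (demand s) F′ →
                  (∃[ e ] u (after-move s (F′ , k′)) ≡ u s ++ e) × F (after-move s (F′ , k′)) ≡ F′ ++ F s ×
                      k (after-move s (F′ , k′)) ≡ k′
    after-legal s F′ k′ ok = spec (p s) em em ok
      where
      spec : ∀ {u₀ n₀ F₀ k₀} (q : Forcing u₀ n₀ F₀ k₀) dl dw → Legal k₀ (demand (position u₀ n₀ F₀ k₀ q)) F′ →
             (∃[ e ] u (proceed q F′ k′ dl dw) ≡ u₀ ++ e) × F (proceed q F′ k′ dl dw) ≡ F′ ++ F₀ ×
                 k (proceed q F′ k′ dl dw) ≡ k′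
      spec (force G h) (no ¬ok) _       ok = ⊥-elim (¬ok ok)
      spec (force G h) (yes _)  (yes _) ok = ([] , sym (Listₚ.++-identityʳ _)) , refl , refl
      spec (force G h) (yes _)  (no _)  ok = (_ , refl) , refl , refl

    module Run-against (s : ℕ → Position) (move : ℕ → FinSet × ℕ)
                       (legal : ∀ i → Legal (k (s i)) (demand (s i)) (proj₁ (move i)))
                       (moves : ∀ i → s (suc i) ≡ after-move (s i) (move i)) where

      Commits : ℕ → Set
      Commits i = length (u (s (suc i))) ≡ suc (length (u (s i))) × Live (u (s (suc i))) (F (s (suc i)))

      -- Each round of waiting descends in the well-founded `Forcing`, so Player II cannot wait
      -- forever.
      commits-within : ∀ {u₀ n₀ F₀ k₀} (q : Forcing u₀ n₀ F₀ k₀) i → s i ≡ position u₀ n₀ F₀ k₀ q →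
                       ∃[ j ] i ℕ.≤ j × Commits j
      commits-within {u₀} {n₀} {F₀} {k₀} (force G h) i s≡ =
        moved em em (trans (moves i) (cong (λ s → after-move s (move i)) s≡))
        where
        F′ = proj₁ (move i)
        k′ = proj₂ (move i)
        moved : (dl : Dec (Legal k₀ G F′)) (dw : Dec (Winning (u₀ ∷ʳ n₀) (F′ ++ F₀) k′)) →
                s (suc i) ≡ proceed (force G h) F′ k′ dl dw → ∃[ j ] i ℕ.≤ j × Commits j
        moved (no ¬ok) _ _ = ⊥-elim (¬ok (subst (λ s → Legal (k s) (demand s) F′) s≡ (legal i)))
        moved (yes ok) (yes w) e =
          let (j , i<j , c) = commits-within (h F′ k′ ok w) (suc i) e
          in j , ℕₚ.≤-trans (ℕₚ.n≤1+n i) i<j , c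
        moved (yes ok) (no lost) e = i , ℕₚ.≤-refl ,
          trans (cong (length ∘ u) e) (trans (length-∷ʳ u₀ n₀) (cong (suc ∘ length ∘ u) (sym s≡))) ,
          subst₂ Live (cong u (sym e)) (cong F (sym e)) (not-winning⇒live lost)

      u-step : ∀ i → ∃[ e ] u (s (suc i)) ≡ u (s i) ++ e
      u-step i = subst (λ s′ → ∃[ e ] u s′ ≡ u (s i) ++ e) (sym (moves i))
                   (proj₁ (after-legal (s i) _ _ (legal i)))

      F-step : ∀ i → F (s (suc i)) ≡ proj₁ (move i) ++ F (s i)
      F-step i = trans (cong F (moves i)) (proj₁ (proj₂ (after-legal (s i) _ _ (legal i))))

      u-grows : ∀ i j → length (u (s i)) ℕ.≤ length (u (s (j ℕ.+ i)))
      u-grows i zero    = ℕₚ.≤-refl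
      u-grows i (suc j) = ℕₚ.≤-trans (u-grows i j) (subst (length (u (s (j ℕ.+ i))) ℕ.≤_)
        (sym (trans (cong length (proj₂ (u-step (j ℕ.+ i)))) (Listₚ.length-++ (u (s (j ℕ.+ i)))))) (ℕₚ.m≤m+n _ _))

      F-grows : ∀ i j {x} → x ∈ₗ F (s i) → x ∈ₗ F (s (j ℕ.+ i))
      F-grows i zero    x∈ = x∈
      F-grows i (suc j) x∈ = subst (_ ∈ₗ_) (sym (F-step (j ℕ.+ i))) (∈-++⁺ʳ _ (F-grows i j x∈))

      live-late : ∀ N → ∃[ i ] N ℕ.≤ i × N ℕ.≤ length (u (s i)) × Live (u (s i)) (F (s i))
      live-late zero =
        let (j , _ , _ , live) = commits-within (p (s 0)) 0 refl
        in suc j , z≤n , z≤n , live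
      live-late (suc N) =
        let (i , N≤i , N≤u , _) = live-late N
            (j , i≤j , len , live) = commits-within (p (s i)) i refl
            u≤u = subst (λ m → length (u (s i)) ℕ.≤ length (u (s m))) (ℕₚ.m∸n+n≡m i≤j) (u-grows i (j ℕ.∸ i))
        in suc j , s≤s (ℕₚ.≤-trans N≤i i≤j) , subst (suc N ℕ.≤_) (sym len) (s≤s (ℕₚ.≤-trans N≤u u≤u)) , live

      limit : ∃[ w ] ∀ i → u (s i) ≡ applyUpTo w (length (u (s i)))
      limit = chain-limit 0 (u ∘ s) u-step λ N → let (i , _ , N≤u , _) = live-late N in i , N≤u

      w : ℕ → ℕ
      w = proj₁ limit

      live-agrees : ∀ i ((v , _) : Live (u (s i)) (F (s i))) → v ≡[< length (u (s i)) ] w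
      live-agrees i (v , _ , u≡ , _) = applyUpTo-injective (length (u (s i))) (trans (sym u≡) (proj₂ limit i))

      -- Live positions supply points of the base that agree with `w` on longer and longer initial
      -- segments, and the base is closed.
      w∈Base : Base w
      w∈Base = by-contradiction λ miss →
        let (N , h) = base-closed w miss
            (i , _ , N≤u , live) = live-late N
        in h (proj₁ live) (λ m m<N → sym (live-agrees i live m (ℕₚ.<-≤-trans m<N N≤u))) (proj₁ (proj₂ live))

      run-small : preimage A f (⋃ ℕ λ i → ⟦ proj₁ (move i) ⟧) ∈ 𝓙
      run-small = ⊆-closed covered (base-sound w∈Base)
        where
        covered : preimage A f (⋃ ℕ λ i → ⟦ proj₁ (move i) ⟧) ⊆ Coded w
        covered {x} (x∈A , i , fx∈) =
          -- Late enough for `F` to contain the `i`-th move and for the coordinate `x` of `w` to be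
          -- committed.
          let (j , N≤j , N≤u , live) = live-late (suc (i ℕ.⊔ x))
              i<j = ℕₚ.≤-trans (s≤s (ℕₚ.m≤m⊔n i x)) N≤j
              x<u = ℕₚ.≤-trans (s≤s (ℕₚ.m≤n⊔m i x)) N≤u
              fx∈F = subst (λ m → f x x∈A ∈ₗ F (s m)) (ℕₚ.m∸n+n≡m i<j)
                       (F-grows (suc i) (j ℕ.∸ suc i) (subst (f x x∈A ∈ₗ_) (sym (F-step i)) (∈-++⁺ˡ fx∈)))
          in coded-agree {proj₁ live} {w} (live-agrees j live) x x<u (proj₂ (proj₂ (proj₂ live)) (x∈A , fx∈F))

  -- A winning strategy of Player II yields a tall summable ideal

  ×ℚ-monoˡ-≤ : ∀ {m n q} → 0ℚ ℚ.≤ q → m ℕ.≤ n → m ×ℚ q ℚ.≤ n ×ℚ q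
  ×ℚ-monoˡ-≤ {n = zero}  0≤q z≤n       = ℚₚ.≤-refl
  ×ℚ-monoˡ-≤ {n = suc n} {q} 0≤q z≤n   = ℚₚ.≤-trans (×ℚ-monoˡ-≤ {n = n} 0≤q z≤n)
    (subst (ℚ._≤ q ℚ.+ n ×ℚ q) (ℚₚ.+-identityˡ _) (ℚₚ.+-monoˡ-≤ (n ×ℚ q) 0≤q))
  ×ℚ-monoˡ-≤ {q = q} 0≤q (s≤s m≤n) = ℚₚ.+-monoʳ-≤ q (×ℚ-monoˡ-≤ 0≤q m≤n)

  -- So many points of weight 2^-i have total mass at least 1.
  size : ℕ → ℕ
  size i = proj₁ (archimedean 1ℚ (0<2^- i))

  module Blocks (m : ℕ → ℕ) (gaps : ∀ i → m i ℕ.+ suc (size i) ℕ.≤ m (suc i)) where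

    InBlock : ℕ → ℕ → Set
    InBlock x i = m i ℕ.≤ x × x ℕ.< m (suc i)

    m-increasing : ∀ i → m i ℕ.< m (suc i)
    m-increasing i = ℕₚ.≤-trans (ℕₚ.≤-trans (ℕₚ.≤-reflexive (ℕₚ.+-comm 1 (m i))) (ℕₚ.+-monoʳ-≤ (m i) (s≤s z≤n)))
        (gaps i)

    m-mono : ∀ {i j} → i ℕ.≤ j → m i ℕ.≤ m j
    m-mono {i} {j} i≤j = subst (λ k → m i ℕ.≤ m k) (ℕₚ.m∸n+n≡m i≤j) (grow (j ℕ.∸ i))
      where
      grow : ∀ k → m i ℕ.≤ m (k ℕ.+ i)
      grow zero    = ℕₚ.≤-refl
      grow (suc k) = ℕₚ.≤-trans (grow k) (ℕₚ.<⇒≤ (m-increasing (k ℕ.+ i)))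

    ≤-m : ∀ i → i ℕ.≤ m i
    ≤-m zero    = z≤n
    ≤-m (suc i) = ℕₚ.≤-trans (s≤s (≤-m i)) (m-increasing i)

    block-≥ : ∀ {x i n} → InBlock x i → m n ℕ.≤ x → n ℕ.≤ i
    block-≥ (_ , x<) mn≤x = ℕₚ.≮⇒≥ λ i<n → ℕₚ.<⇒≱ x< (ℕₚ.≤-trans (m-mono i<n) mn≤x)

    block-of : ∀ {x} → m 0 ℕ.≤ x → ∃[ i ] InBlock x i
    block-of {x} m0≤x = locate (suc x) (≤-m (suc x))
      where
      locate : ∀ N → x ℕ.< m N → ∃[ i ] InBlock x i
      locate zero    x<m = ⊥-elim (ℕₚ.<⇒≱ x<m m0≤x)
      locate (suc N) x<m with m N ℕₚ.≤? x
      ... | yes mN≤x = N , mN≤x , x<m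
      ... | no  mN≰x = locate N (ℕₚ.≰⇒> mN≰x)

    -- Weight 0 goes to the points below `m 0`, which lie in no block.
    weight-from : ∀ {x} → Dec (∃[ i ] InBlock x i) → ℚ
    weight-from (yes (i , _)) = 2^- i
    weight-from (no _)        = 0ℚ

    weight : ℕ → ℚ
    weight x = weight-from {x} em

    weight-≡ : ∀ {x i} → InBlock x i → weight x ≡ 2^- i
    weight-≡ {x} {i} b = go em
      where
      go : (d : Dec (∃[ i ] InBlock x i)) → weight-from {x} d ≡ 2^- i
      go (yes (j , b′)) = cong 2^- (ℕₚ.≤-antisym (block-≥ b (proj₁ b′)) (block-≥ b′ (proj₁ b)))
      go (no none)      = ⊥-elim (none (i , b))

    weight-nonneg : ∀ x → 0ℚ ℚ.≤ weight x
    weight-nonneg x = go em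
      where
      go : (d : Dec (∃[ i ] InBlock x i)) → 0ℚ ℚ.≤ weight-from {x} d
      go (yes (i , _)) = ℚₚ.<⇒≤ (0<2^- i)
      go (no _)        = ℚₚ.≤-refl

    weight-≤ : ∀ {x} n → m n ℕ.≤ x → weight x ℚ.≤ 2^- n
    weight-≤ {x} n mn≤x = go em
      where
      go : (d : Dec (∃[ i ] InBlock x i)) → weight-from {x} d ℚ.≤ 2^- n
      go (yes (i , b)) = subst (λ j → 2^- j ℚ.≤ 2^- n) (ℕₚ.m∸n+n≡m (block-≥ b mn≤x)) (2^-antitone n (i ℕ.∸ n))
      go (no _)        = ℚₚ.<⇒≤ (0<2^- n)

    h : ℕ → ℝ
    h x = fromℚ (weight x)

    full-block : ∀ i {ns} → All (λ x → InBlock x i) ns → size i ℕ.≤ length ns → fromℚ 1ℚ ⊴ sumℝ (map h ns)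
    full-block i {ns} ns∈ long = ⊴-trans
      (fromℚ-mono (ℚₚ.≤-trans (proj₂ (archimedean 1ℚ (0<2^- i))) (×ℚ-monoˡ-≤ (ℚₚ.<⇒≤ (0<2^- i)) long)))
      (×-≤-sum h (2^- i) (All.map (λ b → fromℚ-mono (ℚₚ.≤-reflexive (sym (weight-≡ b)))) ns∈))

    h-nonneg : ∀ x → 0ℝ ⊴ h x
    h-nonneg x = fromℚ-mono (weight-nonneg x)

    h-tallSummable : TallSummable h
    h-tallSummable = record
      { nonneg    = λ x → ⊴⇒≤ℝ (h-nonneg x)
      ; divergent = not-summable {h} λ N →
          applyUpTo (m N ℕ.+_) (size N) ,
          Uniqueₚ.applyUpTo⁺₁ (m N ℕ.+_) (size N) (λ i<j _ e → ℕₚ.<⇒≢ i<j (ℕₚ.+-cancelˡ-≡ (m N) _ _ e)) ,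
          Allₚ.applyUpTo⁺₁ (m N ℕ.+_) (size N) (λ {i} _ → Unit.tt , ℕₚ.≤-trans (≤-m N) (ℕₚ.m≤m+n (m N) i)) ,
          full-block N (Allₚ.applyUpTo⁺₁ (m N ℕ.+_) (size N) λ {i} i< → ℕₚ.m≤m+n (m N) i ,
              ℕₚ.<-≤-trans (ℕₚ.+-monoʳ-< (m N) (ℕₚ.m≤n⇒m≤1+n i<)) (gaps N))
            (ℕₚ.≤-reflexive (sym (Listₚ.length-applyUpTo (m N ℕ.+_) (size N))))
      ; tall      = vanishing⇒tall h-nonneg λ n → m n , λ x mn≤x → fromℚ-mono (weight-≤ n mn≤x)
      }

    slice : Subset → ℕ → List ℕ
    slice B i = filter (λ x → em {P = x ∈ B × m i ℕ.≤ x}) (upTo (m (suc i)))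

    slice⁺ : ∀ {B i x} → x ∈ B → InBlock x i → x ∈ₗ slice B i
    slice⁺ {B} {i} x∈B (mi≤x , x<) = ∈-filter⁺ (λ x → em {P = x ∈ B × m i ℕ.≤ x}) (∈-upTo⁺ x<) (x∈B , mi≤x)

    slice⁻ : ∀ {B i x} → x ∈ₗ slice B i → x ∈ B × InBlock x i
    slice⁻ {B} {i} x∈ =
      let (x∈upTo , x∈B , mi≤x) = ∈-filter⁻ (λ x → em {P = x ∈ B × m i ℕ.≤ x}) {xs = upTo (m (suc i))} x∈
      in x∈B , mi≤x , ∈-upTo⁻ x∈upTo

    -- A slice with at least `size i` points has mass at least 1, and slices of that mass
    -- arbitrarily far out would make `B` non-summable.
    slices-short : ∀ {B} → B ∈ Summable h → ∃[ N ] ∀ i → N ℕ.≤ i → length (slice B i) ℕ.≤ size i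
    slices-short {B} B-summable = by-contradiction λ none → not-summable {h} (λ N →
      let (i , bad) = ¬∀⇒∃¬ λ short → none (N , short)
          N≤i = by-contradiction λ N≰i → bad λ N≤i → ⊥-elim (N≰i N≤i)
          long = ℕₚ.≰⇒≥ λ short → bad λ _ → short
      in slice B i ,
         Uniqueₚ.filter⁺ (λ x → em {P = x ∈ B × m i ℕ.≤ x}) (Uniqueₚ.upTo⁺ (m (suc i))) ,
         All.tabulate (λ x∈ → let (x∈B , mi≤x , _) = slice⁻ {B} {i} x∈ in x∈B ,
                                    ℕₚ.≤-trans N≤i (ℕₚ.≤-trans (≤-m i) mi≤x)) ,
         full-block i (All.tabulate λ x∈ → proj₂ (slice⁻ {B} {i} x∈)) long) B-summable

  subsequences : List ℕ → List (List ℕ)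
  subsequences []      = [] ∷ []
  subsequences (x ∷ l) = map (x ∷_) (subsequences l) ++ subsequences l

  []∈subsequences : ∀ l → [] ∈ₗ subsequences l
  []∈subsequences []      = here refl
  []∈subsequences (x ∷ l) = ∈-++⁺ʳ _ ([]∈subsequences l)

  filter∈subsequences : ∀ {P : Subset} (P? : ∀ x → Dec (P x)) l → filter P? l ∈ₗ subsequences l
  filter∈subsequences P? []      = here refl
  filter∈subsequences P? (x ∷ l) with P? x
  ... | yes _ = ∈-++⁺ˡ (∈-map⁺ (x ∷_) (filter∈subsequences P? l))
  ... | no  _ = ∈-++⁺ʳ _ (filter∈subsequences P? l)

  module LostGame {𝓙 : Family 0ℓ} (ideal : IsIdeal 𝓙) (closedBase : ClosedBase 𝓙) (A : Subset) (f : A ⟶ω)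
                  (toOne : ToOne 𝓙 A f) (lost : ¬ Unfolded.Winning ideal closedBase A f [] [] 0) where
    open IsIdeal ideal
    open SecondPlayer ideal closedBase A f
    open Position

    initial : Position
    initial = position [] 0 [] 0 (not-winning⇒forcing lost)

    demands-bounded : (L : List Position) → ∃[ N ] ∀ {s x} → s ∈ₗ L → x ∈ₗ demand s → x ℕ.< N
    demands-bounded [] = 0 , λ ()
    demands-bounded (s ∷ L) =
      let (N , below) = list-bound (demand s)
          (N′ , below′) = demands-bounded L
      in N ℕ.⊔ N′ , λ { (here refl) x∈ → ℕₚ.<-≤-trans (below x∈) (ℕₚ.m≤m⊔n N N′)
                      ; (there s∈)  x∈ → ℕₚ.<-≤-trans (below′ s∈ x∈) (ℕₚ.m≤n⊔m N N′) }

    moves-below : ℕ → ℕ → List (FinSet × ℕ)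
    moves-below b i = cartesianProduct (subsequences (upTo b)) (upTo (suc (size i)))

    -- After stage i, the positions that Player I can reach by moves inside the first i
    -- blocks, and the beginning of the i-th block, past everything demanded so far.
    mutual
      reachable : ℕ → List Position
      reachable zero    = initial ∷ []
      reachable (suc i) = reachable i ++ cartesianProductWith after-move (reachable i) (moves-below (m i) (suc i))

      m : ℕ → ℕ
      m zero    = proj₁ (demands-bounded (reachable zero))
      m (suc i) = (m i ℕ.+ suc (size i)) ℕ.⊔ proj₁ (demands-bounded (reachable (suc i)))

    demand-below : ∀ i {s x} → s ∈ₗ reachable i → x ∈ₗ demand s → x ℕ.< m i
    demand-below zero    s∈ x∈ = proj₂ (demands-bounded (reachable zero)) s∈ x∈
    demand-below (suc i) s∈ x∈ = ℕₚ.<-≤-trans (proj₂ (demands-bounded (reachable (suc i))) s∈ x∈)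
      (ℕₚ.m≤n⊔m (m i ℕ.+ suc (size i)) _)

    open Blocks m (λ i → ℕₚ.m≤m⊔n (m i ℕ.+ suc (size i)) (proj₁ (demands-bounded (reachable (suc i))))) public

    -- A move within the first blocks up to the `i`-th, made at stage `i`, is accounted for two
    -- stages later, with an allowance that suffices for a short slice of that later block.
    reachable-step : ∀ i {s F k} → s ∈ₗ reachable i → F ∈ₗ subsequences (upTo (m (suc i))) →
        k ℕ.≤ size (suc (suc i)) →
                     after-move s (F , k) ∈ₗ reachable (suc (suc i))
    reachable-step i s∈ F∈ k≤ = ∈-++⁺ʳ (reachable (suc i)) (∈-cartesianProductWith⁺ after-move (∈-++⁺ˡ s∈)
      (∈-cartesianProduct⁺ F∈ (∈-upTo⁺ (s≤s k≤))))

    -- Consecutive moves use every other block, so that Player II's answer is met in the block between.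
    every-other : ℕ → ℕ → ℕ
    every-other q zero    = q
    every-other q (suc n) = suc (suc (every-other q n))

    module _ {B : Subset} (N : ℕ) (short : ∀ i → N ℕ.≤ i → length (slice B i) ℕ.≤ size i) where

      -- From `N` on slices are short enough to be played. The bound 2 empties the first move, whose
      -- index is 0 or 1, since the initial position allows no points.
      cut : ∀ i → Dec (2 ℕ.⊔ N ℕ.≤ i) → List ℕ
      cut i (yes _) = slice B i
      cut i (no _)  = []

      late? : ∀ i → Dec (2 ℕ.⊔ N ℕ.≤ i)
      late? i = 2 ℕ.⊔ N ℕₚ.≤? i

      late : ℕ → List ℕ
      late i = cut i (late? i)

      cut∈subsequences : ∀ i d → cut i d ∈ₗ subsequences (upTo (m (suc i)))
      cut∈subsequences i (yes _) = filter∈subsequences _ (upTo (m (suc i)))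
      cut∈subsequences i (no _)  = []∈subsequences (upTo (m (suc i)))

      cut-short : ∀ i d → length (cut i d) ℕ.≤ size i
      cut-short i (yes le) = short i (ℕₚ.m⊔n≤o⇒n≤o 2 N le)
      cut-short i (no _)   = z≤n

      cut-≥ : ∀ i d {x} → x ∈ₗ cut i d → m i ℕ.≤ x
      cut-≥ i (yes _) x∈ = proj₁ (proj₂ (slice⁻ {B} {i} x∈))

      cut-early : ∀ i d → i ℕ.< 2 → cut i d ≡ []
      cut-early i (yes le) i<2 = ⊥-elim (ℕₚ.<⇒≱ i<2 (ℕₚ.m⊔n≤o⇒m≤o 2 N le))
      cut-early i (no _)   _   = refl

      module _ (q : ℕ) (q<2 : q ℕ.< 2) where

        index : ℕ → ℕ
        index = every-other q

        move : ℕ → FinSet × ℕ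
        -- The allowance announced is exactly what the next slice of `B` in this run needs.
        move n = late (index n) , length (late (index (suc n)))

        s : ℕ → Position
        s zero    = initial
        s (suc n) = after-move (s n) (move n)

        s∈reachable : ∀ n → s n ∈ₗ reachable (index n)
        s∈reachable zero = start q
          where
          start : ∀ q → initial ∈ₗ reachable q
          start zero    = here refl
          start (suc q) = ∈-++⁺ˡ (start q)
        s∈reachable (suc n) = reachable-step (index n) (s∈reachable n) (cut∈subsequences (index n) (late? (index n)))
          (cut-short (index (suc n)) (late? (index (suc n))))

        legal-when : ∀ n → length (late (index n)) ℕ.≤ k (s n) → Legal (k (s n)) (demand (s n)) (late (index n))
        legal-when n le =
          (λ x∈F x∈G → ℕₚ.<⇒≱ (demand-below (index n) (s∈reachable n) x∈G) (cut-≥ (index n) (late? (index n)) x∈F)) ,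
          ℕₚ.≤-trans (Listₚ.length-deduplicate ℕₚ._≟_ (late (index n))) le

        allowed : ∀ n → length (late (index n)) ℕ.≤ k (s n)
        allowed zero    = ℕₚ.≤-reflexive (cong length (cut-early q (late? q) q<2))
        allowed (suc n) = ℕₚ.≤-reflexive (sym (proj₂ (proj₂ (after-legal (s n) _ _ (legal-when n (allowed n))))))

        alternate-small : preimage A f (⋃ ℕ λ n → ⟦ late (index n) ⟧) ∈ 𝓙
        alternate-small = Run-against.run-small s move (λ n → legal-when n (allowed n)) λ _ → refl

      finite-small : ∀ l → preimage A f ⟦ l ⟧ ∈ 𝓙
      finite-small []      = finite ([] , λ { (_ , ()) })
      finite-small (x ∷ l) = ⊆-closed (λ { (n∈A , here e) → inj₁ (n∈A , e) ; (n∈A , there fn∈l) → inj₂ (n∈A , fn∈l) })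
        (∪-closed (toOne x) (finite-small l))

      parity : ∀ i → (∃[ n ] every-other 0 n ≡ i) ⊎ (∃[ n ] every-other 1 n ≡ i)
      parity zero          = inj₁ (0 , refl)
      parity (suc zero)    = inj₂ (0 , refl)
      parity (suc (suc i)) with parity i
      ... | inj₁ (n , e) = inj₁ (suc n , cong (suc ∘ suc) e)
      ... | inj₂ (n , e) = inj₂ (suc n , cong (suc ∘ suc) e)

      -- `B` splits into a finite beginning, small because `f` is 𝓙-to-one, and the slices of even
      -- and of odd index, each played in a run that Player II wins.
      preimage-small : preimage A f B ∈ 𝓙
      preimage-small = ⊆-closed (λ {x} (x∈A , fx∈B) → cover x∈A fx∈B (f x x∈A ℕₚ.<? m (2 ℕ.⊔ N)))
        (∪-closed (finite-small (upTo (m (2 ℕ.⊔ N))))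
          (∪-closed (alternate-small 0 (s≤s z≤n)) (alternate-small 1 (s≤s (s≤s z≤n)))))
        where
        in-cut : ∀ {x} i d → x ∈ B → InBlock x i → 2 ℕ.⊔ N ℕ.≤ i → x ∈ₗ cut i d
        in-cut i (yes _)  x∈B b le = slice⁺ {B} {i} x∈B b
        in-cut i (no ¬le) x∈B b le = ⊥-elim (¬le le)
        cover : ∀ {x} (x∈A : x ∈ A) → f x x∈A ∈ B → Dec (f x x∈A ℕ.< m (2 ℕ.⊔ N)) →
                x ∈ preimage A f ⟦ upTo (m (2 ℕ.⊔ N)) ⟧ ∪ (preimage A f (⋃ ℕ λ n → ⟦ late (every-other 0 n) ⟧)
                                                        ∪ preimage A f (⋃ ℕ λ n → ⟦ late (every-other 1 n) ⟧))
        cover x∈A fx∈B (yes fx<) = inj₁ (x∈A , ∈-upTo⁺ fx<)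
        cover {x} x∈A fx∈B (no fx≮) with block-of (ℕₚ.≤-trans (m-mono {0} {2 ℕ.⊔ N} z≤n) (ℕₚ.≮⇒≥ fx≮))
        ... | i , b with parity i
        ...   | inj₁ (n , refl) = inj₂ (inj₁ (x∈A , n , in-cut i (late? i) fx∈B b (block-≥ b (ℕₚ.≮⇒≥ fx≮))))
        ...   | inj₂ (n , refl) = inj₂ (inj₂ (x∈A , n , in-cut i (late? i) fx∈B b (block-≥ b (ℕₚ.≮⇒≥ fx≮))))

    katetovAbove : KatetovAbove A (𝓙 ↾ A) (Summable h)
    katetovAbove = f , λ B B-summable →
      let (N , short) = slices-short B-summable
      in preimage A f B , preimage-small N short , (λ x∈ → x∈ , proj₁ x∈) , proj₁

  winsEverywhere : ∀ {𝓙 : Family 0ℓ} → IsIdeal 𝓙 → Borel 𝓙 →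
    (∀ A → A ∉ 𝓙 → ∀ g → TallSummable g → ¬ KatetovAbove A (𝓙 ↾ A) (Summable g)) → WinsEverywhere 𝓙
  winsEverywhere {𝓙} ideal borel not-above A A∉𝓙 f toOne = Unfolded.winning⇒playerIWins ideal code𝓙 A f
    (by-contradiction λ lost → let open LostGame ideal code𝓙 A f toOne lost in
      not-above A A∉𝓙 h h-tallSummable katetovAbove)
    where
    code𝓙 : ClosedBase 𝓙
    code𝓙 = closedBase (proj₁ (borel-analytic borel))

theorem5p7 : (∀ {ℓ} → ExcludedMiddle ℓ) →
    (∀ {a b} → Extensionality a b) →
    (𝓘 𝓙 : Family 0ℓ) → IsIdeal 𝓘 → IsIdeal 𝓙 →
    (∃[ g ] TallSummable g × Summable g ⊆ 𝓘) →
    ((∀ A → A ∉ 𝓙 → (f : A ⟶ω) → ToOne 𝓙 A f → PlayerIWins 𝓙 A f)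
    ⊎
    (Borel 𝓙 ×
    (∀ A → A ∉ 𝓙 → ∀ g → TallSummable g →
    ¬ KatetovAbove A (𝓙 ↾ A) (Summable g)))) →
    (cov fip : Cardinal) → IsCovM cov → IsFip 𝓘 𝓙 ω^ω fip →
    cov ≼ fip
theorem5p7 em ext 𝓘 𝓙 ideal𝓘 ideal𝓙 summable (inj₁ wins) cov fip covM isFip =
  covM≼fip em ext ideal𝓘 ideal𝓙 summable wins covM isFip
theorem5p7 em ext 𝓘 𝓙 ideal𝓘 ideal𝓙 summable (inj₂ (borel , not-above)) cov fip covM isFip =
  covM≼fip em ext ideal𝓘 ideal𝓙 summable (winsEverywhere em ext ideal𝓙 borel not-above) covM isFip
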